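{- Let $b=p_1^{l_1}\cdots p_s^{l_s}$ with $s\ge 2$, where $p_1,\ldots,p_s$ are distinct primes and $l_1,\ldots,l_s\geq1$ are integers, and put $b_i=p_i^{l_i}$. For each $i=1,\ldots,s$ let $f_i\colon\mathbb{Z}_{p_i}\to\mathbb{Q}_{p_i}$ be an analytic function that is not identically zero, and let $f=(f_1,\ldots,f_s)$. Let $\mathcal{R}_f=\mathcal{R}_{f_1}\times\cdots\times\mathcal{R}_{f_s}\subset\mathbb{Z}_b$, where $\mathcal{R}_{f_i}$ is the set of roots of $f_i$ in $\mathbb{Z}_{p_i}$. Let $d\ge1$ be an integer. Then the sequence $(\ell_{b,d}(f(n)))_{n\ge0}$ is (a) periodic if $\mathcal{R}_f=\varnothing$, and a power of $b$ can be chosen as a period; (b) strictly $k$-automatic if $\mathcal{R}_f=\{\theta\}$ for some $\theta\in\mathbb{Q}\cap\mathbb{Z}_b$, where $k=b_1^{w_1}\cdots b_s^{w_s}$ and $w_1,\ldots,w_s$ are positive integers satisfying $w_1m_{f_1}(\theta)=\cdots=w_sm_{f_s}(\theta)$; (c) not automatic otherwise. In particular, these conditions do not depend on $d$.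
   Context: $\mathbb{N}=\{0,1,2,\ldots\}$. A function $\mathbb{Z}_p\to\mathbb{Q}_p$ is analytic if it is given by a single Taylor (power) series convergent on all of $\mathbb{Z}_p$; $m_{f_i}(\theta)$ denotes the multiplicity of $\theta$ as a root of $f_i$. Put $\mathbb{Z}_b=\mathbb{Z}_{p_1}\times\cdots\times\mathbb{Z}_{p_s}$ and $\mathbb{Q}_b=\mathbb{Q}_{p_1}\times\cdots\times\mathbb{Q}_{p_s}$; $\mathbb{Q}$ is identified with its diagonal image in $\mathbb{Q}_b$ under $x\mapsto(x,\ldots,x)$. For $n\in\mathbb{N}$, $f(n)=(f_1(n),\ldots,f_s(n))\in\mathbb{Q}_b$. For $x=(x_1,\ldots,x_s)\in\mathbb{Q}_b$ put $\nu_b(x)=\min_{1\le i\le s}\lfloor\nu_{p_i}(x_i)/l_i\rfloor$ (with $\nu_{p_i}(0)=+\infty$), $\mathcal{L}_b(x)=b^{ -\nu_b(x)}x\in\mathbb{Z}_b$ if $x\ne0$, and $\mathcal{L}_b(0)=0$. For $x\in\mathbb{Z}_b$, $x\bmod b^d$ is the unique $y\in\{0,\ldots,b^d-1\}$ with $y\equiv x_i\pmod{b_i^d}$ for all $i$. Put $\ell_{b,d}(x)=\mathcal{L}_b(x)\bmod b^d$. For an integer $k\ge2$, a sequence $(a_n)_{n\ge0}$ is $k$-automatic if its $k$-kernel $\{(a_{k^in+j})_{n\ge0}: i\ge0,\ 0\le j\le k^i-1\}$ is finite. It is automatic if it is $k$-automatic for some $k\ge2$. It is strictly $k$-automatic if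 it is $k$-automatic and is not $m$-automatic for any integer $m\ge2$ multiplicatively independent of $k$ (i.e. with $k^a\neq m^c$ for all integers $a,c\ge1$). A period need not be minimal. -}

module Defs where

open import Level using (0ℓ)
open import Algebra.Bundles using (RawRing)
import Algebra.Definitions.RawSemiring as RawSemiringDefs
open import Axiom.ExcludedMiddle using (ExcludedMiddle)
open import Data.Nat as ℕ using (ℕ; zero; suc; NonZero; _≤_; _<_)
import Data.Nat.Properties as ℕ
import Data.Nat.Divisibility as ℕ∣
import Data.Nat.DivMod as ℕ
open import Data.Nat.Coprimality as Coprimality using (Coprime; coprime-Bézout; coprime-divisor)
open import Data.Nat.GCD using (module Bézout)
open import Data.Nat.Induction using (<-rec)
open import Data.Nat.Primality using (Prime; prime⇒nonZero; prime⇒nonTrivial; prime⇒irreducible)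
open import Data.Integer as ℤ using (ℤ; +_; -[1+_]; 0ℤ; 1ℤ)
import Data.Integer.Properties as ℤ
import Data.Integer.DivMod as ℤ
open import Data.Integer.Divisibility.Signed
open import Data.Integer.Tactic.RingSolver using (solve-∀)
open import Data.Rational using (ℚ; ↥_; ↧ₙ_)
open import Data.Fin using (Fin; zero; suc; toℕ)
import Data.Fin.Properties as Fin
open import Data.Vec.Functional using (foldr)
open import Data.List.Relation.Unary.Any using (Any)
open import Data.Product using (∃-syntax; _×_; _,_; proj₁; proj₂)
open import Data.Sum using (inj₁; inj₂)
open import Function using (_∘_)
open import Function.Definitions using (Injective)
open import Relation.Unary using (Pred)
open import Relation.Nullary using (¬_; yes; no; contradiction)
open import Relation.Nullary.Construct.Add.Supremum using (_⁺; [_]; ⊤⁺)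
open import Relation.Binary.PropositionalEquality using (_≡_; _≢_; _≗_; refl; sym; trans; cong; cong₂; subst; module ≡-Reasoning)

------------------------------------------------------------------------
-- Elementary number theory

∣-resp : ∀ {k x y} → x ≡ y → k ∣ x → k ∣ y
∣-resp refl h = h

pos-mono : ∀ {m n} → m ℕ∣.∣ n → + m ∣ + n
pos-mono = ∣ᵤ⇒∣

∣0 : ∀ {k} → k ∣ 0ℤ
∣0 = divides 0ℤ refl

coprime-* : ∀ {a b n} → Coprime a n → Coprime b n → Coprime (a ℕ.* b) n
coprime-* ca cb {e} (e∣ab , e∣n) =
  cb (coprime-divisor (λ (x , y) → ca (y , ℕ∣.∣-trans x e∣n)) e∣ab , e∣n)

coprime-^ˡ : ∀ {a n} k → Coprime a n → Coprime (a ℕ.^ k) n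
coprime-^ˡ zero    c = Coprimality.1-coprimeTo _
coprime-^ˡ (suc k) c = coprime-* c (coprime-^ˡ k c)

coprime-^ʳ : ∀ {a n} k → Coprime a n → Coprime a (n ℕ.^ k)
coprime-^ʳ k = Coprimality.sym ∘ coprime-^ˡ k ∘ Coprimality.sym

∤⇒coprime : ∀ {p c} → Prime p → ¬ p ℕ∣.∣ c → Coprime c p
∤⇒coprime pr ∤c (e∣c , e∣p) with prime⇒irreducible pr e∣p
... | inj₁ e≡1 = e≡1
... | inj₂ refl = contradiction e∣c ∤c

distinct⇒coprime : ∀ {p q} → Prime p → Prime q → p ≢ q → Coprime p q
distinct⇒coprime pp pq p≢q (e∣p , e∣q) with prime⇒irreducible pp e∣p | prime⇒irreducible pq e∣q
... | inj₁ e≡1 | _ = e≡1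
... | inj₂ _ | inj₁ e≡1 = e≡1
... | inj₂ refl | inj₂ refl = contradiction refl p≢q

inverse-mod : ∀ {c n} → Coprime c n → ∃[ u ] (+ n) ∣ (+ c ℤ.* u ℤ.- 1ℤ)
inverse-mod {c} {n} cop with coprime-Bézout cop
... | Bézout.+- x y eq = + x , divides (+ y) (begin
  + c ℤ.* + x ℤ.- 1ℤ             ≡⟨ cong (ℤ._- 1ℤ) (ℤ.*-comm (+ c) (+ x)) ⟩
  + x ℤ.* + c ℤ.- 1ℤ             ≡⟨ cong (ℤ._- 1ℤ) (ℤ.pos-* x c) ⟨
  + (x ℕ.* c) ℤ.- 1ℤ             ≡⟨ cong (λ t → + t ℤ.- 1ℤ) eq ⟨
  + (1 ℕ.+ y ℕ.* n) ℤ.- 1ℤ       ≡⟨ cong (ℤ._- 1ℤ) (ℤ.pos-+ 1 (y ℕ.* n)) ⟩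
  1ℤ ℤ.+ + (y ℕ.* n) ℤ.- 1ℤ      ≡⟨ lem (+ (y ℕ.* n)) ⟩
  + (y ℕ.* n)                    ≡⟨ ℤ.pos-* y n ⟩
  + y ℤ.* + n                    ∎)
  where
  open ≡-Reasoning
  lem : ∀ t → 1ℤ ℤ.+ t ℤ.- 1ℤ ≡ t
  lem = solve-∀
... | Bézout.-+ x y eq = ℤ.- + x , divides (ℤ.- + y) (begin
  + c ℤ.* (ℤ.- + x) ℤ.- 1ℤ       ≡⟨ lem (+ c) (+ x) ⟩
  ℤ.- (1ℤ ℤ.+ + x ℤ.* + c)       ≡⟨ cong (λ t → ℤ.- (1ℤ ℤ.+ t)) (ℤ.pos-* x c) ⟨
  ℤ.- (1ℤ ℤ.+ + (x ℕ.* c))       ≡⟨ cong ℤ.-_ (ℤ.pos-+ 1 (x ℕ.* c)) ⟨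
  ℤ.- (+ (1 ℕ.+ x ℕ.* c))        ≡⟨ cong (λ t → ℤ.- + t) eq ⟩
  ℤ.- (+ (y ℕ.* n))              ≡⟨ cong ℤ.-_ (ℤ.pos-* y n) ⟩
  ℤ.- (+ y ℤ.* + n)              ≡⟨ ℤ.neg-distribˡ-* (+ y) (+ n) ⟩
  ℤ.- + y ℤ.* + n                ∎)
  where
  open ≡-Reasoning
  lem : ∀ c x → c ℤ.* (ℤ.- x) ℤ.- 1ℤ ≡ ℤ.- (1ℤ ℤ.+ x ℤ.* c)
  lem = solve-∀

coprime-cancel : ∀ {c n} → Coprime c n → ∀ {z} → + n ∣ + c ℤ.* z → + n ∣ z
coprime-cancel {c} {n} cop {z} h =
  ∣ᵤ⇒∣ (coprime-divisor (Coprimality.sym cop) (subst (n ℕ∣.∣_) (ℤ.abs-* (+ c) z) (∣⇒∣ᵤ h)))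

record Split (p m : ℕ) : Set where
  field
    v cofactor   : ℕ
    factorises   : m ≡ p ℕ.^ v ℕ.* cofactor
    p∤cofactor   : ¬ p ℕ∣.∣ cofactor

split : ∀ {p} → Prime p → (m : ℕ) .{{_ : NonZero m}} → Split p m
split {p} pr = λ m → <-rec (λ m → .(NonZero m) → Split p m) step m it
  where
  it : ∀ {m} .{{_ : NonZero m}} → NonZero m
  it {suc _} = _
  step : ∀ m → (∀ {k} → k < m → .(NonZero k) → Split p k) → .(NonZero m) → Split p m
  step (suc m) rec _ with p ℕ∣.∣? suc m
  ... | no p∤ = record { v = 0 ; cofactor = suc m ; factorises = sym (ℕ.+-identityʳ _) ; p∤cofactor = p∤ }
  ... | yes (ℕ∣.divides (suc q) eq) = record
    { v = suc (Split.v r) ; cofactor = Split.cofactor r ; p∤cofactor = Split.p∤cofactor r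
    ; factorises = trans eq (trans (cong (ℕ._* p) (Split.factorises r))
        (trans (ℕ.*-comm _ p) (sym (ℕ.*-assoc p _ (Split.cofactor r))))) }
    where
    r : Split p (suc q)
    r = rec (subst (suc q <_) (sym eq)
          (ℕ.m<m*n (suc q) p (ℕ.nonTrivial⇒n>1 p {{prime⇒nonTrivial pr}}))) _

/ℕ-shift : ∀ x y t P .{{_ : NonZero P}} → x ℤ.- y ≡ t ℤ.* + P → (x ℤ./ℕ P) ℤ.- (y ℤ./ℕ P) ≡ t
/ℕ-shift x y t P h = ℤ.*-cancelʳ-≡ e t (+ P) {{nz}} (begin
  e ℤ.* + P                        ≡⟨ ℤ.+-identityˡ _ ⟨
  0ℤ ℤ.+ e ℤ.* + P                 ≡⟨ cong (ℤ._+ e ℤ.* + P) D≡0 ⟨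
  (r₁ ℤ.- r₂) ℤ.+ e ℤ.* + P        ≡⟨ total ⟩
  t ℤ.* + P                        ∎)
  where
  open ≡-Reasoning
  nz : ℤ.NonZero (+ P)
  nz = ℤ.≢-nonZero λ eq → ℕ.≢-nonZero⁻¹ P (ℤ.+-injective eq)
  q₁ q₂ r₁ r₂ : ℤ
  q₁ = x ℤ./ℕ P
  q₂ = y ℤ./ℕ P
  r₁ = + (x ℤ.%ℕ P)
  r₂ = + (y ℤ.%ℕ P)
  lem : ∀ q₁ q₂ r₁ r₂ P → (r₁ ℤ.+ q₁ ℤ.* P) ℤ.- (r₂ ℤ.+ q₂ ℤ.* P) ≡ (r₁ ℤ.- r₂) ℤ.+ (q₁ ℤ.- q₂) ℤ.* P
  lem = solve-∀
  lem₂ : ∀ D e t P → D ≡ (D ℤ.+ e ℤ.* P) ℤ.- e ℤ.* P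
  lem₂ = solve-∀
  lem₃ : ∀ t e P → t ℤ.* P ℤ.- e ℤ.* P ≡ (t ℤ.- e) ℤ.* P
  lem₃ = solve-∀
  e : ℤ
  e = q₁ ℤ.- q₂
  total : (r₁ ℤ.- r₂) ℤ.+ e ℤ.* + P ≡ t ℤ.* + P
  total = trans (sym (lem q₁ q₂ r₁ r₂ (+ P)))
    (trans (sym (cong₂ ℤ._-_ (ℤ.a≡a%ℕn+[a/ℕn]*n x P) (ℤ.a≡a%ℕn+[a/ℕn]*n y P))) h)
  D≡ : r₁ ℤ.- r₂ ≡ (t ℤ.- e) ℤ.* + P
  D≡ = trans (lem₂ (r₁ ℤ.- r₂) e t (+ P)) (trans (cong (ℤ._- e ℤ.* + P) total) (lem₃ t e (+ P)))
  small : ℤ.∣ r₁ ℤ.- r₂ ∣ < P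
  small = ℕ.≤-<-trans
    (ℕ.≤-reflexive (cong ℤ.∣_∣ (ℤ.m-n≡m⊖n (x ℤ.%ℕ P) (y ℤ.%ℕ P))))
    (ℕ.≤-<-trans (ℤ.∣m⊝n∣≤m⊔n (x ℤ.%ℕ P) (y ℤ.%ℕ P))
      (ℕ.⊔-pres-<m (ℤ.n%ℕd<d x P) (ℤ.n%ℕd<d y P)))
  zero∣ : ∀ n → n < P → P ℕ∣.∣ n → n ≡ 0
  zero∣ zero    _   _  = refl
  zero∣ (suc n) n<P P∣ = contradiction (ℕ∣.∣⇒≤ P∣) (ℕ.<⇒≱ n<P)
  D≡0 : r₁ ℤ.- r₂ ≡ 0ℤ
  D≡0 = ℤ.∣i∣≡0⇒i≡0 {r₁ ℤ.- r₂} (zero∣ _ small (∣⇒∣ᵤ (divides (t ℤ.- e) D≡)))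

Π : ∀ {n} → (Fin n → ℕ) → ℕ
Π = foldr ℕ._*_ 1

coprime-Π : ∀ {s c} (m : Fin s → ℕ) → (∀ i → Coprime c (m i)) → Coprime c (Π m)
coprime-Π {zero}  m h = Coprimality.sym (Coprimality.1-coprimeTo _)
coprime-Π {suc s} m h =
  Coprimality.sym (coprime-* (Coprimality.sym (h zero)) (Coprimality.sym (coprime-Π (m ∘ suc) (h ∘ suc))))

∣Π : ∀ {s} (m : Fin s → ℕ) i → m i ℕ∣.∣ Π m
∣Π m zero    = ℕ∣.m∣m*n _
∣Π m (suc i) = ℕ∣.∣n⇒∣m*n (m zero) (∣Π (m ∘ suc) i)

chineseRemainder : ∀ {s} (m : Fin s → ℕ) → (∀ {i j} → i ≢ j → Coprime (m i) (m j)) →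
                   (r : Fin s → ℤ) → ∃[ y ] (∀ i → + m i ∣ y ℤ.- r i)
chineseRemainder {zero}  m cop r = 0ℤ , λ ()
chineseRemainder {suc s} m cop r = y , λ where
    zero    → divides (u ℤ.* (y′ ℤ.- r zero)) (lem₁ (r zero) (+ m zero) u y′)
    (suc i) → ∣-resp (lem₂ (r zero) (+ m zero) u y′ (r (suc i)))
                (∣m∣n⇒∣m+n (∣m⇒∣m*n (y′ ℤ.- r zero) (∣-trans (pos-mono (∣Π (m ∘ suc) i)) M∣)) (y′≡ i))
  where
  rest = chineseRemainder (m ∘ suc) (λ i≢j → cop (i≢j ∘ Fin.suc-injective)) (r ∘ suc)
  y′ : ℤ
  y′ = proj₁ rest
  y′≡ : ∀ i → + m (suc i) ∣ y′ ℤ.- r (suc i)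
  y′≡ = proj₂ rest
  inv = inverse-mod {m zero} {Π (m ∘ suc)} (coprime-Π (m ∘ suc) (λ i → cop λ ()))
  u : ℤ
  u = proj₁ inv
  M∣ : + Π (m ∘ suc) ∣ + m zero ℤ.* u ℤ.- 1ℤ
  M∣ = proj₂ inv
  y : ℤ
  y = r zero ℤ.+ + m zero ℤ.* u ℤ.* (y′ ℤ.- r zero)
  lem₁ : ∀ r m u y → r ℤ.+ m ℤ.* u ℤ.* (y ℤ.- r) ℤ.- r ≡ u ℤ.* (y ℤ.- r) ℤ.* m
  lem₁ = solve-∀
  lem₂ : ∀ r m u y q → (m ℤ.* u ℤ.- 1ℤ) ℤ.* (y ℤ.- r) ℤ.+ (y ℤ.- q) ≡ r ℤ.+ m ℤ.* u ℤ.* (y ℤ.- r) ℤ.- q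
  lem₂ = solve-∀

------------------------------------------------------------------------
-- p-adic integers

-- ℤₚ is the inverse limit of the rings ℤ/pⁿ: the residue of x modulo pⁿ
-- is represented by an arbitrary integer approx x n, and elements are
-- compared by _≈ᶻ_, not by _≡_.

record ℤₚ (p : ℕ) : Set where
  field
    approx   : ℕ → ℤ
    coherent : ∀ n → + (p ℕ.^ n) ∣ approx (suc n) ℤ.- approx n

open ℤₚ public

module _ {p : ℕ} where

  infix  4 _≈ᶻ_
  infixl 6 _+ᶻ_ _-ᶻ_
  infixl 7 _*ᶻ_
  infix  8 -ᶻ_

  _≈ᶻ_ : ℤₚ p → ℤₚ p → Set
  x ≈ᶻ y = ∀ n → + (p ℕ.^ n) ∣ approx x n ℤ.- approx y n

  fromℤ : ℤ → ℤₚ p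
  fromℤ z = record { approx = λ _ → z ; coherent = λ _ → ∣-resp (sym (ℤ.+-inverseʳ z)) ∣0 }

  fromℕ : ℕ → ℤₚ p
  fromℕ n = fromℤ (+ n)

  _+ᶻ_ : ℤₚ p → ℤₚ p → ℤₚ p
  x +ᶻ y = record
    { approx   = λ n → approx x n ℤ.+ approx y n
    ; coherent = λ n → ∣-resp (lem (approx x (suc n)) (approx x n) (approx y (suc n)) (approx y n))
                               (∣m∣n⇒∣m+n (coherent x n) (coherent y n))
    }
    where
    lem : ∀ a a′ b b′ → (a ℤ.- a′) ℤ.+ (b ℤ.- b′) ≡ (a ℤ.+ b) ℤ.- (a′ ℤ.+ b′)
    lem = solve-∀

  -ᶻ_ : ℤₚ p → ℤₚ p
  -ᶻ x = record
    { approx   = λ n → ℤ.- approx x n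
    ; coherent = λ n → ∣-resp (lem (approx x (suc n)) (approx x n)) (∣m⇒∣-m (coherent x n))
    }
    where
    lem : ∀ a a′ → ℤ.- (a ℤ.- a′) ≡ (ℤ.- a) ℤ.- (ℤ.- a′)
    lem = solve-∀

  _-ᶻ_ : ℤₚ p → ℤₚ p → ℤₚ p
  x -ᶻ y = x +ᶻ -ᶻ y

  _*ᶻ_ : ℤₚ p → ℤₚ p → ℤₚ p
  x *ᶻ y = record
    { approx   = λ n → approx x n ℤ.* approx y n
    ; coherent = λ n → ∣-resp (lem (approx x (suc n)) (approx x n) (approx y (suc n)) (approx y n))
                               (∣m∣n⇒∣m+n (∣m⇒∣m*n (approx y (suc n)) (coherent x n))
                                          (∣n⇒∣m*n (approx x n) (coherent y n)))
    }
    where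
    lem : ∀ a a′ b b′ → (a ℤ.- a′) ℤ.* b ℤ.+ a′ ℤ.* (b ℤ.- b′) ≡ a ℤ.* b ℤ.- a′ ℤ.* b′
    lem = solve-∀

  p^_∣_ : ℕ → ℤₚ p → Set
  p^ k ∣ x = + (p ℕ.^ k) ∣ approx x k

  unitInverse : ∀ {c} → Coprime c p → ℤₚ p
  unitInverse {c} cop = record { approx = u ; coherent = coh }
    where
    u : ℕ → ℤ
    u n = proj₁ (inverse-mod (coprime-^ʳ n cop))
    u≡ : ∀ n → + (p ℕ.^ n) ∣ + c ℤ.* u n ℤ.- 1ℤ
    u≡ n = proj₂ (inverse-mod (coprime-^ʳ n cop))
    lem : ∀ c a a′ → (c ℤ.* a ℤ.- 1ℤ) ℤ.- (c ℤ.* a′ ℤ.- 1ℤ) ≡ c ℤ.* (a ℤ.- a′)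
    lem = solve-∀
    coh : ∀ n → + (p ℕ.^ n) ∣ u (suc n) ℤ.- u n
    coh n = coprime-cancel (coprime-^ʳ n cop) (∣-resp (lem (+ c) (u (suc n)) (u n))
      (∣m∣n⇒∣m-n (∣-trans (pos-mono (ℕ∣.∣n⇒∣m*n p ℕ∣.∣-refl)) (u≡ (suc n))) (u≡ n)))

------------------------------------------------------------------------
-- p-adic numbers

-- ℚₚ = ℤₚ[1/p]: the record below denotes num / p ^ expo.

record ℚₚ (p : ℕ) : Set where
  constructor _/p^_
  field
    num  : ℤₚ p
    expo : ℕ

open ℚₚ public

ℚₚ-rawRing : ℕ → RawRing 0ℓ 0ℓ
ℚₚ-rawRing p = record
  { Carrier = ℚₚ p
  ; _≈_     = λ x y → num x *ᶻ p^ (expo y) ≈ᶻ num y *ᶻ p^ (expo x)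
  ; _+_     = λ x y → (num x *ᶻ p^ (expo y) +ᶻ num y *ᶻ p^ (expo x)) /p^ (expo x ℕ.+ expo y)
  ; _*_     = λ x y → (num x *ᶻ num y) /p^ (expo x ℕ.+ expo y)
  ; -_      = λ x → (-ᶻ num x) /p^ expo x
  ; 0#      = fromℕ 0 /p^ 0
  ; 1#      = fromℕ 1 /p^ 0
  }
  where
  p^ : ℕ → ℤₚ p
  p^ k = fromℕ (p ℕ.^ k)

module _ {p : ℕ} where

  open RawRing (ℚₚ-rawRing p) public using (_≈_; _≉_; _+_; _*_; -_; 0#; 1#)
  open RawSemiringDefs (RawRing.rawSemiring (ℚₚ-rawRing p)) public using (_^_; sum)

  infixl 6 _-_

  _-_ : ℚₚ p → ℚₚ p → ℚₚ p
  x - y = x + - y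

  ι : ℤₚ p → ℚₚ p
  ι x = x /p^ 0

  -- 1 / m, with m = p ^ v * c and p ∤ c
  recip : Prime p → (m : ℕ) .{{_ : NonZero m}} → ℚₚ p
  recip pr m = unitInverse (∤⇒coprime pr p∤cofactor) /p^ v
    where open Split (split pr m)

  fromℚ : Prime p → ℚ → ℚₚ p
  fromℚ pr q = ι (fromℤ (↥ q)) * recip pr (↧ₙ q)

  -- The p-adic integer part: it drops the digits of negative weight, so
  -- ι (integerPart pr y) ≈ y whenever y lies in ℤₚ.
  integerPart : Prime p → ℚₚ p → ℤₚ p
  integerPart pr (x /p^ e) = record { approx = a ; coherent = coh }
    where
    instance
      p^e≢0 : NonZero (p ℕ.^ e)
      p^e≢0 = ℕ.m^n≢0 p e {{prime⇒nonZero pr}}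
    a : ℕ → ℤ
    a n = approx x (n ℕ.+ e) ℤ./ℕ (p ℕ.^ e)
    coh : ∀ n → + (p ℕ.^ n) ∣ a (suc n) ℤ.- a n
    coh n with coherent x (n ℕ.+ e)
    ... | divides q eq = divides q (/ℕ-shift (approx x (suc n ℕ.+ e)) (approx x (n ℕ.+ e)) (q ℤ.* + (p ℕ.^ n)) (p ℕ.^ e) (begin
      approx x (suc n ℕ.+ e) ℤ.- approx x (n ℕ.+ e)  ≡⟨ eq ⟩
      q ℤ.* + (p ℕ.^ (n ℕ.+ e))                      ≡⟨ cong (λ t → q ℤ.* + t) (ℕ.^-distribˡ-+-* p n e) ⟩
      q ℤ.* + (p ℕ.^ n ℕ.* p ℕ.^ e)                  ≡⟨ cong (q ℤ.*_) (ℤ.pos-* (p ℕ.^ n) (p ℕ.^ e)) ⟩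
      q ℤ.* (+ (p ℕ.^ n) ℤ.* + (p ℕ.^ e))            ≡⟨ ℤ.*-assoc q _ _ ⟨
      q ℤ.* + (p ℕ.^ n) ℤ.* + (p ℕ.^ e)              ∎))
      where open ≡-Reasoning

  -- Convergence in ℚₚ: eventually νₚ (u N - y) ≥ k, for each k.
  _⟶_ : (ℕ → ℚₚ p) → ℚₚ p → Set
  u ⟶ y = ∀ k → ∃[ N₀ ] (∀ N → N₀ ≤ N → p^ (k ℕ.+ expo (u N - y)) ∣ num (u N - y))

  partialSum : (ℕ → ℚₚ p) → ℚₚ p → ℕ → ℚₚ p
  partialSum a x N = sum {N} λ j → a (toℕ j) * x ^ toℕ j

  Analytic : (ℤₚ p → ℚₚ p) → Set
  Analytic f = ∃[ a ] (∀ x → partialSum a (ι x) ⟶ f x)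

  Root : (ℤₚ p → ℚₚ p) → Pred (ℤₚ p) 0ℓ
  Root f θ = f θ ≈ 0#

  IsMultiplicity : (ℤₚ p → ℚₚ p) → ℤₚ p → ℕ → Set
  IsMultiplicity f θ m =
    ∃[ g ] Analytic g × g θ ≉ 0# × (∀ x → f x ≈ (ι x - ι θ) ^ m * g x)

  -- νₚ is not computable, since x ≈ 0# is undecidable; the ambient logic is
  -- classical, so excluded middle is taken as an argument.  The m below is
  -- unique and exists unless x ≈ 0#, so the second case is νₚ 0 = +∞.
  ν : ExcludedMiddle 0ℓ → ℚₚ p → ℤ ⁺
  ν em (x /p^ e) with em {∃[ m ] (p^ m ∣ x × ¬ p^ (suc m) ∣ x)}
  ... | yes (m , _) = [ + m ℤ.- + e ]
  ... | no  _       = ⊤⁺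

------------------------------------------------------------------------
-- b-adic notions

infixl 6 _⊓_

_⊓_ : ℤ ⁺ → ℤ ⁺ → ℤ ⁺
⊤⁺    ⊓ y     = y
[ x ] ⊓ ⊤⁺    = [ x ]
[ x ] ⊓ [ y ] = [ x ℤ.⊓ y ]

⌊_/_⌋ : ℤ ⁺ → (l : ℕ) .{{_ : NonZero l}} → ℤ ⁺
⌊ ⊤⁺    / l ⌋ = ⊤⁺
⌊ [ x ] / l ⌋ = [ x ℤ./ℕ l ]

record Factorisation (s : ℕ) : Set where
  field
    p l      : Fin s → ℕ
    prime    : ∀ i → Prime (p i)
    distinct : Injective _≡_ _≡_ p
    positive : ∀ i → NonZero (l i)

  bᵢ : Fin s → ℕ
  bᵢ i = p i ℕ.^ l i

  b : ℕ
  b = Π bᵢ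

  ℤ_b ℚ_b : Set
  ℤ_b = ∀ i → ℤₚ (p i)
  ℚ_b = ∀ i → ℚₚ (p i)

  _≈b_ : ℤ_b → ℤ_b → Set
  x ≈b y = ∀ i → x i ≈ᶻ y i

  Rational : ℤ_b → Set
  Rational θ = ∃[ q ] (∀ i → ι (θ i) ≈ fromℚ (prime i) q)

  b≢0 : NonZero b
  b≢0 = go bᵢ λ i → ℕ.m^n≢0 (p i) (l i) {{prime⇒nonZero (prime i)}}
    where
    go : ∀ {n} (m : Fin n → ℕ) → (∀ i → NonZero (m i)) → NonZero (Π m)
    go {zero}  m h = _
    go {suc n} m h = ℕ.m*n≢0 (m zero) _ {{h zero}} {{go (m ∘ suc) (h ∘ suc)}}

  b^≢0 : ∀ n → NonZero (b ℕ.^ n)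
  b^≢0 n = ℕ.m^n≢0 b n {{b≢0}}

  ν-b : ExcludedMiddle 0ℓ → ℚ_b → ℤ ⁺
  ν-b em x = foldr _⊓_ ⊤⁺ λ i → ⌊ ν em (x i) / l i ⌋ {{positive i}}

  b^-_ : ℤ → ℚ_b
  (b^- (+ n))    i = recip (prime i) (b ℕ.^ n) {{b^≢0 n}}
  (b^- -[1+ n ]) i = ι (fromℕ (b ℕ.^ suc n))

  -- ν-b em x is ⊤⁺ exactly when x = 0; otherwise b^-ν x is integral.
  ℒ : ExcludedMiddle 0ℓ → ℚ_b → ℤ_b
  ℒ em x with ν-b em x
  ... | ⊤⁺    = λ i → fromℕ 0
  ... | [ k ] = λ i → integerPart (prime i) ((b^- k) i * x i)

  -- The congruences are y ≡ xᵢ (mod bᵢᵈ), as bᵢᵈ = pᵢ ^ (lᵢ d); they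
  -- determine y because the bᵢᵈ are coprime with product bᵈ.
  residue : (x : ℤ_b) (d : ℕ) →
            ∃[ y ] (y < b ℕ.^ d × (∀ i → p^ (l i ℕ.* d) ∣ (fromℕ y -ᶻ x i)))
  residue x d = z ℤ.%ℕ (b ℕ.^ d) , ℤ.n%ℕd<d z (b ℕ.^ d) , cong-mod
    where
    instance
      bd≢0 : NonZero (b ℕ.^ d)
      bd≢0 = b^≢0 d
    m : Fin s → ℕ
    m i = p i ℕ.^ (l i ℕ.* d)
    crt = chineseRemainder m
      (λ {i} {j} i≢j → coprime-^ˡ (l i ℕ.* d) (coprime-^ʳ (l j ℕ.* d)
        (distinct⇒coprime (prime i) (prime j) (i≢j ∘ distinct))))
      (λ i → approx (x i) (l i ℕ.* d))
    z : ℤ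
    z = proj₁ crt
    ^-mono-∣ : ∀ {a c} k → a ℕ∣.∣ c → a ℕ.^ k ℕ∣.∣ c ℕ.^ k
    ^-mono-∣ zero    h = ℕ∣.∣-refl
    ^-mono-∣ (suc k) h = ℕ∣.*-pres-∣ h (^-mono-∣ k h)
    m∣ : ∀ i → m i ℕ∣.∣ b ℕ.^ d
    m∣ i = subst (ℕ∣._∣ b ℕ.^ d) (ℕ.^-*-assoc (p i) (l i) d) (^-mono-∣ d (∣Π bᵢ i))
    lem : ∀ z r q B a → z ≡ r ℤ.+ q ℤ.* B → (z ℤ.- a) ℤ.- q ℤ.* B ≡ r ℤ.+ ℤ.- a
    lem _ r q B a refl = lem′ r q B a
      where
      lem′ : ∀ r q B a → (r ℤ.+ q ℤ.* B ℤ.- a) ℤ.- q ℤ.* B ≡ r ℤ.+ ℤ.- a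
      lem′ = solve-∀
    cong-mod : ∀ i → + m i ∣ + (z ℤ.%ℕ (b ℕ.^ d)) ℤ.+ ℤ.- approx (x i) (l i ℕ.* d)
    cong-mod i = ∣-resp (lem z (+ (z ℤ.%ℕ (b ℕ.^ d))) (z ℤ./ℕ (b ℕ.^ d)) (+ (b ℕ.^ d)) (approx (x i) (l i ℕ.* d)) (ℤ.a≡a%ℕn+[a/ℕn]*n z (b ℕ.^ d)))
      (∣m∣n⇒∣m-n (proj₂ crt i) (∣n⇒∣m*n (z ℤ./ℕ (b ℕ.^ d)) (pos-mono (m∣ i))))

  _mod-b^_ : ℤ_b → ℕ → ℕ
  x mod-b^ d = proj₁ (residue x d)

  ℓ : ExcludedMiddle 0ℓ → ℕ → ℚ_b → ℕ
  ℓ em d x = ℒ em x mod-b^ d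

  Roots : (∀ i → ℤₚ (p i) → ℚₚ (p i)) → Pred ℤ_b 0ℓ
  Roots f x = ∀ i → Root (f i) (x i)

------------------------------------------------------------------------
-- Automatic sequences

module _ {A : Set} where

  IsPeriod : ℕ → (ℕ → A) → Set
  IsPeriod T a = NonZero T × (∀ n → a (n ℕ.+ T) ≡ a n)

  kernelElement : ℕ → (ℕ → A) → ℕ → ℕ → ℕ → A
  kernelElement k a i j n = a (k ℕ.^ i ℕ.* n ℕ.+ j)

  -- Finiteness up to pointwise equality; the list may contain sequences
  -- outside the kernel.
  FiniteKernel : ℕ → (ℕ → A) → Set
  FiniteKernel k a =
    ∃[ cs ] (∀ i j → j < k ℕ.^ i → Any (kernelElement k a i j ≗_) cs)

  IsAutomatic : ℕ → (ℕ → A) → Set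
  IsAutomatic k a = 2 ≤ k × FiniteKernel k a

  Automatic : (ℕ → A) → Set
  Automatic a = ∃[ k ] IsAutomatic k a

  StrictlyAutomatic : ℕ → (ℕ → A) → Set
  StrictlyAutomatic k a =
    IsAutomatic k a × (∀ m → 2 ≤ m → MultiplicativelyIndependent k m → ¬ IsAutomatic m a)
    where
    MultiplicativelyIndependent : ℕ → ℕ → Set
    MultiplicativelyIndependent k m = ∀ e c → 1 ≤ e → 1 ≤ c → k ℕ.^ e ≢ m ℕ.^ c

{-# OPTIONS --safe #-}

-- Clearing denominators, b^E f takes values in ℤ_b and is Lipschitz, and its
-- last digits are locally constant off the common roots of the fᵢ.  If some
-- fᵢ has no root, compactness bounds ν_b(f(n)), and the digits are periodic.
-- By Strassman's argument (synthetic division lowers the last index at which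
-- the minimal valuation of a coefficient is attained) each fᵢ is a product of
-- linear factors and a rootless series.
--
-- As s ≥ 2, the digits are discontinuous exactly at the common roots: close
-- to a root, any one component can be made to dominate all the others.  Hence
-- if x ↦ mᵉx + j and x ↦ mᵉ'x + j' give the same element of the m-kernel, they
-- have the same preimages of roots.  For a root θ and e ∈ ℕ choose j < mᵉ and
-- ω in ℤ_b with θ = mᵉω + j; finitely many kernel elements and finitely many
-- roots force a coincidence ω = ω' for some e < e', which makes θ rational.
-- Two roots are impossible, as they could be mixed into a non-diagonal one.
--
-- For a unique rational root θ = u / v, multiplication of vn - u by k shifts
-- all ν_{pᵢ}(fᵢ(n)) / lᵢ by the same integer, so decimation by k leads to
-- finitely many sequences.  Conversely, if the digits are m-automatic, then
-- counting the possible j for fixed e shows that m has only the prime factors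
-- pᵢ, and comparing the growth in e of the valuations of two components
-- along mᵉx + j shows that m and k are multiplicatively dependent.
module Submission where

open import Defs
open import Level using (0ℓ)
open import Axiom.ExcludedMiddle using (ExcludedMiddle)
open import Data.Nat using (ℕ; _≤_; NonZero) renaming (_*_ to _*ℕ_; _^_ to _^ℕ_)
open import Data.Nat using (zero; suc; _<_; z≤n; s≤s) renaming (_+_ to _+ℕ_)
import Data.Nat as ℕ
import Data.Nat.Properties as ℕ
import Data.Nat.Divisibility as ℕ∣
import Data.Nat.DivMod as ℕ
open import Data.Nat.Coprimality as Coprimality using (Coprime; coprime-divisor)
open import Data.Nat.Primality using (Prime; prime⇒nonZero; prime⇒nonTrivial)
import Data.Nat.Tactic.RingSolver as ℕ-Solver
open import Data.Integer as ℤ using (ℤ; +_; -[1+_]; 0ℤ; 1ℤ)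
import Data.Integer.Properties as ℤ
import Data.Integer.DivMod as ℤ
import Data.Integer.GCD as ℤ
open import Data.Integer.Divisibility.Signed
open import Data.Integer.Tactic.RingSolver using (solve-∀)
import Data.Rational as ℚ
import Data.Rational.Properties as ℚ
open import Data.Rational using (ℚ; mkℚ; ↥_; ↧ₙ_)
import Data.Sign as Sign
open import Data.Empty using (⊥)
open import Data.Fin using (Fin; zero; suc; toℕ)
import Data.Fin as Fin
import Data.Fin.Properties as Fin
open import Data.Vec.Functional using (foldr)
import Data.List as List
open import Data.List.Relation.Unary.Any as Any using (Any)
open import Data.List.Relation.Unary.Any.Properties using (tabulate⁺; lookup-index)
open import Data.Maybe using (Maybe; just; nothing)
open import Data.Product using (Σ; ∃-syntax; _×_; _,_; proj₁; proj₂)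
open import Data.Sum as Sum using (_⊎_; inj₁; inj₂)
open import Algebra.Bundles using (CommutativeRing)
import Algebra.Solver.Ring
import Algebra.Solver.Ring.AlmostCommutativeRing as ACR
open import Function using (_∘_; id)
open import Function.Bundles using (_⇔_; mk⇔)
open import Relation.Nullary using (¬_; Dec; yes; no; contradiction)
open import Relation.Nullary.Construct.Add.Supremum using (_⁺; [_]; ⊤⁺)
open import Relation.Unary using (Empty; _≐_)
open import Relation.Binary.PropositionalEquality using (_≡_; _≢_; _≗_; refl; sym; trans; cong; cong₂; subst; module ≡-Reasoning)

-- Arithmetic of ℤₚ

-- Valuations are infinite at roots, so they are hardly ever handled as numbers: `t ∣ₚ x` stands for
-- ν(x) ≥ t and its negation for ν(x) < t, and comparing digits becomes comparing such
-- divisibilities. The digits themselves are described by a relation, `LastDigits`, which is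
-- insensitive to scaling by powers of b; this permits the passage to integral values.
--
-- Equality of two kernel elements is a statement about sequences on ℕ. It becomes one about roots
-- because ℕ is dense in ℤ_b: the behaviour of n ↦ a(A n + j) for n close to ω tells whether A ω + j
-- is a common root.
--
-- The base m is arbitrary and may have prime factors outside b. The equation θ = mᵉ ω + j restricts
-- j only modulo the part of mᵉ composed of the primes pᵢ. Hence it is solvable for every θ, and the
-- remaining freedom in j is what later excludes the other prime factors.

^-∣-^ : ∀ p {m n} → m ≤ n → p ^ℕ m ℕ∣.∣ p ^ℕ n
^-∣-^ p {m} {n} m≤n = subst (p ^ℕ m ℕ∣.∣_)
  (trans (sym (ℕ.^-distribˡ-+-* p m (n ℕ.∸ m))) (cong (p ^ℕ_) (ℕ.m+[n∸m]≡n m≤n))) (ℕ∣.m∣m*n _)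

-- With ¬ p^(a+1) ∣ X read as ν(X) ≤ a, this is the additivity of valuations. Each induction step
-- strips one factor p from X and from the product; when X has none left, it is coprime to p and
-- cancels.
prime-power-cancel : ∀ {p} → Prime p → ∀ a {t} X {Y} → ¬ p ^ℕ suc a ℕ∣.∣ X →
                     p ^ℕ (a +ℕ t) ℕ∣.∣ X *ℕ Y → p ^ℕ t ℕ∣.∣ Y
prime-power-cancel {p} pr zero {t} X ∤X h = coprime-divisor (Coprimality.sym (coprime-^ʳ t
  (∤⇒coprime pr (λ d → ∤X (subst (ℕ∣._∣ X) (sym (ℕ.*-identityʳ p)) d))))) h
prime-power-cancel {p} pr (suc a) {t} X {Y} ∤X h with p ℕ∣.∣? X
... | no p∤X = ℕ∣.∣-trans (^-∣-^ p (ℕ.m≤n+m t (suc a)))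
  (coprime-divisor (Coprimality.sym (coprime-^ʳ (suc a +ℕ t) (∤⇒coprime pr p∤X))) h)
... | yes (ℕ∣.divides q refl) = prime-power-cancel pr a q
  (λ d → ∤X (subst (p ^ℕ suc (suc a) ℕ∣.∣_) (ℕ.*-comm p q) (ℕ∣.*-monoʳ-∣ p d)))
  (ℕ∣.*-cancelˡ-∣ p {{prime⇒nonZero pr}} (subst (p *ℕ p ^ℕ (a +ℕ t) ℕ∣.∣_)
    (trans (cong (_*ℕ Y) (ℕ.*-comm q p)) (ℕ.*-assoc p q Y)) h))

∣-*-∣ : ∀ {a b x y} → a ∣ x → b ∣ y → a ℤ.* b ∣ x ℤ.* y
∣-*-∣ {a} {b} {x} {y} a∣x b∣y = ∣-trans (*-monoʳ-∣ a b∣y) (*-monoˡ-∣ y a∣x)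

infix  4 _≋_ _∣ₚ_
infixl 6 _⊕_ _⊖_
infixl 7 _⊗_
infix  8 ⊝_

-- The operations of ℤₚ are made opaque, so that the arguments of a sum or a
-- product can be recovered by unification.

opaque

  _≋_ : ∀ {p} → ℤₚ p → ℤₚ p → Set
  x ≋ y = x ≈ᶻ y

  _⊕_ : ∀ {p} → ℤₚ p → ℤₚ p → ℤₚ p
  x ⊕ y = x +ᶻ y

  _⊗_ : ∀ {p} → ℤₚ p → ℤₚ p → ℤₚ p
  x ⊗ y = x *ᶻ y

  ⊝_ : ∀ {p} → ℤₚ p → ℤₚ p
  ⊝ x = -ᶻ x

  ⌜_⌝ : ∀ {p} → ℤ → ℤₚ p
  ⌜ z ⌝ = fromℤ z

  _∣ₚ_ : ∀ {p} → ℕ → ℤₚ p → Set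
  t ∣ₚ x = p^ t ∣ x

_⊖_ : ∀ {p} → ℤₚ p → ℤₚ p → ℤₚ p
x ⊖ y = x ⊕ ⊝ y

module _ {p : ℕ} where

  opaque
    unfolding _≋_

    ≋-pointwise : (x y : ℤₚ p) → (∀ n → approx x n ≡ approx y n) → x ≋ y
    ≋-pointwise x y h n = ∣-resp (sym (trans (cong (ℤ._- approx y n) (h n)) (ℤ.+-inverseʳ (approx y n)))) ∣0

    ≋⇒≈ᶻ : {x y : ℤₚ p} → x ≋ y → x ≈ᶻ y
    ≋⇒≈ᶻ h = h

    ≈ᶻ⇒≋ : {x y : ℤₚ p} → x ≈ᶻ y → x ≋ y
    ≈ᶻ⇒≋ h = h

    ≋-refl : {x : ℤₚ p} → x ≋ x
    ≋-refl {x} = ≋-pointwise x x λ _ → refl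

    ≋-sym : {x y : ℤₚ p} → x ≋ y → y ≋ x
    ≋-sym {x} {y} h n = ∣-resp (lem (approx x n) (approx y n)) (∣m⇒∣-m (h n))
      where
      lem : ∀ a b → ℤ.- (a ℤ.- b) ≡ b ℤ.- a
      lem = solve-∀

    ≋-trans : {x y z : ℤₚ p} → x ≋ y → y ≋ z → x ≋ z
    ≋-trans {x} {y} {z} h k n = ∣-resp (lem (approx x n) (approx y n) (approx z n)) (∣m∣n⇒∣m+n (h n) (k n))
      where
      lem : ∀ a b c → (a ℤ.- b) ℤ.+ (b ℤ.- c) ≡ a ℤ.- c
      lem = solve-∀

    ⊕-cong : {x y z w : ℤₚ p} → x ≋ y → z ≋ w → x ⊕ z ≋ y ⊕ w
    ⊕-cong {x} {y} {z} {w} h k n =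
      ∣-resp (lem (approx x n) (approx y n) (approx z n) (approx w n)) (∣m∣n⇒∣m+n (h n) (k n))
      where
      lem : ∀ a b c d → (a ℤ.- b) ℤ.+ (c ℤ.- d) ≡ (a ℤ.+ c) ℤ.- (b ℤ.+ d)
      lem = solve-∀

    ⊗-cong : {x y z w : ℤₚ p} → x ≋ y → z ≋ w → x ⊗ z ≋ y ⊗ w
    ⊗-cong {x} {y} {z} {w} h k n =
      ∣-resp (lem (approx x n) (approx y n) (approx z n) (approx w n))
        (∣m∣n⇒∣m+n (∣m⇒∣m*n (approx z n) (h n)) (∣n⇒∣m*n (approx y n) (k n)))
      where
      lem : ∀ a b c d → (a ℤ.- b) ℤ.* c ℤ.+ b ℤ.* (c ℤ.- d) ≡ (a ℤ.* c) ℤ.- (b ℤ.* d)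
      lem = solve-∀

    ⊝-cong : {x y : ℤₚ p} → x ≋ y → ⊝ x ≋ ⊝ y
    ⊝-cong {x} {y} h n = ∣-resp (lem (approx x n) (approx y n)) (∣m⇒∣-m (h n))
      where
      lem : ∀ a b → ℤ.- (a ℤ.- b) ≡ (ℤ.- a) ℤ.- (ℤ.- b)
      lem = solve-∀

    private
      assoc⊕ : (x y z : ℤₚ p) → (x ⊕ y) ⊕ z ≋ x ⊕ (y ⊕ z)
      assoc⊕ x y z = ≋-pointwise ((x ⊕ y) ⊕ z) (x ⊕ (y ⊕ z)) λ n → ℤ.+-assoc (approx x n) (approx y n) (approx z n)
      assoc⊗ : (x y z : ℤₚ p) → (x ⊗ y) ⊗ z ≋ x ⊗ (y ⊗ z)
      assoc⊗ x y z = ≋-pointwise ((x ⊗ y) ⊗ z) (x ⊗ (y ⊗ z)) λ n → ℤ.*-assoc (approx x n) (approx y n) (approx z n)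
      comm⊕ : (x y : ℤₚ p) → x ⊕ y ≋ y ⊕ x
      comm⊕ x y = ≋-pointwise (x ⊕ y) (y ⊕ x) λ n → ℤ.+-comm (approx x n) (approx y n)
      comm⊗ : (x y : ℤₚ p) → x ⊗ y ≋ y ⊗ x
      comm⊗ x y = ≋-pointwise (x ⊗ y) (y ⊗ x) λ n → ℤ.*-comm (approx x n) (approx y n)
      idˡ⊕ : (x : ℤₚ p) → ⌜ 0ℤ ⌝ ⊕ x ≋ x
      idˡ⊕ x = ≋-pointwise (⌜ 0ℤ ⌝ ⊕ x) x λ n → ℤ.+-identityˡ (approx x n)
      idʳ⊕ : (x : ℤₚ p) → x ⊕ ⌜ 0ℤ ⌝ ≋ x
      idʳ⊕ x = ≋-pointwise (x ⊕ ⌜ 0ℤ ⌝) x λ n → ℤ.+-identityʳ (approx x n)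
      idˡ⊗ : (x : ℤₚ p) → ⌜ 1ℤ ⌝ ⊗ x ≋ x
      idˡ⊗ x = ≋-pointwise (⌜ 1ℤ ⌝ ⊗ x) x λ n → ℤ.*-identityˡ (approx x n)
      idʳ⊗ : (x : ℤₚ p) → x ⊗ ⌜ 1ℤ ⌝ ≋ x
      idʳ⊗ x = ≋-pointwise (x ⊗ ⌜ 1ℤ ⌝) x λ n → ℤ.*-identityʳ (approx x n)
      invˡ⊕ : (x : ℤₚ p) → ⊝ x ⊕ x ≋ ⌜ 0ℤ ⌝
      invˡ⊕ x = ≋-pointwise (⊝ x ⊕ x) ⌜ 0ℤ ⌝ λ n → ℤ.+-inverseˡ (approx x n)
      invʳ⊕ : (x : ℤₚ p) → x ⊕ ⊝ x ≋ ⌜ 0ℤ ⌝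
      invʳ⊕ x = ≋-pointwise (x ⊕ ⊝ x) ⌜ 0ℤ ⌝ λ n → ℤ.+-inverseʳ (approx x n)
      distribˡ : (x y z : ℤₚ p) → x ⊗ (y ⊕ z) ≋ x ⊗ y ⊕ x ⊗ z
      distribˡ x y z = ≋-pointwise (x ⊗ (y ⊕ z)) (x ⊗ y ⊕ x ⊗ z) λ n → ℤ.*-distribˡ-+ (approx x n) (approx y n) (approx z n)
      distribʳ : (x y z : ℤₚ p) → (y ⊕ z) ⊗ x ≋ y ⊗ x ⊕ z ⊗ x
      distribʳ x y z = ≋-pointwise ((y ⊕ z) ⊗ x) (y ⊗ x ⊕ z ⊗ x) λ n → ℤ.*-distribʳ-+ (approx x n) (approx y n) (approx z n)

    ⌜⌝-+ : ∀ a b → ⌜ a ℤ.+ b ⌝ ≋ ⌜_⌝ {p} a ⊕ ⌜ b ⌝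
    ⌜⌝-+ a b = ≋-pointwise (⌜ a ℤ.+ b ⌝) (⌜ a ⌝ ⊕ ⌜ b ⌝) λ _ → refl

    ⌜⌝-* : ∀ a b → ⌜ a ℤ.* b ⌝ ≋ ⌜_⌝ {p} a ⊗ ⌜ b ⌝
    ⌜⌝-* a b = ≋-pointwise (⌜ a ℤ.* b ⌝) (⌜ a ⌝ ⊗ ⌜ b ⌝) λ _ → refl

    ⌜⌝-neg : ∀ a → ⌜ ℤ.- a ⌝ ≋ ⊝ ⌜_⌝ {p} a
    ⌜⌝-neg a = ≋-pointwise (⌜ ℤ.- a ⌝) (⊝ ⌜ a ⌝) λ _ → refl

  ℤₚ-commutativeRing : CommutativeRing 0ℓ 0ℓ
  ℤₚ-commutativeRing = record
    { Carrier = ℤₚ p ; _≈_ = _≋_ ; _+_ = _⊕_ ; _*_ = _⊗_ ; -_ = ⊝_ ; 0# = ⌜ 0ℤ ⌝ ; 1# = ⌜ 1ℤ ⌝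
    ; isCommutativeRing = record
      { isRing = record
        { +-isAbelianGroup = record
          { isGroup = record
            { isMonoid = record
              { isSemigroup = record
                { isMagma = record
                  { isEquivalence = record { refl = ≋-refl ; sym = ≋-sym ; trans = ≋-trans }
                  ; ∙-cong = ⊕-cong }
                ; assoc = assoc⊕ }
              ; identity = idˡ⊕ , idʳ⊕ }
            ; inverse = invˡ⊕ , invʳ⊕
            ; ⁻¹-cong = ⊝-cong }
          ; comm = comm⊕ }
        ; *-cong = ⊗-cong
        ; *-assoc = assoc⊗
        ; *-identity = idˡ⊗ , idʳ⊗
        ; distrib = distribˡ , distribʳ }
      ; *-comm = comm⊗ } }

module Ring {p : ℕ} = CommutativeRing (ℤₚ-commutativeRing {p})

fromℤ-homomorphism : ∀ {p} → CommutativeRing.rawRing ℤ.+-*-commutativeRing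
                     ACR.-Raw-AlmostCommutative⟶ ACR.fromCommutativeRing (ℤₚ-commutativeRing {p})
fromℤ-homomorphism = record
  { ⟦_⟧ = ⌜_⌝ ; +-homo = ⌜⌝-+ ; *-homo = ⌜⌝-* ; -‿homo = ⌜⌝-neg
  ; 0-homo = ≋-refl ; 1-homo = ≋-refl }

coefficient≟ : ∀ {p} (a b : ℤ) → Maybe (⌜_⌝ {p} a ≋ ⌜ b ⌝)
coefficient≟ a b with a ℤ.≟ b
... | yes refl = just ≋-refl
... | no  _    = nothing

module Solver {p : ℕ} = Algebra.Solver.Ring (CommutativeRing.rawRing ℤ.+-*-commutativeRing)
  (ACR.fromCommutativeRing (ℤₚ-commutativeRing {p})) (fromℤ-homomorphism {p}) (coefficient≟ {p})
open Solver using (solve; _:+_; _:*_; _:-_; :-_; _:=_; con)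

nat : ∀ {p} → ℕ → ℤₚ p
nat n = ⌜ + n ⌝

infixr 8 _^ᶻ_

_^ᶻ_ : ∀ {p} → ℤₚ p → ℕ → ℤₚ p
x ^ᶻ zero  = ⌜ 1ℤ ⌝
x ^ᶻ suc n = x ⊗ x ^ᶻ n

≡⇒≋ : ∀ {p} {x y : ℤₚ p} → x ≡ y → x ≋ y
≡⇒≋ refl = ≋-refl

nat-* : ∀ {p} a b → nat {p} (a *ℕ b) ≋ nat a ⊗ nat b
nat-* a b = ≋-trans (≡⇒≋ (cong ⌜_⌝ (ℤ.pos-* a b))) (⌜⌝-* (+ a) (+ b))

nat-+ : ∀ {p} a b → nat {p} (a +ℕ b) ≋ nat a ⊕ nat b
nat-+ a b = ≋-trans (≡⇒≋ (cong ⌜_⌝ (ℤ.pos-+ a b))) (⌜⌝-+ (+ a) (+ b))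

nat-^ : ∀ {p} a n → nat {p} (a ^ℕ n) ≋ nat a ^ᶻ n
nat-^ a zero    = ≋-refl
nat-^ a (suc n) = ≋-trans (nat-* a (a ^ℕ n)) (⊗-cong ≋-refl (nat-^ a n))

^ᶻ-cong : ∀ {p} {x y : ℤₚ p} n → x ≋ y → x ^ᶻ n ≋ y ^ᶻ n
^ᶻ-cong zero    h = ≋-refl
^ᶻ-cong (suc n) h = ⊗-cong h (^ᶻ-cong n h)

^ᶻ-⊗ : ∀ {p} (x y : ℤₚ p) n → (x ⊗ y) ^ᶻ n ≋ x ^ᶻ n ⊗ y ^ᶻ n
^ᶻ-⊗ x y zero    = solve 0 (con 1ℤ := con 1ℤ :* con 1ℤ) ≋-refl
^ᶻ-⊗ x y (suc n) = ≋-trans (⊗-cong ≋-refl (^ᶻ-⊗ x y n))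
  (solve 4 (λ x y a b → (x :* y) :* (a :* b) := (x :* a) :* (y :* b)) ≋-refl x y (x ^ᶻ n) (y ^ᶻ n))

⊖-self : ∀ {p} (x : ℤₚ p) → x ⊖ x ≋ ⌜ 0ℤ ⌝
⊖-self = solve 1 (λ x → x :- x := con 0ℤ) ≋-refl

module _ {p : ℕ} where

  approx-mod : (x : ℤₚ p) → ∀ n k → + (p ^ℕ n) ∣ approx x (k +ℕ n) ℤ.- approx x n
  approx-mod x n zero    = ∣-resp (sym (ℤ.+-inverseʳ (approx x n))) ∣0
  approx-mod x n (suc k) = ∣-resp (lem (approx x (suc k +ℕ n)) (approx x (k +ℕ n)) (approx x n))
    (∣m∣n⇒∣m+n (∣-trans (pos-mono (^-∣-^ p (ℕ.m≤n+m n k))) (coherent x (k +ℕ n))) (approx-mod x n k))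
    where
    lem : ∀ a b c → (a ℤ.- b) ℤ.+ (b ℤ.- c) ≡ a ℤ.- c
    lem = solve-∀

  private
    add-back : ∀ a b → (a ℤ.- b) ℤ.+ b ≡ a
    add-back = solve-∀
    sub-back : ∀ a b → a ℤ.- (a ℤ.- b) ≡ b
    sub-back = solve-∀

    lift-∣ : (x : ℤₚ p) → ∀ n k → + (p ^ℕ n) ∣ approx x n → + (p ^ℕ n) ∣ approx x (k +ℕ n)
    lift-∣ x n k h = ∣-resp (add-back (approx x (k +ℕ n)) (approx x n)) (∣m∣n⇒∣m+n (approx-mod x n k) h)

    lower-∣ : (x : ℤₚ p) → ∀ n k → + (p ^ℕ n) ∣ approx x (k +ℕ n) → + (p ^ℕ n) ∣ approx x n
    lower-∣ x n k h = ∣-resp (sub-back (approx x (k +ℕ n)) (approx x n)) (∣m∣n⇒∣m-n h (approx-mod x n k))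

  opaque
    unfolding _≋_

    ∣ₚ-0 : (x : ℤₚ p) → 0 ∣ₚ x
    ∣ₚ-0 x = divides (approx x 0) (sym (ℤ.*-identityʳ _))

    ∣ₚ-cong : ∀ {t} {x y : ℤₚ p} → x ≋ y → t ∣ₚ x → t ∣ₚ y
    ∣ₚ-cong {t} {x} {y} h d = ∣-resp (sub-back (approx x t) (approx y t)) (∣m∣n⇒∣m-n d (h t))

    ∣ₚ-≤ : ∀ {s t} {x : ℤₚ p} → s ≤ t → t ∣ₚ x → s ∣ₚ x
    ∣ₚ-≤ {s} {t} {x} s≤t d = lower-∣ x s (t ℕ.∸ s)
      (subst (λ u → + (p ^ℕ s) ∣ approx x u) (sym (ℕ.m∸n+n≡m s≤t)) (∣-trans (pos-mono (^-∣-^ p s≤t)) d))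

    ∣ₚ-⊕ : ∀ {t} {x y : ℤₚ p} → t ∣ₚ x → t ∣ₚ y → t ∣ₚ x ⊕ y
    ∣ₚ-⊕ d e = ∣m∣n⇒∣m+n d e

    ∣ₚ-⊝ : ∀ {t} {x : ℤₚ p} → t ∣ₚ x → t ∣ₚ ⊝ x
    ∣ₚ-⊝ d = ∣m⇒∣-m d

    ∣ₚ-⊗ : ∀ {s t} {x y : ℤₚ p} → s ∣ₚ x → t ∣ₚ y → s +ℕ t ∣ₚ x ⊗ y
    ∣ₚ-⊗ {s} {t} {x} {y} d e = ∣-trans
      (∣-reflexive (trans (cong +_ (ℕ.^-distribˡ-+-* p s t)) (ℤ.pos-* (p ^ℕ s) (p ^ℕ t))))
      (∣-*-∣ (subst (λ u → + (p ^ℕ s) ∣ approx x u) (ℕ.+-comm t s) (lift-∣ x s t d)) (lift-∣ y t s e))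

    ∣ₚ-⌜⌝ : ∀ {t z} → + (p ^ℕ t) ∣ z → t ∣ₚ ⌜_⌝ {p} z
    ∣ₚ-⌜⌝ d = d

    ∣ₚ-⌜⌝⁻¹ : ∀ {t z} → t ∣ₚ ⌜_⌝ {p} z → + (p ^ℕ t) ∣ z
    ∣ₚ-⌜⌝⁻¹ d = d

    ≋⇒∣ₚ : {x y : ℤₚ p} → x ≋ y → ∀ t → t ∣ₚ x ⊖ y
    ≋⇒∣ₚ h = h

    ∣ₚ⇒≋ : {x y : ℤₚ p} → (∀ t → t ∣ₚ x ⊖ y) → x ≋ y
    ∣ₚ⇒≋ h = h

    approximation : (x : ℤₚ p) → ∀ t → t ∣ₚ x ⊖ ⌜ approx x t ⌝
    approximation x t = ∣-resp (sym (ℤ.+-inverseʳ (approx x t))) ∣0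

    -- A diagonal choice: level n of the limit is level n of the n-th term. Passing from n + 1 to n
    -- changes first the level and then the term, and both changes vanish modulo p^n.
    cauchy-limit : (r : ℕ → ℤₚ p) → (∀ n → n ∣ₚ r (suc n) ⊖ r n) → ∃[ x ] (∀ n → n ∣ₚ x ⊖ r n)
    cauchy-limit r h = record
      { approx   = λ n → approx (r n) n
      ; coherent = λ n → ∣-resp (lem (approx (r (suc n)) (suc n)) (approx (r (suc n)) n) (approx (r n) n))
          (∣m∣n⇒∣m+n (coherent (r (suc n)) n) (h n)) }
      , λ n → ∣-resp (sym (ℤ.+-inverseʳ (approx (r n) n))) ∣0
      where
      lem : ∀ a b c → (a ℤ.- b) ℤ.+ (b ℤ.- c) ≡ a ℤ.- c
      lem = solve-∀

    -- Division by p^t costs t digits of precision, so level n of the quotient is computed from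
    -- level n + t of x.
    ∣ₚ-divide : .{{_ : NonZero p}} → ∀ {t} {x : ℤₚ p} → t ∣ₚ x → ∃[ y ] nat (p ^ℕ t) ⊗ y ≋ x
    ∣ₚ-divide {t} {x} d = y , λ n → ∣-resp (cong (ℤ._- approx x n)
        (trans (_∣_.equality (q n)) (ℤ.*-comm (_∣_.quotient (q n)) (+ (p ^ℕ t)))))
        (subst (λ u → + (p ^ℕ n) ∣ approx x u ℤ.- approx x n) (ℕ.+-comm t n) (approx-mod x n t))
      where
      instance
        p^t≢0 : ℤ.NonZero (+ (p ^ℕ t))
        p^t≢0 = ℕ.m^n≢0 p t
      q : ∀ n → + (p ^ℕ t) ∣ approx x (n +ℕ t)
      q n = lift-∣ x t n d
      lem : ∀ a b c → (a ℤ.- b) ℤ.* c ≡ a ℤ.* c ℤ.- b ℤ.* c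
      lem = solve-∀
      y : ℤₚ p
      y = record
        { approx   = λ n → _∣_.quotient (q n)
        ; coherent = λ n → *-cancelʳ-∣ (+ (p ^ℕ t)) (subst (_∣ (_∣_.quotient (q (suc n)) ℤ.- _∣_.quotient (q n)) ℤ.* + (p ^ℕ t))
            (trans (cong +_ (ℕ.^-distribˡ-+-* p n t)) (ℤ.pos-* (p ^ℕ n) (p ^ℕ t)))
            (∣-resp (trans (cong₂ ℤ._-_ (_∣_.equality (q (suc n))) (_∣_.equality (q n)))
                    (sym (lem (_∣_.quotient (q (suc n))) (_∣_.quotient (q n)) (+ (p ^ℕ t)))))
              (coherent x (n +ℕ t)))) }

    -- The hypotheses live at the levels a + 1 and a + t. At the common level a + t + 1 both become
    -- statements about integers, to which `prime-power-cancel` applies.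
    ∣ₚ-cancel : Prime p → ∀ {a t} {x y : ℤₚ p} → ¬ suc a ∣ₚ x → a +ℕ t ∣ₚ x ⊗ y → t ∣ₚ y
    ∣ₚ-cancel pr {a} {t} {x} {y} ∤x d = lower-∣ y t (suc a) (∣ᵤ⇒∣ (prime-power-cancel pr a ℤ.∣ approx x (suc (a +ℕ t)) ∣
      (λ e → ∤x (lower-∣ x (suc a) t (∣ᵤ⇒∣ (subst (λ u → p ^ℕ suc a ℕ∣.∣ ℤ.∣ approx x u ∣) (ℕ.+-comm (suc a) t) e))))
      (subst (p ^ℕ (a +ℕ t) ℕ∣.∣_) (ℤ.abs-* (approx x (suc (a +ℕ t))) (approx y (suc (a +ℕ t))))
        (∣⇒∣ᵤ (lift-∣ (x ⊗ y) (a +ℕ t) 1 d)))))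

    inverse-of-coprime : ∀ {c} → Coprime c p → ∃[ u ] nat {p} c ⊗ u ≋ ⌜ 1ℤ ⌝
    inverse-of-coprime cop = unitInverse cop , λ n → proj₂ (inverse-mod (coprime-^ʳ n cop))

module _ {p : ℕ} where

  ∣ₚ-exponent : ∀ {s t} {x : ℤₚ p} → s ≡ t → s ∣ₚ x → t ∣ₚ x
  ∣ₚ-exponent refl d = d

  ∣ₚ-⊖ : ∀ {t} {x y : ℤₚ p} → t ∣ₚ x → t ∣ₚ y → t ∣ₚ x ⊖ y
  ∣ₚ-⊖ d e = ∣ₚ-⊕ d (∣ₚ-⊝ e)

  ∣ₚ-⊗ˡ : ∀ {t} (x : ℤₚ p) {y} → t ∣ₚ y → t ∣ₚ x ⊗ y
  ∣ₚ-⊗ˡ x d = ∣ₚ-⊗ (∣ₚ-0 x) d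

  ∣ₚ-⊗ʳ : ∀ {t} {x : ℤₚ p} y → t ∣ₚ x → t ∣ₚ x ⊗ y
  ∣ₚ-⊗ʳ y d = ∣ₚ-cong (solve 2 (λ x y → y :* x := x :* y) ≋-refl _ y) (∣ₚ-⊗ˡ y d)

  ∣ₚ-^ : ∀ {t} {x : ℤₚ p} → t ∣ₚ x → ∀ m → m *ℕ t ∣ₚ x ^ᶻ m
  ∣ₚ-^ d zero    = ∣ₚ-0 _
  ∣ₚ-^ d (suc m) = ∣ₚ-⊗ d (∣ₚ-^ d m)

  mod-refl : ∀ {t} {x : ℤₚ p} → t ∣ₚ x ⊖ x
  mod-refl {t} = ≋⇒∣ₚ ≋-refl t

  mod-sym : ∀ {t} {x y : ℤₚ p} → t ∣ₚ x ⊖ y → t ∣ₚ y ⊖ x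
  mod-sym d = ∣ₚ-cong (solve 2 (λ x y → :- (x :- y) := y :- x) ≋-refl _ _) (∣ₚ-⊝ d)

  mod-trans : ∀ {t} {x y z : ℤₚ p} → t ∣ₚ x ⊖ y → t ∣ₚ y ⊖ z → t ∣ₚ x ⊖ z
  mod-trans {y = y} d e = ∣ₚ-cong (solve 3 (λ x y z → (x :- y) :+ (y :- z) := x :- z) ≋-refl _ y _) (∣ₚ-⊕ d e)

  mod-⊕ : ∀ {t} {x y z w : ℤₚ p} → t ∣ₚ x ⊖ y → t ∣ₚ z ⊖ w → t ∣ₚ (x ⊕ z) ⊖ (y ⊕ w)
  mod-⊕ d e = ∣ₚ-cong (solve 4 (λ x y z w → (x :- y) :+ (z :- w) := (x :+ z) :- (y :+ w)) ≋-refl _ _ _ _) (∣ₚ-⊕ d e)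

  mod-⊗ : ∀ {t} {x y z w : ℤₚ p} → t ∣ₚ x ⊖ y → t ∣ₚ z ⊖ w → t ∣ₚ (x ⊗ z) ⊖ (y ⊗ w)
  mod-⊗ {x = x} {y} {z} {w} d e = ∣ₚ-cong
    (solve 4 (λ x y z w → (x :- y) :* z :+ y :* (z :- w) := (x :* z) :- (y :* w)) ≋-refl x y z w)
    (∣ₚ-⊕ (∣ₚ-⊗ʳ z d) (∣ₚ-⊗ˡ y e))

  mod-^ : ∀ {t} {x y : ℤₚ p} → t ∣ₚ x ⊖ y → ∀ m → t ∣ₚ (x ^ᶻ m) ⊖ (y ^ᶻ m)
  mod-^ d zero    = mod-refl
  mod-^ d (suc m) = mod-⊗ d (mod-^ d m)

  mod-∣ : ∀ {t} {x y : ℤₚ p} → t ∣ₚ x ⊖ y → t ∣ₚ y → t ∣ₚ x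
  mod-∣ d e = ∣ₚ-cong (solve 2 (λ x y → (x :- y) :+ y := x) ≋-refl _ _) (∣ₚ-⊕ d e)

  mod-congˡ : ∀ {t} {x y z : ℤₚ p} → x ≋ y → t ∣ₚ y ⊖ z → t ∣ₚ x ⊖ z
  mod-congˡ {t} h d = mod-trans (≋⇒∣ₚ h t) d

  mod-congʳ : ∀ {t} {x y z : ℤₚ p} → y ≋ z → t ∣ₚ x ⊖ y → t ∣ₚ x ⊖ z
  mod-congʳ {t} h d = mod-trans d (≋⇒∣ₚ h t)

  ⊖0 : (x : ℤₚ p) → x ⊖ ⌜ 0ℤ ⌝ ≋ x
  ⊖0 = solve 1 (λ x → x :- con 0ℤ := x) ≋-refl

  ≋0⇒∣ₚ : {x : ℤₚ p} → x ≋ ⌜ 0ℤ ⌝ → ∀ t → t ∣ₚ x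
  ≋0⇒∣ₚ {x} h t = ∣ₚ-cong (⊖0 x) (≋⇒∣ₚ h t)

  ∣ₚ⇒≋0 : {x : ℤₚ p} → (∀ t → t ∣ₚ x) → x ≋ ⌜ 0ℤ ⌝
  ∣ₚ⇒≋0 {x} h = ∣ₚ⇒≋ λ t → ∣ₚ-cong (≋-sym (⊖0 x)) (h t)

  ⊖≋0⇒≋ : {x y : ℤₚ p} → x ⊖ y ≋ ⌜ 0ℤ ⌝ → x ≋ y
  ⊖≋0⇒≋ h = ∣ₚ⇒≋ (≋0⇒∣ₚ h)

  ≋⇒⊖≋0 : {x y : ℤₚ p} → x ≋ y → x ⊖ y ≋ ⌜ 0ℤ ⌝
  ≋⇒⊖≋0 {x} {y} h = ≋-trans (⊕-cong h ≋-refl) (⊖-self y)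

  ⊗0 : (x : ℤₚ p) → x ⊗ ⌜ 0ℤ ⌝ ≋ ⌜ 0ℤ ⌝
  ⊗0 = solve 1 (λ x → x :* con 0ℤ := con 0ℤ) ≋-refl

  nat-∣ₚ : ∀ {t A} → p ^ℕ t ℕ∣.∣ A → t ∣ₚ nat {p} A
  nat-∣ₚ d = ∣ₚ-⌜⌝ (pos-mono d)

  nat-∣ₚ⁻¹ : ∀ {t A} → t ∣ₚ nat {p} A → p ^ℕ t ℕ∣.∣ A
  nat-∣ₚ⁻¹ d = ∣⇒∣ᵤ (∣ₚ-⌜⌝⁻¹ d)

  nat-p^ : ∀ t → t ∣ₚ nat {p} (p ^ℕ t)
  nat-p^ t = nat-∣ₚ ℕ∣.∣-refl

module _ {p : ℕ} (pr : Prime p) where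

  private
    instance
      p≢0 : NonZero p
      p≢0 = prime⇒nonZero pr

  nat-p^-∤ : ∀ t → ¬ suc t ∣ₚ nat {p} (p ^ℕ t)
  nat-p^-∤ t d = ℕ.<⇒≱ (ℕ.^-monoʳ-< p (ℕ.nonTrivial⇒n>1 p {{prime⇒nonTrivial pr}}) (ℕ.n<1+n t))
    (ℕ∣.∣⇒≤ {{ℕ.m^n≢0 p t}} (nat-∣ₚ⁻¹ d))

  ⊗≋0 : ∀ {a} {x y : ℤₚ p} → ¬ a ∣ₚ x → x ⊗ y ≋ ⌜ 0ℤ ⌝ → y ≋ ⌜ 0ℤ ⌝
  ⊗≋0 {a} ∤x h = ∣ₚ⇒≋0 λ t → ∣ₚ-cancel pr (∤x ∘ ∣ₚ-≤ (ℕ.n≤1+n a)) (≋0⇒∣ₚ h (a +ℕ t))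

  ⊗-cancelˡ : ∀ {a} {x y z : ℤₚ p} → ¬ a ∣ₚ x → x ⊗ y ≋ x ⊗ z → y ≋ z
  ⊗-cancelˡ {x = x} {y} {z} ∤x h = ⊖≋0⇒≋ (⊗≋0 ∤x (≋-trans
    (solve 3 (λ x y z → x :* (y :- z) := x :* y :- x :* z) ≋-refl x y z) (≋⇒⊖≋0 h)))

  ∤-⊗ : ∀ {a c} {x y : ℤₚ p} → ¬ suc a ∣ₚ x → ¬ suc c ∣ₚ y → ¬ suc (a +ℕ c) ∣ₚ x ⊗ y
  ∤-⊗ {a} {c} {x} {y} ∤x ∤y d = ∤y (∣ₚ-cancel pr ∤x (subst (_∣ₚ x ⊗ y) (sym (ℕ.+-suc a c)) d))

  unit-cancel : ∀ {t} {x y : ℤₚ p} → ¬ 1 ∣ₚ x → t ∣ₚ x ⊗ y → t ∣ₚ y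
  unit-cancel = ∣ₚ-cancel pr

  p^-cancel : ∀ s {t} {x : ℤₚ p} → s +ℕ t ∣ₚ nat (p ^ℕ s) ⊗ x → t ∣ₚ x
  p^-cancel s = ∣ₚ-cancel pr (nat-p^-∤ s)

  ¬-∣1 : ¬ 1 ∣ₚ ⌜_⌝ {p} 1ℤ
  ¬-∣1 d = nat-p^-∤ 0 d

  nat-unit : ∀ {c} → ¬ p ℕ∣.∣ c → ¬ 1 ∣ₚ nat {p} c
  nat-unit {c} p∤c d = p∤c (subst (ℕ∣._∣ c) (ℕ.*-identityʳ p) (nat-∣ₚ⁻¹ d))

  ∤-^ : ∀ {a} {x : ℤₚ p} → ¬ suc a ∣ₚ x → ∀ m → ¬ suc (m *ℕ a) ∣ₚ x ^ᶻ m
  ∤-^ ∤x zero    = ¬-∣1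
  ∤-^ ∤x (suc m) = ∤-⊗ ∤x (∤-^ ∤x m)

  ∣-nat-split : ∀ {A} (A-split : Split p A) → Split.v A-split ∣ₚ nat {p} A
  ∣-nat-split sp = nat-∣ₚ (subst (p ^ℕ Split.v sp ℕ∣.∣_) (sym (Split.factorises sp)) (ℕ∣.m∣m*n _))

  ∤-nat-split : ∀ {A} (A-split : Split p A) → ¬ suc (Split.v A-split) ∣ₚ nat {p} A
  ∤-nat-split {A} sp d = subst (λ u → ¬ suc u ∣ₚ nat (p ^ℕ v) ⊗ nat cofactor) (ℕ.+-identityʳ v)
    (∤-⊗ (nat-p^-∤ v) (nat-unit p∤cofactor))
    (∣ₚ-cong (≋-trans (≡⇒≋ (cong nat factorises)) (nat-* (p ^ℕ v) cofactor)) d)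
    where open Split sp

  opaque

    divide-by-nat : ∀ {A} (A-split : Split p A) {x : ℤₚ p} → Split.v A-split ∣ₚ x → ∃[ y ] nat A ⊗ y ≋ x
    divide-by-nat {A} sp {x} d with inverse-of-coprime (∤⇒coprime pr (Split.p∤cofactor sp)) | ∣ₚ-divide d
    ... | u , cu≋1 | y , eq = u ⊗ y ,
      ≋-trans (⊗-cong (≋-trans (≡⇒≋ (cong nat factorises)) (nat-* (p ^ℕ v) cofactor)) ≋-refl)
      (≋-trans (solve 4 (λ q c u y → (q :* c) :* (u :* y) := (c :* u) :* (q :* y)) ≋-refl (nat (p ^ℕ v)) (nat cofactor) u y)
      (≋-trans (⊗-cong cu≋1 eq) (solve 1 (λ x → con 1ℤ :* x := x) ≋-refl x)))
      where open Split sp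

    nat-≢0 : ∀ A .{{_ : NonZero A}} → ∃[ a ] ¬ suc a ∣ₚ nat {p} A
    nat-≢0 A = Split.v (split pr A) , ∤-nat-split (split pr A)

  nat-cancel : ∀ A .{{_ : NonZero A}} {x y : ℤₚ p} → nat A ⊗ x ≋ nat A ⊗ y → x ≋ y
  nat-cancel A = ⊗-cancelˡ (proj₂ (nat-≢0 A))

exact-unique : ∀ {q m n} {x : ℤₚ q} → m ∣ₚ x → ¬ suc m ∣ₚ x → n ∣ₚ x → ¬ suc n ∣ₚ x → m ≡ n
exact-unique d ∤ d′ ∤′ = ℕ.≤-antisym (ℕ.≮⇒≥ λ n<m → ∤′ (∣ₚ-≤ n<m d)) (ℕ.≮⇒≥ λ m<n → ∤ (∣ₚ-≤ m<n d′))

-- Classical logic and exact valuations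

module Classical (em : ExcludedMiddle 0ℓ) where

  ¬∀⇒∃¬ : {A : Set} {P : A → Set} → ¬ (∀ x → P x) → ∃[ x ] ¬ P x
  ¬∀⇒∃¬ {A} {P} h with em {∃[ x ] ¬ P x}
  ... | yes e = e
  ... | no ¬e = contradiction (λ x → decide x) h
    where
    decide : ∀ x → P x
    decide x with em {P x}
    ... | yes px = px
    ... | no ¬px = contradiction (x , ¬px) ¬e

  ¬¬-elim : {P : Set} → ¬ ¬ P → P
  ¬¬-elim {P} h with em {P}
  ... | yes p = p
  ... | no ¬p = contradiction ¬p h

  last-true : {P : ℕ → Set} → P 0 → ∀ k → ¬ P k → ∃[ V ] (P V × ¬ P (suc V))
  last-true p0 zero ¬pk = contradiction p0 ¬pk
  last-true {P} p0 (suc k) ¬pk with em {P k}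
  ... | yes pk = k , pk , ¬pk
  ... | no ¬pk′ = last-true p0 k ¬pk′

  last-false : {P : ℕ → Set} → ∀ N₀ → (∀ n → N₀ ≤ n → P n) → ∃[ j ] ¬ P j →
               ∃[ N ] (¬ P N × (∀ n → N < n → P n))
  last-false zero h (j , ¬pj) = contradiction (h j z≤n) ¬pj
  last-false {P} (suc N) h e with em {P N}
  ... | no ¬pN = N , ¬pN , h
  ... | yes pN = last-false N (λ n N≤n → go n (ℕ.m≤n⇒m<n∨m≡n N≤n)) e
    where
    go : ∀ n → N < n ⊎ N ≡ n → P n
    go n (inj₁ N<n)  = h n N<n
    go n (inj₂ refl) = pN

  ≉0⇒∤ : ∀ {p} {x : ℤₚ p} → ¬ x ≋ ⌜ 0ℤ ⌝ → ∃[ a ] ¬ a ∣ₚ x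
  ≉0⇒∤ h = ¬∀⇒∃¬ (h ∘ ∣ₚ⇒≋0)

  exact-valuation : ∀ {p} {x : ℤₚ p} → ¬ x ≋ ⌜ 0ℤ ⌝ → ∃[ a ] (a ∣ₚ x × ¬ suc a ∣ₚ x)
  exact-valuation {x = x} h with ≉0⇒∤ h
  ... | k , ∤x = last-true (∣ₚ-0 x) k ∤x

-- Power series over ℤₚ

-- Coefficients tending to 0 are exactly what convergence on all of ℤₚ requires: these are the
-- elements of the Tate algebra ℤₚ⟨x⟩.
record Series (p : ℕ) : Set where
  field
    coefficient : ℕ → ℤₚ p
    vanishing   : ∀ k → ∃[ N ] (∀ n → N ≤ n → k ∣ₚ coefficient n)

open Series

DivisibleFrom : ∀ {p} → ℕ → ℕ → (ℕ → ℤₚ p) → Set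
DivisibleFrom k N a = ∀ n → N ≤ n → k ∣ₚ a n

-- horner N a x = Σ_{j < N} aⱼ xʲ
horner : ∀ {p} → ℕ → (ℕ → ℤₚ p) → ℤₚ p → ℤₚ p
horner zero    a x = ⌜ 0ℤ ⌝
horner (suc N) a x = a 0 ⊕ x ⊗ horner N (a ∘ suc) x

module _ {p : ℕ} where

  horner-∣ : ∀ {k} N {a : ℕ → ℤₚ p} x → (∀ n → k ∣ₚ a n) → k ∣ₚ horner N a x
  horner-∣ {k} zero    x h = ≋0⇒∣ₚ ≋-refl k
  horner-∣ (suc N) x h = ∣ₚ-⊕ (h 0) (∣ₚ-⊗ˡ x (horner-∣ N x (h ∘ suc)))

  horner-stable : ∀ {k} M M′ {a : ℕ → ℤₚ p} x → DivisibleFrom k M a → DivisibleFrom k M′ a →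
                  k ∣ₚ horner M a x ⊖ horner M′ a x
  horner-stable zero    M′      x h h′ = mod-sym (∣ₚ-cong (≋-sym (⊖0 _)) (horner-∣ M′ x λ n → h n z≤n))
  horner-stable (suc M) zero    x h h′ = ∣ₚ-cong (≋-sym (⊖0 _)) (horner-∣ (suc M) x λ n → h′ n z≤n)
  horner-stable (suc M) (suc M′) x h h′ = mod-⊕ mod-refl (mod-⊗ mod-refl
    (horner-stable M M′ x (λ n le → h (suc n) (s≤s le)) (λ n le → h′ (suc n) (s≤s le))))

  horner-cong : ∀ N {a c : ℕ → ℤₚ p} x → (∀ n → a n ≋ c n) → horner N a x ≋ horner N c x
  horner-cong zero    x h = ≋-refl
  horner-cong (suc N) x h = ⊕-cong (h 0) (⊗-cong ≋-refl (horner-cong N x (h ∘ suc)))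

  horner-lipschitz : ∀ {t} N (a : ℕ → ℤₚ p) {x y} → t ∣ₚ x ⊖ y → t ∣ₚ horner N a x ⊖ horner N a y
  horner-lipschitz zero    a d = mod-refl
  horner-lipschitz (suc N) a d = mod-⊕ mod-refl (mod-⊗ d (horner-lipschitz N (a ∘ suc) d))

  private
    threshold : Series p → ℕ → ℕ
    threshold A k = proj₁ (vanishing A k)

    divisible : (A : Series p) → ∀ k → DivisibleFrom k (threshold A k) (coefficient A)
    divisible A k = proj₂ (vanishing A k)

    limit : (A : Series p) (x : ℤₚ p) →
            ∃[ y ] (∀ k → k ∣ₚ y ⊖ horner (threshold A k) (coefficient A) x)
    limit A x = cauchy-limit (λ k → horner (threshold A k) (coefficient A) x)
      λ k → horner-stable (threshold A (suc k)) (threshold A k) x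
        (λ n le → ∣ₚ-≤ (ℕ.n≤1+n k) (divisible A (suc k) n le)) (divisible A k)

  opaque

    eval : Series p → ℤₚ p → ℤₚ p
    eval A x = proj₁ (limit A x)

    -- Further properties of `eval` are derived from this congruence. M may be any index past which
    -- the coefficients vanish modulo p^k, so two series can be compared through truncations of
    -- matching lengths.
    eval-mod : (A : Series p) → ∀ {k} M x → DivisibleFrom k M (coefficient A) →
               k ∣ₚ eval A x ⊖ horner M (coefficient A) x
    eval-mod A {k} M x h = mod-trans (proj₂ (limit A x) k)
      (horner-stable (threshold A k) M x (divisible A k) h)

  drop : ℕ → Series p → Series p
  drop m A = record
    { coefficient = λ n → coefficient A (m +ℕ n)
    ; vanishing   = λ k → threshold A k , λ n le → divisible A k (m +ℕ n) (ℕ.≤-trans le (ℕ.m≤n+m n m)) }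

  eval-step : (A : Series p) → ∀ x → eval A x ≋ coefficient A 0 ⊕ x ⊗ eval (drop 1 A) x
  eval-step A x = ∣ₚ⇒≋ λ k → mod-trans
    (eval-mod A (suc (threshold A k)) x λ n le → divisible A k n (ℕ.≤-trans (ℕ.n≤1+n _) le))
    (mod-⊕ mod-refl (mod-⊗ mod-refl (mod-sym (eval-mod (drop 1 A) (threshold A k) x
      λ n le → divisible A k (suc n) (ℕ.≤-trans le (ℕ.n≤1+n n))))))

  eval-∣ : (A : Series p) → ∀ {k} x → (∀ n → k ∣ₚ coefficient A n) → k ∣ₚ eval A x
  eval-∣ A x h = ∣ₚ-cong (⊖0 _) (eval-mod A 0 x λ n _ → h n)

  eval-cong : (A C : Series p) → (∀ n → coefficient A n ≋ coefficient C n) → ∀ x → eval A x ≋ eval C x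
  eval-cong A C h x = ∣ₚ⇒≋ λ k → mod-trans (eval-mod A (threshold A k) x (divisible A k))
    (mod-congˡ (horner-cong (threshold A k) x h)
      (mod-sym (eval-mod C (threshold A k) x λ n le → ∣ₚ-cong (h n) (divisible A k n le))))

  eval-lipschitz : (A : Series p) → ∀ {t x y} → t ∣ₚ x ⊖ y → t ∣ₚ eval A x ⊖ eval A y
  eval-lipschitz A {t} {x} {y} d = mod-trans (eval-mod A (threshold A t) x (divisible A t))
    (mod-trans (horner-lipschitz (threshold A t) (coefficient A) d)
      (mod-sym (eval-mod A (threshold A t) y (divisible A t))))

  eval-≋ : (A : Series p) → ∀ {x y} → x ≋ y → eval A x ≋ eval A y
  eval-≋ A h = ∣ₚ⇒≋ λ t → eval-lipschitz A (≋⇒∣ₚ h t)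

  -- Synthetic division by x - θ
  quotientAt : ℤₚ p → Series p → Series p
  quotientAt θ A = record
    { coefficient = λ n → eval (drop (suc n) A) θ
    ; vanishing   = λ k → threshold A k , λ n le → eval-∣ (drop (suc n) A) θ
        λ j → divisible A k (suc n +ℕ j) (ℕ.≤-trans le (ℕ.≤-trans (ℕ.m≤m+n n j) (ℕ.n≤1+n _))) }

  -- The error of the division of A is x times the error for `drop 1 A`. After N steps all remaining
  -- coefficients are divisible by p^k, and so is the error.
  quotientAt-mod : ∀ k N (A : Series p) θ x → DivisibleFrom k N (coefficient A) →
                   k ∣ₚ (x ⊖ θ) ⊗ eval (quotientAt θ A) x ⊖ (eval A x ⊖ eval A θ)
  quotientAt-mod k zero A θ x h = ∣ₚ-⊖
    (∣ₚ-⊗ˡ (x ⊖ θ) (eval-∣ (quotientAt θ A) x λ n → eval-∣ (drop (suc n) A) θ λ j → h (suc n +ℕ j) z≤n))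
    (∣ₚ-⊖ (eval-∣ A x λ n → h n z≤n) (eval-∣ A θ λ n → h n z≤n))
  quotientAt-mod k (suc N) A θ x h = ∣ₚ-cong (≋-sym factor)
    (∣ₚ-⊗ˡ x (quotientAt-mod k N A′ θ x λ n le → h (suc n) (s≤s le)))
    where
    A′ Q Q′ : Series p
    A′ = drop 1 A
    Q  = quotientAt θ A
    Q′ = quotientAt θ A′
    step-Q : eval Q x ≋ eval A′ θ ⊕ x ⊗ eval Q′ x
    step-Q = ≋-trans (eval-step Q x) (⊕-cong
      (eval-cong (drop 1 A) A′ (λ _ → ≋-refl) θ)
      (⊗-cong ≋-refl (eval-cong (drop 1 Q) Q′ (λ n → eval-cong _ _ (λ _ → ≋-refl) θ) x)))
    factor : (x ⊖ θ) ⊗ eval Q x ⊖ (eval A x ⊖ eval A θ) ≋ x ⊗ ((x ⊖ θ) ⊗ eval Q′ x ⊖ (eval A′ x ⊖ eval A′ θ))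
    factor = ≋-trans (⊕-cong (⊗-cong ≋-refl step-Q) (⊝-cong (⊕-cong (eval-step A x) (⊝-cong (eval-step A θ)))))
      (solve 6 (λ x θ q a₀ a b → (x :- θ) :* (b :+ x :* q) :- ((a₀ :+ x :* a) :- (a₀ :+ θ :* b))
                 := x :* ((x :- θ) :* q :- (a :- b))) ≋-refl
        x θ (eval Q′ x) (coefficient A 0) (eval A′ x) (eval A′ θ))

  eval-quotientAt : ∀ (A : Series p) {θ} → eval A θ ≋ ⌜ 0ℤ ⌝ → ∀ x → eval A x ≋ (x ⊖ θ) ⊗ eval (quotientAt θ A) x
  eval-quotientAt A {θ} root x = ≋-sym (≋-trans
    (∣ₚ⇒≋ λ k → quotientAt-mod k (threshold A k) A θ x (divisible A k))
    (≋-trans (⊕-cong ≋-refl (⊝-cong root)) (⊖0 _)))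

  -- V is the minimal valuation of a coefficient, and N the last index at
  -- which it is attained (the Strassman bound for the number of roots).
  record Strassman (V N : ℕ) (A : Series p) : Set where
    field
      all-divisible : ∀ n → V ∣ₚ coefficient A n
      attained      : ¬ suc V ∣ₚ coefficient A N
      beyond        : ∀ n → N < n → suc V ∣ₚ coefficient A n

  open Strassman

  -- The n-th coefficient of the quotient is the sum of a_{n+1+j} θ^j over j. Modulo p^(V+1) only j
  -- = 0 survives at n = N, and nothing survives for n > N.
  quotientAt-Strassman : ∀ {V N} (A : Series p) θ → Strassman V (suc N) A → Strassman V N (quotientAt θ A)
  quotientAt-Strassman {V} {N} A θ S = record
    { all-divisible = λ n → eval-∣ (drop (suc n) A) θ λ j → all-divisible S (suc n +ℕ j)
    ; attained = λ d → attained S (∣ₚ-cong (lem (coefficient A (suc N)) (θ ⊗ eval D θ))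
        (∣ₚ-⊖ (∣ₚ-cong (≋-trans (eval-step (drop (suc N) A) θ) (⊕-cong (≡⇒≋ (cong (coefficient A) (ℕ.+-identityʳ (suc N)))) ≋-refl)) d)
          (∣ₚ-⊗ˡ θ (eval-∣ D θ λ j → beyond S (suc N +ℕ suc j) (s≤s (ℕ.m<m+n N (s≤s z≤n)))))))
    ; beyond = λ n N<n → eval-∣ (drop (suc n) A) θ λ j →
        beyond S (suc n +ℕ j) (s≤s (ℕ.≤-trans N<n (ℕ.m≤m+n n j))) }
    where
    D : Series p
    D = drop 1 (drop (suc N) A)
    lem : ∀ a b → (a ⊕ b) ⊖ b ≋ a
    lem = solve 2 (λ a b → (a :+ b) :- b := a) ≋-refl

  -- The constant term has a strictly smaller valuation than all other terms together, so nothing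
  -- can cancel it.
  Strassman-0-rootless : ∀ {V} (A : Series p) → Strassman V 0 A → ∀ x → ¬ eval A x ≋ ⌜ 0ℤ ⌝
  Strassman-0-rootless {V} A S x root = attained S (∣ₚ-cong (lem (coefficient A 0) (x ⊗ eval (drop 1 A) x))
    (∣ₚ-⊖ (∣ₚ-cong (eval-step A x) (≋0⇒∣ₚ root (suc V))) (∣ₚ-⊗ˡ x (eval-∣ (drop 1 A) x λ n → beyond S (suc n) (s≤s z≤n)))))
    where
    lem : ∀ a b → (a ⊕ b) ⊖ b ≋ a
    lem = solve 2 (λ a b → (a :+ b) :- b := a) ≋-refl

linearProduct : ∀ {p r} → (Fin r → ℤₚ p) → ℤₚ p → ℤₚ p
linearProduct {r = zero}  θ x = ⌜ 1ℤ ⌝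
linearProduct {r = suc r} θ x = (x ⊖ θ zero) ⊗ linearProduct (θ ∘ suc) x

-- Multiplicities are recorded by repetition in `root`.
record RootFactorisation {p : ℕ} (F : ℤₚ p → ℤₚ p) : Set where
  field
    {count}  : ℕ
    root     : Fin count → ℤₚ p
    cofactor : Series p
    factors  : ∀ x → F x ≋ linearProduct root x ⊗ eval cofactor x
    rootless : ∀ x → ¬ eval cofactor x ≋ ⌜ 0ℤ ⌝

module _ (em : ExcludedMiddle 0ℓ) {p : ℕ} where
  open Classical em
  open Strassman

  factorise-Strassman : ∀ V N (A : Series p) → Strassman V N A → RootFactorisation (eval A)
  factorise-Strassman V N A S with em {∃[ θ ] eval A θ ≋ ⌜ 0ℤ ⌝}
  ... | no ¬root = record
    { count = 0 ; root = λ () ; cofactor = A ; factors = λ x → ≋-sym (Ring.*-identityˡ (eval A x))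
    ; rootless = λ x e → ¬root (x , e) }
  factorise-Strassman V zero A S | yes (θ , e) = contradiction e (Strassman-0-rootless A S θ)
  factorise-Strassman V (suc N) A S | yes (θ , e) = record
    { count = suc count ; root = λ { zero → θ ; (suc i) → root i } ; cofactor = cofactor ; rootless = rootless
    ; factors = λ x → ≋-trans (eval-quotientAt A e x) (≋-trans (⊗-cong ≋-refl (factors x))
        (≋-sym (Ring.*-assoc (x ⊖ θ) (linearProduct root x) (eval cofactor x)))) }
    where open RootFactorisation (factorise-Strassman V N (quotientAt θ A) (quotientAt-Strassman A θ S))

  -- V exists because not all coefficients vanish, and N because only finitely many of them fail to
  -- be divisible by p^(V+1).
  Strassman-exists : (A : Series p) → ¬ (∀ x → eval A x ≋ ⌜ 0ℤ ⌝) → ∃[ V ] ∃[ N ] Strassman V N A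
  Strassman-exists A A≢0 = V , proj₁ last , record
    { all-divisible = proj₁ (proj₂ minimal) ; attained = proj₁ (proj₂ last) ; beyond = proj₂ (proj₂ last) }
    where
    some : ∃[ k ] ¬ (∀ n → k ∣ₚ coefficient A n)
    some = ¬∀⇒∃¬ λ h → A≢0 λ x → ∣ₚ⇒≋0 λ k → eval-∣ A x (h k)
    minimal : ∃[ V ] ((∀ n → V ∣ₚ coefficient A n) × ¬ (∀ n → suc V ∣ₚ coefficient A n))
    minimal = last-true (λ n → ∣ₚ-0 _) (proj₁ some) (proj₂ some)
    V : ℕ
    V = proj₁ minimal
    last = last-false {λ n → suc V ∣ₚ coefficient A n} (proj₁ (vanishing A (suc V))) (proj₂ (vanishing A (suc V)))
      (¬∀⇒∃¬ (proj₂ (proj₂ minimal)))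

  root-factorisation : (A : Series p) → ¬ (∀ x → eval A x ≋ ⌜ 0ℤ ⌝) → RootFactorisation (eval A)
  root-factorisation A A≢0 with Strassman-exists A A≢0
  ... | V , N , S = factorise-Strassman V N A S

-- Finiteness of the set of roots, and compactness of ℤₚ

FiniteRoots : ∀ {p} → (ℤₚ p → ℤₚ p) → Set
FiniteRoots {p} F = ∃[ r ] Σ (Fin r → ℤₚ p) λ root → ∀ x → F x ≋ ⌜ 0ℤ ⌝ → ∃[ i ] x ≋ root i

Lipschitz : ∀ {p} → (ℤₚ p → ℤₚ p) → Set
Lipschitz F = ∀ {t x y} → t ∣ₚ x ⊖ y → t ∣ₚ F x ⊖ F y

Lipschitz⇒≋ : ∀ {p} {F : ℤₚ p → ℤₚ p} → Lipschitz F → ∀ {x y} → x ≋ y → F x ≋ F y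
Lipschitz⇒≋ lip h = ∣ₚ⇒≋ λ t → lip (≋⇒∣ₚ h t)

upper-bound : ∀ {K} (t : Fin K → ℕ) → ∃[ T ] (∀ c → t c ≤ T)
upper-bound {zero}  t = 0 , λ ()
upper-bound {suc K} t with upper-bound (t ∘ suc)
... | T , h = t zero ℕ.⊔ T , λ { zero → ℕ.m≤m⊔n _ _ ; (suc c) → ℕ.≤-trans (h c) (ℕ.m≤n⊔m (t zero) T) }

⌜⌝-mod : ∀ {p t} a b → + (p ^ℕ t) ∣ a ℤ.- b → t ∣ₚ ⌜_⌝ {p} a ⊖ ⌜ b ⌝
⌜⌝-mod a b d = ∣ₚ-cong (≋-trans (⌜⌝-+ a (ℤ.- b)) (⊕-cong ≋-refl (⌜⌝-neg b))) (∣ₚ-⌜⌝ d)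

%ℕ-mod : ∀ z P .{{_ : NonZero P}} → + P ∣ z ℤ.- + (z ℤ.%ℕ P)
%ℕ-mod z P = divides (z ℤ./ℕ P) (lem z (+ (z ℤ.%ℕ P)) (z ℤ./ℕ P ℤ.* + P) (ℤ.a≡a%ℕn+[a/ℕn]*n z P))
  where
  lem : ∀ z r u → z ≡ r ℤ.+ u → z ℤ.- r ≡ u
  lem _ r u refl = lem′ r u
    where
    lem′ : ∀ r u → r ℤ.+ u ℤ.- r ≡ u
    lem′ = solve-∀

residue-mod : ∀ {p} .{{_ : NonZero p}} (x : ℤₚ p) → ∀ n → Σ (Fin (p ^ℕ n)) λ c → n ∣ₚ x ⊖ nat (toℕ c)
residue-mod {p} x n = Fin.fromℕ< r< ,
  subst (λ u → n ∣ₚ x ⊖ nat u) (sym (Fin.toℕ-fromℕ< r<)) (mod-trans (approximation x n)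
    (⌜⌝-mod (approx x n) (+ (approx x n ℤ.%ℕ (p ^ℕ n))) (%ℕ-mod (approx x n) (p ^ℕ n))))
  where
  instance
    p^n≢0 : NonZero (p ^ℕ n)
    p^n≢0 = ℕ.m^n≢0 p n
  r< : approx x n ℤ.%ℕ (p ^ℕ n) < p ^ℕ n
  r< = ℤ.n%ℕd<d (approx x n) (p ^ℕ n)

module Compactness (em : ExcludedMiddle 0ℓ) where
  open Classical em

  -- If each colour were absent from some bound on, the colour of an index beyond all these bounds
  -- would violate its own bound.
  infinite-pigeonhole : ∀ {K} (colour : ℕ → Fin K) → ∃[ c ] (∀ N → ∃[ i ] (N ≤ i × colour i ≡ c))
  infinite-pigeonhole colour = ¬¬-elim λ none → refute λ c → ¬∀⇒∃¬ λ h → none (c , h)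
    where
    refute : ¬ (∀ c → ∃[ N ] ¬ (∃[ i ] (N ≤ i × colour i ≡ c)))
    refute bound with upper-bound (proj₁ ∘ bound)
    ... | T , T≥ = proj₂ (bound (colour T)) (T , T≥ (colour T) , refl)

  linearProduct-root : ∀ {p} → Prime p → ∀ {r} (root : Fin r → ℤₚ p) x → linearProduct root x ≋ ⌜ 0ℤ ⌝ → ∃[ i ] x ≋ root i
  linearProduct-root pr {zero}  root x h = contradiction (≋0⇒∣ₚ h 1) (¬-∣1 pr)
  linearProduct-root pr {suc r} root x h with em {x ≋ root zero}
  ... | yes e = zero , e
  ... | no ¬e with linearProduct-root pr (root ∘ suc) x (⊗≋0 pr (proj₂ (≉0⇒∤ (¬e ∘ ⊖≋0⇒≋))) h)
  ... | i , e = suc i , e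

  finite-roots : ∀ {p} → Prime p → {F : ℤₚ p → ℤₚ p} → RootFactorisation F → FiniteRoots F
  finite-roots pr R = _ , root , λ x Fx≋0 → linearProduct-root pr root x
    (⊗≋0 pr (proj₂ (≉0⇒∤ (rootless x)))
      (≋-trans (Ring.*-comm (eval cofactor x) (linearProduct root x)) (≋-trans (≋-sym (factors x)) Fx≋0)))
    where open RootFactorisation R

  module _ {p : ℕ} .{{_ : NonZero p}} {F : ℤₚ p → ℤₚ p} (lip : Lipschitz F) where

    private
      -- The ball r + pⁿℤₚ contains points where F is arbitrarily divisible.
      Accumulates : ℕ → ℕ → Set
      Accumulates n r = ∀ t → ∃[ x ] (n ∣ₚ x ⊖ nat r × t ∣ₚ F x)

      -- The witnesses for t = 0, 1, 2, ... are coloured by their residues modulo p^(n+1). A colour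
      -- recurring for arbitrarily large t serves every t, since divisibility by a higher power of p
      -- implies that by a lower one.
      refine : ∀ {n r} → Accumulates n r → ∃[ r′ ] (n ∣ₚ nat {p} r′ ⊖ nat r × Accumulates (suc n) r′)
      refine {n} {r} acc with infinite-pigeonhole (λ t → proj₁ (residue-mod (proj₁ (acc t)) (suc n)))
      ... | c , often = toℕ c , close , acc′
        where
        near : ∀ t → proj₁ (residue-mod (proj₁ (acc t)) (suc n)) ≡ c → suc n ∣ₚ proj₁ (acc t) ⊖ nat (toℕ c)
        near t refl = proj₂ (residue-mod (proj₁ (acc t)) (suc n))
        close : n ∣ₚ nat (toℕ c) ⊖ nat r
        close with often 0
        ... | t , _ , eq = mod-trans (mod-sym (∣ₚ-≤ (ℕ.n≤1+n n) (near t eq))) (proj₁ (proj₂ (acc t)))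
        acc′ : Accumulates (suc n) (toℕ c)
        acc′ t with often t
        ... | t′ , t≤t′ , eq = proj₁ (acc t′) , near t′ eq , ∣ₚ-≤ t≤t′ (proj₂ (proj₂ (acc t′)))

    -- If F took values of arbitrarily high valuation, nested balls on which it does so would shrink
    -- to a point, and F would vanish there by continuity.
    rootless⇒bounded : (∀ x → ¬ F x ≋ ⌜ 0ℤ ⌝) → ∃[ t ] (∀ x → ¬ t ∣ₚ F x)
    rootless⇒bounded rootless = ¬¬-elim λ unbounded → rootless′ (λ t → ¬¬-elim λ none →
        unbounded (t , λ x d → none (x , ∣ₚ-0 _ , d)))
      where
      rootless′ : ¬ Accumulates 0 0
      rootless′ acc₀ = rootless (proj₁ lim) (∣ₚ⇒≋0 λ t →
          let y , y≈ , t∣Fy = proj₂ (ball t) t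
          in mod-∣ (lip (mod-trans (proj₂ lim t) (mod-sym y≈))) t∣Fy)
        where
        ball : ∀ n → ∃[ r ] Accumulates n r
        ball zero    = 0 , acc₀
        ball (suc n) = proj₁ next , proj₂ (proj₂ next)
          where next = refine (proj₂ (ball n))
        nested : ∀ n → n ∣ₚ nat {p} (proj₁ (ball (suc n))) ⊖ nat (proj₁ (ball n))
        nested n = proj₁ (proj₂ (refine (proj₂ (ball n))))
        lim : ∃[ x ] (∀ n → n ∣ₚ x ⊖ nat (proj₁ (ball n)))
        lim = cauchy-limit (λ n → nat (proj₁ (ball n))) nested

-- Products of pairwise coprime factors

Π-cong : ∀ {n} {u v : Fin n → ℕ} → (∀ i → u i ≡ v i) → Π u ≡ Π v
Π-cong {zero}  h = refl
Π-cong {suc n} h = cong₂ _*ℕ_ (h zero) (Π-cong (h ∘ suc))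

^-distribʳ-* : ∀ m n k → (m *ℕ n) ^ℕ k ≡ m ^ℕ k *ℕ n ^ℕ k
^-distribʳ-* m n zero    = refl
^-distribʳ-* m n (suc k) = trans (cong (m *ℕ n *ℕ_) (^-distribʳ-* m n k)) (lem m n (m ^ℕ k) (n ^ℕ k))
  where
  lem : ∀ m n a b → m *ℕ n *ℕ (a *ℕ b) ≡ m *ℕ a *ℕ (n *ℕ b)
  lem = ℕ-Solver.solve-∀

Π-^ : ∀ {n} (u : Fin n → ℕ) k → Π u ^ℕ k ≡ Π (λ i → u i ^ℕ k)
Π-^ {zero}  u k = ℕ.^-zeroˡ k
Π-^ {suc n} u k = trans (^-distribʳ-* (u zero) (Π (u ∘ suc)) k) (cong (u zero ^ℕ k *ℕ_) (Π-^ (u ∘ suc) k))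

Π-nonZero : ∀ {n} (u : Fin n → ℕ) → (∀ i → NonZero (u i)) → NonZero (Π u)
Π-nonZero {zero}  u h = _
Π-nonZero {suc n} u h = ℕ.m*n≢0 (u zero) _ {{h zero}} {{Π-nonZero (u ∘ suc) (h ∘ suc)}}

-- The number c is the product of the other factors. It serves twice: as the part prime to pᵢ in a
-- product of prime powers, and as the exponent wᵢ that makes all wᵢ mᵢ equal to the product of the
-- mⱼ.
Π-remove : ∀ {n} (u : Fin n → ℕ) i → ∃[ c ] (Π u ≡ u i *ℕ c × (∀ {q} → (∀ j → j ≢ i → Coprime q (u j)) → Coprime q c))
Π-remove {suc n} u zero    = Π (u ∘ suc) , refl , λ h → coprime-Π (u ∘ suc) λ j → h (suc j) λ ()
Π-remove {suc n} u (suc i) with Π-remove (u ∘ suc) i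
... | c , eq , cop = u zero *ℕ c , trans (cong (u zero *ℕ_) eq) (lem (u zero) (u (suc i)) c) ,
  λ h → Coprimality.sym (coprime-* (Coprimality.sym (h zero λ ()))
    (Coprimality.sym (cop λ j j≢i → h (suc j) (j≢i ∘ Fin.suc-injective))))
  where
  lem : ∀ a b c → a *ℕ (b *ℕ c) ≡ b *ℕ (a *ℕ c)
  lem = ℕ-Solver.solve-∀

coprime-*-∣ : ∀ {a c N} → Coprime a c → a ℕ∣.∣ N → c ℕ∣.∣ N → a *ℕ c ℕ∣.∣ N
coprime-*-∣ {a} {c} cop (ℕ∣.divides q refl) c∣N = subst (a *ℕ c ℕ∣.∣_) (ℕ.*-comm a q)
  (ℕ∣.*-monoʳ-∣ a (coprime-divisor (Coprimality.sym cop) (subst (c ℕ∣.∣_) (ℕ.*-comm q a) c∣N)))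

Π-∣ : ∀ {n} (u : Fin n → ℕ) {N} → (∀ {i j} → i ≢ j → Coprime (u i) (u j)) → (∀ i → u i ℕ∣.∣ N) → Π u ℕ∣.∣ N
Π-∣ {zero}  u cop h = ℕ∣.1∣ _
Π-∣ {suc n} u cop h = coprime-*-∣ (coprime-Π (u ∘ suc) λ i → cop λ ()) (h zero)
  (Π-∣ (u ∘ suc) (λ i≢j → cop (i≢j ∘ Fin.suc-injective)) (h ∘ suc))

coprime⇒∤ : ∀ {q c} → Prime q → Coprime q c → ¬ q ℕ∣.∣ c
coprime⇒∤ {q} pr cop d = ℕ.<⇒≢ (ℕ.nonTrivial⇒n>1 q {{prime⇒nonTrivial pr}}) (sym (cop (ℕ∣.∣-refl , d)))

power-split : ∀ {q A} → Prime q → Split q A → ∀ M → Split q (A ^ℕ M)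
power-split {q} {A} pr sp M = record
  { v = v *ℕ M ; cofactor = cofactor ^ℕ M
  ; factorises = trans (cong (_^ℕ M) factorises) (trans (^-distribʳ-* (q ^ℕ v) cofactor M)
      (cong (_*ℕ cofactor ^ℕ M) (ℕ.^-*-assoc q v M)))
  ; p∤cofactor = coprime⇒∤ pr (coprime-^ʳ M (Coprimality.sym (∤⇒coprime pr p∤cofactor))) }
  where open Split sp

small-multiple : ∀ {n P} → n < P → P ℕ∣.∣ n → n ≡ 0
small-multiple {zero}  _   _  = refl
small-multiple {suc n} n<P P∣ = contradiction (ℕ∣.∣⇒≤ P∣) (ℕ.<⇒≱ n<P)

-- Last digits of integral b-adic numbers

module LastDigits {s : ℕ} (B : Factorisation s) where
  open Factorisation B

  prime-power-coprime : ∀ (e : Fin s → ℕ) {i j} → i ≢ j → Coprime (p i ^ℕ e i) (p j ^ℕ e j)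
  prime-power-coprime e {i} {j} i≢j = coprime-^ˡ (e i) (coprime-^ʳ (e j)
    (distinct⇒coprime (prime i) (prime j) (i≢j ∘ distinct)))

  prime-power-product-split : ∀ (e : Fin s → ℕ) i → Split (p i) (Π λ j → p j ^ℕ e j)
  prime-power-product-split e i with Π-remove (λ j → p j ^ℕ e j) i
  ... | c , eq , cop = record { v = e i ; cofactor = c ; factorises = eq
    ; p∤cofactor = coprime⇒∤ (prime i) (cop λ j j≢i → coprime-^ʳ (e j)
        (distinct⇒coprime (prime i) (prime j) λ eq → j≢i (sym (distinct eq)))) }

  b-power-split : ∀ M i → Split (p i) (b ^ℕ M)
  b-power-split M i = power-split (prime i) (prime-power-product-split l i) M

  b^-∣ₚ : ∀ M i → l i *ℕ M ∣ₚ nat (b ^ℕ M)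
  b^-∣ₚ M i = ∣-nat-split (prime i) (b-power-split M i)

  b^-cancel : ∀ M i {t x} → l i *ℕ M +ℕ t ∣ₚ nat {p i} (b ^ℕ M) ⊗ x → t ∣ₚ x
  b^-cancel M i = ∣ₚ-cancel (prime i) (∤-nat-split (prime i) (b-power-split M i))

  b^-divide : ∀ M i {x} → l i *ℕ M ∣ₚ x → ∃[ y ] nat {p i} (b ^ℕ M) ⊗ y ≋ x
  b^-divide M i = divide-by-nat (prime i) (b-power-split M i)

  l≥1 : ∀ i → 1 ≤ l i
  l≥1 i = ℕ.>-nonZero⁻¹ (l i) {{positive i}}

  infix 4 _∣b_

  -- This encodes V ≤ ν_b(h): as V is an integer, the floors in the definition of ν_b disappear and
  -- the minimum becomes a conjunction.
  _∣b_ : ℕ → ℤ_b → Set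
  V ∣b h = ∀ i → l i *ℕ V ∣ₚ h i

  ∣b-≤ : ∀ {V W} {h : ℤ_b} → V ≤ W → W ∣b h → V ∣b h
  ∣b-≤ V≤W d i = ∣ₚ-≤ (ℕ.*-monoʳ-≤ (l i) V≤W) (d i)

  ∣b-resp-mod : ∀ {V} {h h′ : ℤ_b} → V ∣b (λ i → h i ⊖ h′ i) → V ∣b h → V ∣b h′
  ∣b-resp-mod d e i = mod-∣ (mod-sym (d i)) (e i)

  ∣b⇒≋0 : {h : ℤ_b} → (∀ V → V ∣b h) → ∀ i → h i ≋ ⌜ 0ℤ ⌝
  ∣b⇒≋0 h i = ∣ₚ⇒≋0 λ t → ∣ₚ-≤ (ℕ.m≤n*m t (l i) {{positive i}}) (h t i)

  residues-determine : ∀ {d y y′} → y < b ^ℕ d → y′ < b ^ℕ d →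
                       (∀ i → l i *ℕ d ∣ₚ nat {p i} y ⊖ nat y′) → y ≡ y′
  residues-determine {d} {y} {y′} y< y′< h = ℤ.+-injective (ℤ.i-j≡0⇒i≡j (+ y) (+ y′) (ℤ.∣i∣≡0⇒i≡0 (small-multiple small
    (subst (ℕ∣._∣ ℤ.∣ + y ℤ.- + y′ ∣) (sym b^d≡)
      (Π-∣ _ (prime-power-coprime (λ i → l i *ℕ d)) divides-distance)))))
    where
    b^d≡ : b ^ℕ d ≡ Π (λ i → p i ^ℕ (l i *ℕ d))
    b^d≡ = trans (Π-^ bᵢ d) (Π-cong λ i → ℕ.^-*-assoc (p i) (l i) d)
    small : ℤ.∣ + y ℤ.- + y′ ∣ < b ^ℕ d
    small = ℕ.≤-<-trans (ℕ.≤-trans (ℕ.≤-reflexive (cong ℤ.∣_∣ (ℤ.m-n≡m⊖n y y′))) (ℤ.∣m⊝n∣≤m⊔n y y′))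
      (ℕ.⊔-pres-<m y< y′<)
    divides-distance : ∀ i → p i ^ℕ (l i *ℕ d) ℕ∣.∣ ℤ.∣ + y ℤ.- + y′ ∣
    divides-distance i = ∣⇒∣ᵤ (∣ₚ-⌜⌝⁻¹ (∣ₚ-cong
        (≋-sym (≋-trans (⌜⌝-+ (+ y) (ℤ.- + y′)) (⊕-cong ≋-refl (⌜⌝-neg (+ y′))))) (h i)))

  -- y = ℓ_{b,d}(h), for h in ℤ_b; V is ν_b(h).
  data LastDigits (d : ℕ) (h : ℤ_b) (y : ℕ) : Set where
    zero-case    : (∀ i → h i ≋ ⌜ 0ℤ ⌝) → y ≡ 0 → LastDigits d h y
    nonzero-case : ∀ V → V ∣b h → ¬ suc V ∣b h → y < b ^ℕ d →
                   (∀ i → l i *ℕ (V +ℕ d) ∣ₚ h i ⊖ nat (b ^ℕ V) ⊗ nat y) → LastDigits d h y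

  lastDigits-bound : ∀ {d h y} → LastDigits d h y → y < b ^ℕ d
  lastDigits-bound {d} (zero-case _ refl) = ℕ.>-nonZero⁻¹ (b ^ℕ d) {{b^≢0 d}}
  lastDigits-bound (nonzero-case _ _ _ y< _) = y<

  -- Agreement to d digits counted from the leading b-adic digit of h. Quantifying over every V ≤
  -- ν_b(h) also covers h = 0, where it forces h′ = 0.
  Close : ℕ → ℤ_b → ℤ_b → Set
  Close d h h′ = ∀ V → V ∣b h → V +ℕ d ∣b (λ i → h i ⊖ h′ i)

  maximal-unique : ∀ {V V′} {h : ℤ_b} → V ∣b h → ¬ suc V ∣b h → V′ ∣b h → ¬ suc V′ ∣b h → V ≡ V′
  maximal-unique {V} {V′} d ∤ d′ ∤′ = ℕ.≤-antisym
    (ℕ.≮⇒≥ λ V′<V → ∤′ (∣b-≤ V′<V d)) (ℕ.≮⇒≥ λ V<V′ → ∤ (∣b-≤ V<V′ d′))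

  -- As d ≥ 1, closeness makes ν_b(h) and ν_b(h′) equal to a common V, and the congruence between h
  -- and h′ can be divided by b^V. With h = h′ it shows that the digits are determined by h.
  lastDigits-unique : ∀ {d h h′ y y′} → 1 ≤ d → Close d h h′ → LastDigits d h y → LastDigits d h′ y′ → y ≡ y′
  lastDigits-unique d≥1 close (zero-case _ refl) (zero-case _ refl) = refl
  lastDigits-unique {d} d≥1 close (zero-case h≋0 _) (nonzero-case V′ _ ∤h′ _ _) =
    contradiction (∣b-resp-mod (∣b-≤ (ℕ.m≤m+n (suc V′) d) (close (suc V′) sV∣h)) sV∣h) ∤h′
    where sV∣h = λ i → ≋0⇒∣ₚ (h≋0 i) _
  lastDigits-unique {d} {h} {h′} d≥1 close (nonzero-case V V∣h ∤h _ _) (zero-case h′≋0 _) =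
    contradiction (∣b-≤ (ℕ.≤-trans (ℕ.≤-reflexive (ℕ.+-comm 1 V)) (ℕ.+-monoʳ-≤ V d≥1))
      (λ i → mod-∣ (close V V∣h i) (≋0⇒∣ₚ (h′≋0 i) _))) ∤h
  lastDigits-unique {d} {h} {h′} {y} {y′} d≥1 close (nonzero-case V V∣h ∤h y< hy) (nonzero-case V′ V′∣h′ ∤h′ y′< hy′)
    with maximal-unique (∣b-resp-mod (∣b-≤ (ℕ.m≤m+n V d) (close V V∣h)) V∣h)
           (λ e → ∤h (λ i → mod-∣ (∣b-≤ {h = λ i → h i ⊖ h′ i} sV≤ (close V V∣h) i) (e i))) V′∣h′ ∤h′
    where
    sV≤ : suc V ≤ V +ℕ d
    sV≤ = ℕ.≤-trans (ℕ.≤-reflexive (ℕ.+-comm 1 V)) (ℕ.+-monoʳ-≤ V d≥1)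
  ... | refl = residues-determine y< y′< λ i → b^-cancel V i (∣ₚ-exponent
    (ℕ.*-distribˡ-+ (l i) V d)
    (∣ₚ-cong (solve 5 (λ h h′ B y y′ → (h :- h′) :- (h :- B :* y) :+ (h′ :- B :* y′) := B :* (y :- y′)) ≋-refl
        (h i) (h′ i) (nat (b ^ℕ V)) (nat y) (nat y′))
      (∣ₚ-⊕ (∣ₚ-⊖ (close V V∣h i) (hy i)) (hy′ i))))

  -- Scaling by b^M shifts ν_b by M and cancels against the normalising power of b. Decimation at a
  -- root produces such a factor in all components at once.
  lastDigits-b^-cancel : ∀ {d h y} M → LastDigits d (λ i → nat (b ^ℕ M) ⊗ h i) y → LastDigits d h y
  lastDigits-b^-cancel M (zero-case h≋0 y≡0) =
    zero-case (λ i → ⊗≋0 (prime i) (proj₂ (nat-≢0 (prime i) (b ^ℕ M) {{b^≢0 M}})) (h≋0 i)) y≡0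
  lastDigits-b^-cancel {d} {h} {y} M (nonzero-case V V∣ ∤ y< hy) = nonzero-case V′
    (λ i → b^-cancel M i (∣ₚ-exponent (trans (cong (l i *ℕ_) (sym V≡)) (ℕ.*-distribˡ-+ (l i) M V′)) (V∣ i)))
    (λ e → ∤ λ i → ∣ₚ-exponent (trans (sym (ℕ.*-distribˡ-+ (l i) M (suc V′)))
        (cong (l i *ℕ_) (trans (ℕ.+-suc M V′) (cong suc V≡)))) (∣ₚ-⊗ (b^-∣ₚ M i) (e i)))
    y<
    (λ i → b^-cancel M i (∣ₚ-exponent (trans (cong (λ u → l i *ℕ (u +ℕ d)) (sym V≡))
        (trans (cong (l i *ℕ_) (ℕ.+-assoc M V′ d)) (ℕ.*-distribˡ-+ (l i) M (V′ +ℕ d))))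
      (∣ₚ-cong (≋-trans (⊕-cong ≋-refl (⊝-cong (⊗-cong (split-power i) ≋-refl)))
          (solve 4 (λ h B C y → B :* h :- (B :* C) :* y := B :* (h :- C :* y)) ≋-refl
            (h i) (nat (b ^ℕ M)) (nat (b ^ℕ V′)) (nat y)))
        (hy i))))
    where
    V′ : ℕ
    V′ = V ℕ.∸ M
    V≡ : M +ℕ V′ ≡ V
    -- V ≥ M because b^M divides the element, while V is the largest exponent that does.
    V≡ = ℕ.m+[n∸m]≡n (ℕ.≮⇒≥ λ V<M → ∤ (∣b-≤ {h = λ i → nat (b ^ℕ M) ⊗ h i} V<M λ i → ∣ₚ-⊗ʳ (h i) (b^-∣ₚ M i)))
    split-power : ∀ i → nat {p i} (b ^ℕ V) ≋ nat (b ^ℕ M) ⊗ nat (b ^ℕ V′)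
    split-power i = ≋-trans (≡⇒≋ (cong nat (trans (cong (b ^ℕ_) (sym V≡)) (ℕ.^-distribˡ-+-* b M V′)))) (nat-* (b ^ℕ M) (b ^ℕ V′))

-- From ℚₚ to ℤₚ

-- x = h / p ^ e
record Represents {p : ℕ} (x : ℚₚ p) (h : ℤₚ p) (e : ℕ) : Set where
  constructor represents
  field
    cross : num x ⊗ nat (p ^ℕ e) ≋ h ⊗ nat (p ^ℕ expo x)

open Represents

module _ {p : ℕ} where

  opaque
    unfolding _≋_

    ≈⇒≋ : (x y : ℚₚ p) → x ≈ y → num x ⊗ nat (p ^ℕ expo y) ≋ num y ⊗ nat (p ^ℕ expo x)
    ≈⇒≋ x y h n = h n

    ≋⇒≈ : (x y : ℚₚ p) → num x ⊗ nat (p ^ℕ expo y) ≋ num y ⊗ nat (p ^ℕ expo x) → x ≈ y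
    ≋⇒≈ x y h n = h n

    num-+ : (x y : ℚₚ p) → num (x + y) ≋ num x ⊗ nat (p ^ℕ expo y) ⊕ num y ⊗ nat (p ^ℕ expo x)
    num-+ x y = ≋-pointwise (num (x + y)) (num x ⊗ nat (p ^ℕ expo y) ⊕ num y ⊗ nat (p ^ℕ expo x)) λ n → refl

    num-* : (x y : ℚₚ p) → num (x * y) ≋ num x ⊗ num y
    num-* x y = ≋-pointwise (num (x * y)) (num x ⊗ num y) λ n → refl

    num-neg : (x : ℚₚ p) → num (- x) ≋ ⊝ num x
    num-neg x = ≋-pointwise (num (- x)) (⊝ num x) λ n → refl

    fromℤ≋⌜⌝ : ∀ z → fromℤ {p} z ≋ ⌜ z ⌝
    fromℤ≋⌜⌝ z = ≋-pointwise (fromℤ z) ⌜ z ⌝ λ n → refl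

    ∣⇒∣ₚ : ∀ {t} {x : ℤₚ p} → p^ t ∣ x → t ∣ₚ x
    ∣⇒∣ₚ d = d

    ∣ₚ⇒∣ : ∀ {t} {x : ℤₚ p} → t ∣ₚ x → p^ t ∣ x
    ∣ₚ⇒∣ d = d

  p^-+ : ∀ a c → nat {p} (p ^ℕ (a +ℕ c)) ≋ nat (p ^ℕ a) ⊗ nat (p ^ℕ c)
  p^-+ a c = ≋-trans (≡⇒≋ (cong nat (ℕ.^-distribˡ-+-* p a c))) (nat-* (p ^ℕ a) (p ^ℕ c))

  represents-+ : ∀ {x y : ℚₚ p} {h g e} → Represents x h e → Represents y g e → Represents (x + y) (h ⊕ g) e
  represents-+ {x} {y} {h} {g} {e} (represents hx) (represents hy) = represents (≋-trans (⊗-cong (num-+ x y) ≋-refl)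
    (≋-trans (solve 5 (λ nx ny Px Py Pe → (nx :* Py :+ ny :* Px) :* Pe := (nx :* Pe) :* Py :+ (ny :* Pe) :* Px) ≋-refl
      (num x) (num y) (nat (p ^ℕ expo x)) (nat (p ^ℕ expo y)) (nat (p ^ℕ e)))
    (≋-trans (⊕-cong (⊗-cong hx ≋-refl) (⊗-cong hy ≋-refl))
    (≋-trans (solve 4 (λ h g Px Py → (h :* Px) :* Py :+ (g :* Py) :* Px := (h :+ g) :* (Px :* Py)) ≋-refl
      h g (nat (p ^ℕ expo x)) (nat (p ^ℕ expo y)))
    (⊗-cong ≋-refl (≋-sym (p^-+ (expo x) (expo y))))))))

  represents-* : ∀ {x y : ℚₚ p} {h g e e′} → Represents x h e → Represents y g e′ →
                 Represents (x * y) (h ⊗ g) (e +ℕ e′)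
  represents-* {x} {y} {h} {g} {e} {e′} (represents hx) (represents hy) = represents
    (≋-trans (⊗-cong (num-* x y) (p^-+ e e′))
    (≋-trans (solve 4 (λ a b c d → (a :* b) :* (c :* d) := (a :* c) :* (b :* d)) ≋-refl
      (num x) (num y) (nat (p ^ℕ e)) (nat (p ^ℕ e′)))
    (≋-trans (⊗-cong hx hy)
    (≋-trans (solve 4 (λ a b c d → (a :* b) :* (c :* d) := (a :* c) :* (b :* d)) ≋-refl
      h (nat (p ^ℕ expo x)) g (nat (p ^ℕ expo y)))
    (⊗-cong ≋-refl (≋-sym (p^-+ (expo x) (expo y))))))))

  represents-neg : ∀ {x : ℚₚ p} {h e} → Represents x h e → Represents (- x) (⊝ h) e
  represents-neg {x} {h} {e} (represents hx) = represents (≋-trans (⊗-cong (num-neg x) ≋-refl)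
    (≋-trans (solve 2 (λ a b → (:- a) :* b := :- (a :* b)) ≋-refl (num x) (nat (p ^ℕ e)))
    (≋-trans (⊝-cong hx) (solve 2 (λ a b → :- (a :* b) := (:- a) :* b) ≋-refl h (nat (p ^ℕ expo x))))))

  represents-approx : ∀ {x y : ℚₚ p} {h e} → Represents x h e → (∀ n → approx (num y) n ≡ approx (num x) n) →
                      expo y ≡ expo x → Represents y h e
  represents-approx {x} {y} (represents hx) eq eq′ = represents (≋-trans (⊗-cong (≋-pointwise (num y) (num x) eq) ≋-refl)
    (≋-trans hx (⊗-cong ≋-refl (≡⇒≋ (cong (λ t → nat (p ^ℕ t)) (sym eq′))))))

  represents-- : ∀ {x y : ℚₚ p} {h g e} → Represents x h e → Represents y g e → Represents (x - y) (h ⊖ g) e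
  represents-- hx hy = represents-approx (represents-+ hx (represents-neg hy)) (λ n → refl) refl

  represents-/p^ : ∀ h e → Represents {p} (h /p^ e) h e
  represents-/p^ h e = represents ≋-refl

  represents-ι : ∀ x → Represents {p} (ι x) x 0
  represents-ι x = represents ≋-refl

  represents-0 : ∀ e → Represents {p} 0# ⌜ 0ℤ ⌝ e
  represents-0 e = represents (≋-trans (⊗-cong (fromℤ≋⌜⌝ 0ℤ) ≋-refl)
    (solve 2 (λ a b → con 0ℤ :* a := con 0ℤ :* b) ≋-refl (nat (p ^ℕ e)) (nat 1)))

  represents-cong : ∀ {x : ℚₚ p} {h g e} → h ≋ g → Represents x h e → Represents x g e
  represents-cong eq (represents hx) = represents (≋-trans hx (⊗-cong eq ≋-refl))

  represents-denominator : ∀ {x : ℚₚ p} {h e e′} → e ≡ e′ → Represents x h e → Represents x h e′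
  represents-denominator refl hx = hx

  represents-scale : ∀ {x : ℚₚ p} {h e} k → Represents x h e → Represents x (nat (p ^ℕ k) ⊗ h) (k +ℕ e)
  represents-scale {x} {h} {e} k (represents hx) = represents (≋-trans (⊗-cong ≋-refl (p^-+ k e))
    (≋-trans (solve 3 (λ a b c → a :* (b :* c) := b :* (a :* c)) ≋-refl (num x) (nat (p ^ℕ k)) (nat (p ^ℕ e)))
    (≋-trans (⊗-cong ≋-refl hx) (≋-sym (Ring.*-assoc (nat (p ^ℕ k)) h (nat (p ^ℕ expo x)))))))

  represents-1 : Represents {p} 1# ⌜ 1ℤ ⌝ 0
  represents-1 = represents (⊗-cong (fromℤ≋⌜⌝ 1ℤ) ≋-refl)

  represents-^ : ∀ {x : ℚₚ p} {h} m → Represents x h 0 → Represents (x ^ m) (h ^ᶻ m) 0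
  represents-^ zero    hx = represents-1
  represents-^ (suc m) hx = represents-approx (represents-* hx (represents-^ m hx)) (λ n → refl) refl

  sumᶻ : ∀ {N} → (Fin N → ℤₚ p) → ℤₚ p
  sumᶻ {zero}  u = ⌜ 0ℤ ⌝
  sumᶻ {suc N} u = u zero ⊕ sumᶻ (u ∘ suc)

  represents-sum : ∀ {N e} {u : Fin N → ℚₚ p} {U} → (∀ j → Represents (u j) (U j) e) → Represents (sum u) (sumᶻ U) e
  represents-sum {zero}  {e} h = represents-0 e
  represents-sum {suc N} h = represents-approx (represents-+ (h zero) (represents-sum (h ∘ suc))) (λ n → refl) refl

  sumᶻ-⊗ : ∀ {N} x (u v : Fin N → ℤₚ p) → (∀ j → u j ≋ x ⊗ v j) → sumᶻ u ≋ x ⊗ sumᶻ v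
  sumᶻ-⊗ {zero}  x u v h = ≋-sym (⊗0 x)
  sumᶻ-⊗ {suc N} x u v h = ≋-trans (⊕-cong (h zero) (sumᶻ-⊗ x (u ∘ suc) (v ∘ suc) (h ∘ suc)))
    (≋-sym (Ring.distribˡ x (v zero) (sumᶻ (v ∘ suc))))

  sumᶻ-horner : ∀ N (a : ℕ → ℤₚ p) x → sumᶻ {N} (λ j → a (toℕ j) ⊗ x ^ᶻ toℕ j) ≋ horner N a x
  sumᶻ-horner zero    a x = ≋-refl
  sumᶻ-horner (suc N) a x = ⊕-cong (Ring.*-identityʳ (a 0))
    (≋-trans (sumᶻ-⊗ {N} x (λ j → a (suc (toℕ j)) ⊗ (x ⊗ x ^ᶻ toℕ j)) (λ j → a (suc (toℕ j)) ⊗ x ^ᶻ toℕ j)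
        λ j → solve 3 (λ a x y → a :* (x :* y) := x :* (a :* y)) ≋-refl (a (suc (toℕ j))) x (x ^ᶻ toℕ j))
      (⊗-cong ≋-refl (sumᶻ-horner N (a ∘ suc) x)))

  represents-partialSum : ∀ (a : ℕ → ℚₚ p) (A : ℕ → ℤₚ p) N {e} x →
                          (∀ (j : Fin N) → Represents (a (toℕ j)) (A (toℕ j)) e) →
                          Represents (partialSum a (ι x) N) (horner N A x) e
  represents-partialSum a A N {e} x h = represents-approx (represents-cong (sumᶻ-horner N A x)
    (represents-sum {u = λ j → a (toℕ j) * ι x ^ toℕ j} λ j → term (toℕ j) (h j))) (λ n → refl) refl
    where
    term : ∀ j → Represents (a j) (A j) e → Represents (a j * ι x ^ j) (A j ⊗ x ^ᶻ j) e
    term j hj = represents-approx (represents-denominator (ℕ.+-identityʳ e)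
      (represents-* hj (represents-^ j (represents-ι x)))) (λ n → refl) refl

  horner-last : ∀ N (A : ℕ → ℤₚ p) x → horner (suc N) A x ≋ horner N A x ⊕ A N ⊗ x ^ᶻ N
  horner-last zero    A x = solve 2 (λ a x → a :+ x :* con 0ℤ := con 0ℤ :+ a :* con 1ℤ) ≋-refl (A 0) x
  horner-last (suc N) A x = ≋-trans (⊕-cong ≋-refl (⊗-cong ≋-refl (horner-last N (A ∘ suc) x)))
    (solve 5 (λ a x h b y → a :+ x :* (h :+ b :* y) := (a :+ x :* h) :+ b :* (x :* y)) ≋-refl
      (A 0) x (horner N (A ∘ suc) x) (A (suc N)) (x ^ᶻ N))

module _ {p : ℕ} (pr : Prime p) where

  private
    p^-cancelˡ : ∀ k {x y : ℤₚ p} → nat (p ^ℕ k) ⊗ x ≋ nat (p ^ℕ k) ⊗ y → x ≋ y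
    p^-cancelˡ k = ⊗-cancelˡ pr (nat-p^-∤ pr k)

  represents-unique : ∀ {x : ℚₚ p} {h g e} → Represents x h e → Represents x g e → h ≋ g
  represents-unique {x} {h} {g} (represents hx) (represents gx) = p^-cancelˡ (expo x)
    (≋-trans (Ring.*-comm (nat (p ^ℕ expo x)) h) (≋-trans (≋-trans (≋-sym hx) gx) (Ring.*-comm g (nat (p ^ℕ expo x)))))

  represents-≈ : ∀ {x y : ℚₚ p} {h e} → x ≈ y → Represents x h e → Represents y h e
  represents-≈ {x} {y} {h} {e} eq (represents hx) = represents (p^-cancelˡ (expo x)
    (≋-trans (solve 3 (λ a b c → c :* (a :* b) := (a :* c) :* b) ≋-refl (num y) (nat (p ^ℕ e)) (nat (p ^ℕ expo x)))
    (≋-trans (⊗-cong (≋-sym (≈⇒≋ x y eq)) ≋-refl)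
    (≋-trans (solve 3 (λ a b c → (a :* b) :* c := (a :* c) :* b) ≋-refl (num x) (nat (p ^ℕ expo y)) (nat (p ^ℕ e)))
    (≋-trans (⊗-cong hx ≋-refl)
      (solve 3 (λ a b c → (a :* b) :* c := b :* (a :* c)) ≋-refl h (nat (p ^ℕ expo x)) (nat (p ^ℕ expo y))))))))

  represented-≈ : ∀ {x y : ℚₚ p} {h e} → Represents x h e → Represents y h e → x ≈ y
  represented-≈ {x} {y} {h} {e} (represents hx) (represents hy) = ≋⇒≈ x y (p^-cancelˡ e
    (≋-trans (solve 3 (λ a b c → c :* (a :* b) := (a :* c) :* b) ≋-refl (num x) (nat (p ^ℕ expo y)) (nat (p ^ℕ e)))
    (≋-trans (⊗-cong hx ≋-refl)
    (≋-trans (solve 3 (λ a b c → (a :* b) :* c := (a :* c) :* b) ≋-refl h (nat (p ^ℕ expo x)) (nat (p ^ℕ expo y)))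
    (≋-trans (⊗-cong (≋-sym hy) ≋-refl)
      (solve 3 (λ a b c → (a :* b) :* c := b :* (a :* c)) ≋-refl (num y) (nat (p ^ℕ e)) (nat (p ^ℕ expo x))))))))

  root⇒≋0 : ∀ {x : ℚₚ p} {h e} → Represents x h e → x ≈ 0# → h ≋ ⌜ 0ℤ ⌝
  root⇒≋0 {x} {e = e} hx x≈0 = represents-unique {0#} (represents-≈ {x} {0#} x≈0 hx) (represents-0 e)

  ≋0⇒root : ∀ {x : ℚₚ p} {h e} → Represents x h e → h ≋ ⌜ 0ℤ ⌝ → x ≈ 0#
  ≋0⇒root {x} {e = e} hx h≋0 = represented-≈ {x} {0#} (represents-cong {x = x} h≋0 hx) (represents-0 e)

  -- Both divisibilities say ν(x) ≥ k, a condition that does not depend on the fraction chosen to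
  -- represent x.
  num-∣⇒ : ∀ k {x : ℚₚ p} {h e} → Represents x h e → k +ℕ expo x ∣ₚ num x → k +ℕ e ∣ₚ h
  num-∣⇒ k {x} {h} {e} (represents hx) d = p^-cancel pr (expo x)
    (∣ₚ-exponent (lem k e (expo x)) (∣ₚ-cong (≋-trans hx (Ring.*-comm h _)) (∣ₚ-⊗ d (nat-p^ e))))
    where
    lem : ∀ k e x → k +ℕ x +ℕ e ≡ x +ℕ (k +ℕ e)
    lem = ℕ-Solver.solve-∀

  ⇒num-∣ : ∀ k {x : ℚₚ p} {h e} → Represents x h e → k +ℕ e ∣ₚ h → k +ℕ expo x ∣ₚ num x
  ⇒num-∣ k {x} {h} {e} (represents hx) = num-∣⇒ k {h /p^ e} (represents (≋-sym hx))

-- Analytic functions as integral power series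

record IntegralSeries {p : ℕ} (f : ℤₚ p → ℚₚ p) : Set where
  field
    series      : Series p
    denominator : ℕ
    represented : ∀ x → Represents (f x) (eval series x) denominator

module _ {p : ℕ} (pr : Prime p) where

  private
    instance
      p≢0 : NonZero p
      p≢0 = prime⇒nonZero pr

  clear : ∀ {x : ℚₚ p} {E} → expo x ≤ E → Represents x (nat (p ^ℕ (E ℕ.∸ expo x)) ⊗ num x) E
  clear {x} {E} x≤E = represents-denominator (ℕ.m∸n+n≡m x≤E)
    (represents-scale (E ℕ.∸ expo x) (represents-/p^ (num x) (expo x)))

  convergence : ∀ (u : ℕ → ℚₚ p) y → u ⟶ y → ∀ k → ∃[ N₀ ] (∀ N → N₀ ≤ N → ∀ {h g e} →
                Represents (u N) h e → Represents y g e → k +ℕ e ∣ₚ h ⊖ g)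
  convergence u y conv k = proj₁ (conv k) , λ N le hu hy → num-∣⇒ pr k (represents-- hu hy) (∣⇒∣ₚ (proj₂ (conv k) N le))

  converges : ∀ (u : ℕ → ℚₚ p) y {e} (h : ℕ → ℤₚ p) {g} → (∀ N → Represents (u N) (h N) e) → Represents y g e →
              (∀ k → ∃[ N₀ ] (∀ N → N₀ ≤ N → k ∣ₚ h N ⊖ g)) → u ⟶ y
  converges u y {e} h hu hy conv k = proj₁ (conv (k +ℕ e)) , λ N le →
    ∣ₚ⇒∣ (⇒num-∣ pr k (represents-- (hu N) hy) (proj₂ (conv (k +ℕ e)) N le))

  -- Compare two consecutive partial sums at 1.
  coefficients-vanish : ∀ (a : ℕ → ℚₚ p) y → partialSum a (ι ⌜ 1ℤ ⌝) ⟶ y →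
                        ∀ k → ∃[ N ] (∀ n → N ≤ n → k +ℕ expo (a n) ∣ₚ num (a n))
  coefficients-vanish a y conv k = proj₁ (small k) , λ n le →
    let open Step n in ⇒num-∣ pr k {a n} (clear (E≥ (Fin.fromℕ n) (Fin.toℕ-fromℕ n)))
      (∣ₚ-cong (≋-trans (⊕-cong (≋-trans (⊕-cong (horner-last n A ⌜ 1ℤ ⌝) ≋-refl) ≋-refl) ≋-refl) (lem n (A n) (horner n A ⌜ 1ℤ ⌝) Y))
        (∣ₚ-⊖ (near (suc n) (ℕ.≤-trans le (ℕ.n≤1+n n)) λ j → clear (E≥ j refl))
              (near n le λ j → clear (E≥ (Fin.inject₁ j) (Fin.toℕ-inject₁ j)))))
    where
    small = convergence (partialSum a (ι ⌜ 1ℤ ⌝)) y conv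
    1^ : ∀ n → ⌜_⌝ {p} 1ℤ ^ᶻ n ≋ ⌜ 1ℤ ⌝
    1^ zero    = ≋-refl
    1^ (suc n) = ≋-trans (Ring.*-identityˡ _) (1^ n)
    lem : ∀ n c h Y → (h ⊕ c ⊗ ⌜ 1ℤ ⌝ ^ᶻ n) ⊖ Y ⊖ (h ⊖ Y) ≋ c
    lem n c h Y = ≋-trans (⊕-cong (⊕-cong (⊕-cong ≋-refl (⊗-cong ≋-refl (1^ n))) ≋-refl) ≋-refl)
      (solve 3 (λ c h Y → (h :+ c :* con 1ℤ) :- Y :- (h :- Y) := c) ≋-refl c h Y)
    module Step (n : ℕ) where
      bound = upper-bound {suc n} (λ j → expo (a (toℕ j)))
      -- No denominator common to all coefficients is known yet, so E is chosen for each n. The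
      -- conclusion ν(a n) ≥ k does not mention it.
      E : ℕ
      E = proj₁ bound ℕ.⊔ expo y
      A : ℕ → ℤₚ p
      A j = nat (p ^ℕ (E ℕ.∸ expo (a j))) ⊗ num (a j)
      Y : ℤₚ p
      Y = nat (p ^ℕ (E ℕ.∸ expo y)) ⊗ num y
      E≥ : (j : Fin (suc n)) → ∀ {i} → toℕ j ≡ i → expo (a i) ≤ E
      E≥ j refl = ℕ.≤-trans (proj₂ bound j) (ℕ.m≤m⊔n _ _)
      near : ∀ M → proj₁ (small k) ≤ M → (∀ (j : Fin M) → Represents (a (toℕ j)) (A (toℕ j)) E) →
             k +ℕ E ∣ₚ horner M A ⌜ 1ℤ ⌝ ⊖ Y
      near M le rep = proj₂ (small k) M le (represents-partialSum a A M ⌜ 1ℤ ⌝ rep) (clear (ℕ.m≤n⊔m (proj₁ bound) _))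

  -- Convergence at x = 1 makes the coefficients tend to 0. All but finitely many are therefore
  -- integral, and a single power p^e clears the denominators of the others.
  integral-series : ∀ {f : ℤₚ p → ℚₚ p} → Analytic f → IntegralSeries f
  integral-series {f} (a , conv) = record { series = A ; denominator = e ; represented = rep }
    where
    small : ∀ k → ∃[ N ] (∀ n → N ≤ n → k +ℕ expo (a n) ∣ₚ num (a n))
    small = coefficients-vanish a (f ⌜ 1ℤ ⌝) (conv ⌜ 1ℤ ⌝)
    bound = upper-bound {proj₁ (small 0)} (λ j → expo (a (toℕ j)))
    e : ℕ
    e = proj₁ bound
    integral : ∀ n → expo (a n) ∣ₚ nat (p ^ℕ e) ⊗ num (a n)
    integral n with n ℕ.<? proj₁ (small 0)
    ... | yes n< = ∣ₚ-⊗ʳ (num (a n)) (∣ₚ-≤ (subst (λ i → expo (a i) ≤ e) (Fin.toℕ-fromℕ< n<) (proj₂ bound (Fin.fromℕ< n<))) (nat-p^ e))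
    ... | no  n≮ = ∣ₚ-⊗ˡ (nat (p ^ℕ e)) (proj₂ (small 0) n (ℕ.≮⇒≥ n≮))
    coefficient-rep : ∀ n → Represents (a n) (proj₁ (∣ₚ-divide (integral n))) e
    coefficient-rep n = represents (≋-trans (Ring.*-comm (num (a n)) (nat (p ^ℕ e)))
      (≋-trans (≋-sym (proj₂ (∣ₚ-divide (integral n)))) (Ring.*-comm (nat (p ^ℕ expo (a n))) _)))
    A : Series p
    A = record
      { coefficient = λ n → proj₁ (∣ₚ-divide (integral n))
      ; vanishing   = λ k → proj₁ (small k) , λ n le →
          ∣ₚ-≤ (ℕ.m≤m+n k e) (num-∣⇒ pr k {a n} (coefficient-rep n) (proj₂ (small k) n le)) }
    rep : ∀ x → Represents (f x) (eval A x) e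
    rep x = represents (∣ₚ⇒≋ λ k → mod-sym (close k))
      where
      Pe Pf : ℤₚ p
      Pe = nat (p ^ℕ e)
      Pf = nat (p ^ℕ expo (f x))
      limit : ∀ k → ∃[ N₀ ] (∀ N → N₀ ≤ N → ∀ {h g e} →
              Represents (partialSum a (ι x) N) h e → Represents (f x) g e → k +ℕ e ∣ₚ h ⊖ g)
      limit = convergence (partialSum a (ι x)) (f x) (conv x)
      close : ∀ k → k ∣ₚ eval A x ⊗ Pf ⊖ num (f x) ⊗ Pe
      close k = mod-trans (mod-⊗ (eval-mod A M x λ n le → proj₂ (vanishing A k) n (ℕ.≤-trans (ℕ.m≤n⊔m (proj₁ (limit k)) _) le)) mod-refl)
        (∣ₚ-cong (lem (horner M (coefficient A) x) (num (f x)) Pf Pe)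
          (∣ₚ-≤ (ℕ.m≤m+n k (expo (f x) +ℕ e)) (proj₂ (limit k) M (ℕ.m≤m⊔n _ _)
            (represents-scale (expo (f x)) (represents-partialSum a (coefficient A) M x λ j → coefficient-rep (toℕ j)))
            (represents-denominator (ℕ.+-comm e (expo (f x)))
              (represents-scale e (represents-/p^ (num (f x)) (expo (f x))))))))
        where
        M : ℕ
        M = proj₁ (limit k) ℕ.⊔ proj₁ (vanishing A k)
        lem : ∀ h y Pf Pe → Pf ⊗ h ⊖ Pe ⊗ y ≋ h ⊗ Pf ⊖ y ⊗ Pe
        lem = solve 4 (λ h y Pf Pe → Pf :* h :- Pe :* y := h :* Pf :- y :* Pe) ≋-refl

  analytic-series : (A : Series p) → ∀ e → Analytic (λ x → eval A x /p^ e)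
  analytic-series A e = (λ n → coefficient A n /p^ e) , λ x →
    converges (partialSum (λ n → coefficient A n /p^ e) (ι x)) (eval A x /p^ e) (λ N → horner N (coefficient A) x)
      (λ N → represents-partialSum (λ n → coefficient A n /p^ e) (coefficient A) N x λ j → represents-/p^ (coefficient A (toℕ j)) e)
      (represents-/p^ (eval A x) e)
      λ k → proj₁ (vanishing A k) , λ N le → mod-sym (eval-mod A N x λ n N≤n → proj₂ (vanishing A k) n (ℕ.≤-trans le N≤n))

  private
    factor⇒ : ∀ (w y z : ℚₚ p) {g h k e e′} → y ≈ w * z → Represents w g 0 → Represents y h e → Represents z k e′ →
              nat (p ^ℕ e′) ⊗ h ≋ nat (p ^ℕ e) ⊗ (g ⊗ k)
    factor⇒ w y z {e = e} {e′} eq hw hy hz = represents-unique pr {w * z} (represents-scale e′ (represents-≈ pr {y} {w * z} eq hy))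
        (represents-denominator (ℕ.+-comm e e′) (represents-scale e (represents-* hw hz)))

    ⇒factor : ∀ (w y z : ℚₚ p) {g k e} → Represents w g 0 → Represents y (g ⊗ k) e → Represents z k e → y ≈ w * z
    ⇒factor w y z hw hy hz = represented-≈ pr {y} {w * z} hy (represents-* hw hz)

    represents-linear-power : ∀ (θ x : ℤₚ p) m → Represents ((ι x - ι θ) ^ m) ((x ⊖ θ) ^ᶻ m) 0
    represents-linear-power θ x m = represents-approx (represents-^ m (represents-- (represents-ι x) (represents-ι θ))) (λ n → refl) refl

  power-factor⇒ : ∀ (θ x : ℤₚ p) (y z : ℚₚ p) {h k e e′} m → y ≈ (ι x - ι θ) ^ m * z → Represents y h e → Represents z k e′ →
                  nat (p ^ℕ e′) ⊗ h ≋ nat (p ^ℕ e) ⊗ ((x ⊖ θ) ^ᶻ m ⊗ k)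
  power-factor⇒ θ x y z m eq hy hz = factor⇒ ((ι x - ι θ) ^ m) y z eq (represents-linear-power θ x m) hy hz

  ⇒power-factor : ∀ (θ x : ℤₚ p) (y z : ℚₚ p) {k e} m → Represents y ((x ⊖ θ) ^ᶻ m ⊗ k) e → Represents z k e →
                  y ≈ (ι x - ι θ) ^ m * z
  ⇒power-factor θ x y z m hy hz = ⇒factor ((ι x - ι θ) ^ m) y z (represents-linear-power θ x m) hy hz

-- The last digits of a b-adic number

module _ {p : ℕ} where

  opaque
    unfolding _≋_

    unitInverse-spec : ∀ {c} (cop : Coprime c p) → nat {p} c ⊗ unitInverse cop ≋ ⌜ 1ℤ ⌝
    unitInverse-spec cop n = proj₂ (inverse-mod (coprime-^ʳ n cop))

    -ᶻ≋⊖ : (y : ℕ) (w : ℤₚ p) → fromℕ y -ᶻ w ≋ nat y ⊖ w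
    -ᶻ≋⊖ y w = ≋-pointwise (fromℕ y -ᶻ w) (nat y ⊖ w) λ n → refl

    integerPart-spec : (pr : Prime p) (q : ℚₚ p) → expo q ∣ₚ num q → nat (p ^ℕ expo q) ⊗ integerPart pr q ≋ num q
    integerPart-spec pr (x /p^ e) d n = ∣-resp (cong (ℤ._- approx x n) (sym (trans (ℤ.*-comm (+ P) (approx x (n +ℕ e) ℤ./ℕ P)) (exact (n +ℕ e) (ℕ.m≤n+m e n)))))
      (subst (λ u → + (p ^ℕ n) ∣ approx x u ℤ.- approx x n) (ℕ.+-comm e n) (approx-mod x n e))
      where
      P : ℕ
      P = p ^ℕ e
      instance
        P≢0 : NonZero P
        P≢0 = ℕ.m^n≢0 p e {{prime⇒nonZero pr}}
      exact′ : ∀ a → + P ∣ a → (a ℤ./ℕ P) ℤ.* + P ≡ a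
      exact′ a (divides q refl) = cong (ℤ._* + P) (trans
        (sym (trans (cong (λ u → (a ℤ./ℕ P) ℤ.- u) (cong +_ (ℕ.0/n≡0 P))) (ℤ.+-identityʳ (a ℤ./ℕ P))))
        (/ℕ-shift a 0ℤ q P (ℤ.+-identityʳ a)))
      exact : ∀ m → e ≤ m → (approx x m ℤ./ℕ P) ℤ.* + P ≡ approx x m
      exact m e≤m = exact′ (approx x m) (∣-resp (lem (approx x m) (approx x e))
        (∣m∣n⇒∣m+n (subst (λ u → + P ∣ approx x u ℤ.- approx x e) (ℕ.m∸n+n≡m e≤m) (approx-mod x e (m ℕ.∸ e))) d))
        where
        lem : ∀ a b → (a ℤ.- b) ℤ.+ b ≡ a
        lem = solve-∀

cofactor-inverse : ∀ {p m} (pr : Prime p) (sp : Split p m) (u : ℤₚ p) →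
                   (∀ n → approx u n ≡ approx (unitInverse (∤⇒coprime pr (Split.p∤cofactor sp))) n) →
                   u ⊗ nat m ≋ nat (p ^ℕ Split.v sp)
cofactor-inverse {p} pr sp u u≡ = ≋-trans (⊗-cong (≋-pointwise u (unitInverse cop) u≡)
    (≋-trans (≡⇒≋ (cong nat factorises)) (nat-* (p ^ℕ v) cofactor)))
  (≋-trans (solve 3 (λ u q c → u :* (q :* c) := (c :* u) :* q) ≋-refl (unitInverse cop) (nat (p ^ℕ v)) (nat cofactor))
    (≋-trans (⊗-cong (unitInverse-spec cop) ≋-refl) (Ring.*-identityˡ (nat (p ^ℕ v)))))
  where
  open Split sp
  cop : Coprime cofactor p
  cop = ∤⇒coprime pr p∤cofactor

recip-spec : ∀ {p} (pr : Prime p) m .{{_ : NonZero m}} → num (recip pr m) ⊗ nat m ≋ nat (p ^ℕ expo (recip pr m))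
recip-spec pr m {{m≢0}} = cofactor-inverse pr (split pr m {{m≢0}}) _ λ n → refl

∸-shift : ∀ {m e μ n} → m +ℕ n ≡ μ +ℕ e → + m ℤ.- + e ≡ + μ ℤ.- + n
∸-shift {m} {e} {μ} {n} eq = lem (+ m) (+ e) (+ μ) (+ n) (trans (sym (ℤ.pos-+ m n)) (trans (cong +_ eq) (ℤ.pos-+ μ e)))
  where
  lem : ∀ m e μ n → m ℤ.+ n ≡ μ ℤ.+ e → m ℤ.- e ≡ μ ℤ.- n
  lem m e μ n eq = trans (lem₁ m e n) (trans (cong (λ u → u ℤ.- e ℤ.- n) eq) (lem₂ μ e n))
    where
    lem₁ : ∀ m e n → m ℤ.- e ≡ m ℤ.+ n ℤ.- e ℤ.- n
    lem₁ = solve-∀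
    lem₂ : ∀ μ e n → μ ℤ.+ e ℤ.- e ℤ.- n ≡ μ ℤ.- n
    lem₂ = solve-∀

<-suc-/* : ∀ m n .{{_ : NonZero n}} → m < suc (m ℕ./ n) *ℕ n
<-suc-/* m n = ℕ.≤-<-trans (ℕ.≤-reflexive (ℕ.m≡m%n+[m/n]*n m n)) (ℕ.+-monoˡ-< ((m ℕ./ n) *ℕ n) (ℕ.m%n<n m n))

/ℕ-minus : ∀ μ E l .{{_ : NonZero l}} → (+ μ ℤ.- + (l *ℕ E)) ℤ./ℕ l ≡ + (μ ℕ./ l) ℤ.- + E
/ℕ-minus μ E l = trans (lem₁ ((+ μ ℤ.- + (l *ℕ E)) ℤ./ℕ l) (+ (μ ℕ./ l)))
  (cong (λ u → + (μ ℕ./ l) ℤ.+ u) (/ℕ-shift (+ μ ℤ.- + (l *ℕ E)) (+ μ) (ℤ.- + E) l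
    (trans (cong (λ u → + μ ℤ.- u ℤ.- + μ) (ℤ.pos-* l E)) (lem₂ (+ μ) (+ l) (+ E)))))
  where
  lem₁ : ∀ a b → a ≡ b ℤ.+ (a ℤ.- b)
  lem₁ = solve-∀
  lem₂ : ∀ μ l E → μ ℤ.- l ℤ.* E ℤ.- μ ≡ (ℤ.- E) ℤ.* l
  lem₂ = solve-∀

-- For an antitone predicate P on ℕ, the two cases are max { V ∣ P V } = ∞
-- and max { V ∣ P V } = κ.
data Order (E : ℕ) (P : ℕ → Set) (v : ℤ ⁺) : Set where
  no-maximum : (∀ V → P V) → v ≡ ⊤⁺ → Order E P v
  maximum   : ∀ κ → P κ → ¬ P (suc κ) → v ≡ [ + κ ℤ.- + E ] → Order E P v

module _ {E : ℕ} {P Q : ℕ → Set} (P-antitone : ∀ {m n} → m ≤ n → P n → P m) (Q-antitone : ∀ {m n} → m ≤ n → Q n → Q m) where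

  order-⊓ : ∀ {v w} → Order E P v → Order E Q w → Order E (λ V → P V × Q V) (v ⊓ w)
  order-⊓ (no-maximum hP refl) (no-maximum hQ refl) = no-maximum (λ V → hP V , hQ V) refl
  order-⊓ (no-maximum hP refl) (maximum κ hκ ∤ refl) = maximum κ (hP κ , hκ) (∤ ∘ proj₂) refl
  order-⊓ (maximum κ hκ ∤ refl) (no-maximum hQ refl) = maximum κ (hκ , hQ κ) (∤ ∘ proj₁) refl
  order-⊓ (maximum κ hκ ∤ refl) (maximum κ′ hκ′ ∤′ refl) with ℕ.≤-total κ κ′
  ... | inj₁ κ≤κ′ = maximum κ (hκ , Q-antitone κ≤κ′ hκ′) (∤ ∘ proj₁)
    (cong [_] (ℤ.i≤j⇒i⊓j≡i (ℤ.+-monoˡ-≤ (ℤ.- + E) (ℤ.+≤+ κ≤κ′))))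
  ... | inj₂ κ′≤κ = maximum κ′ (P-antitone κ′≤κ hκ , hκ′) (∤′ ∘ proj₂)
    (cong [_] (ℤ.i≥j⇒i⊓j≡j (ℤ.+-monoˡ-≤ (ℤ.- + E) (ℤ.+≤+ κ′≤κ))))

order-resp : ∀ {E P Q v} → (∀ V → P V → Q V) → (∀ V → Q V → P V) → Order E P v → Order E Q v
order-resp P⇒Q Q⇒P (no-maximum h eq)     = no-maximum (λ V → P⇒Q V (h V)) eq
order-resp P⇒Q Q⇒P (maximum κ hκ ∤ eq) = maximum κ (P⇒Q κ hκ) (∤ ∘ Q⇒P (suc κ)) eq

-- The maximum of an intersection of down-closed sets is the minimum of their maxima; this matches
-- the minimum over i in `ν-b` with the conjunction in `_∣b_`.
order-minimum : ∀ {n E} (P : Fin n → ℕ → Set) → (∀ i {k m} → k ≤ m → P i m → P i k) → (v : Fin n → ℤ ⁺) →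
                (∀ i → Order E (P i) (v i)) → Order E (λ V → ∀ i → P i V) (foldr _⊓_ ⊤⁺ v)
order-minimum {zero}  P anti v h = no-maximum (λ V ()) refl
order-minimum {suc n} P anti v h = order-resp
  (λ V (h₀ , h₁) → λ { zero → h₀ ; (suc i) → h₁ i }) (λ V h → h zero , h ∘ suc)
  (order-⊓ (anti zero) (λ k≤m h i → anti (suc i) k≤m (h i)) (h zero) (order-minimum (P ∘ suc) (anti ∘ suc) (v ∘ suc) (h ∘ suc)))

module Bridge (em : ExcludedMiddle 0ℓ) {s : ℕ} (B : Factorisation s) where
  open Factorisation B
  open LastDigits B
  open Classical em

  private
    instance
      l≢0 : ∀ {i} → NonZero (l i)
      l≢0 {i} = positive i

  module _ (E : ℕ) (i : Fin s) where

    private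
      bE : ℤₚ (p i)
      bE = nat (b ^ℕ E)

    -- As h = b^E q, one has ν(h) = ν(q) + lᵢ E, and a multiple of lᵢ passes through the floor: it
    -- becomes the shift by E that `Order` records.
    ν-order : ∀ (q : ℚₚ (p i)) (h : ℤₚ (p i)) → num q ⊗ bE ≋ h ⊗ nat (p i ^ℕ expo q) →
              Order E (λ V → l i *ℕ V ∣ₚ h) ⌊ ν em q / l i ⌋
    ν-order (x /p^ e) h scaled with em {∃[ m ] (p^ m ∣ x × ¬ p^ (suc m) ∣ x)}
    ... | no none = no-maximum (λ V → ≋0⇒∣ₚ h≋0 _) refl
      where
      x≋0 : x ≋ ⌜ 0ℤ ⌝
      x≋0 = ¬¬-elim λ x≉0 → let m , d , ∤ = exact-valuation x≉0 in none (m , ∣ₚ⇒∣ d , ∤ ∘ ∣⇒∣ₚ)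
      h≋0 : h ≋ ⌜ 0ℤ ⌝
      h≋0 = ⊗≋0 (prime i) (nat-p^-∤ (prime i) e) (≋-trans (Ring.*-comm (nat (p i ^ℕ e)) h)
        (≋-trans (≋-sym scaled) (≋-trans (⊗-cong x≋0 ≋-refl) (Ring.zeroˡ bE))))
    ... | yes (m , d , ∤) = maximum (μ ℕ./ l i)
        (∣ₚ-≤ (ℕ.≤-trans (ℕ.≤-reflexive (ℕ.*-comm (l i) (μ ℕ./ l i))) (ℕ.m/n*n≤m μ (l i))) μ∣h)
        (λ e → ∤μ (∣ₚ-≤ (subst (suc μ ≤_) (ℕ.*-comm (suc (μ ℕ./ l i)) (l i)) (<-suc-/* μ (l i))) e))
        (cong [_] (trans (cong (ℤ._/ℕ l i) (∸-shift {m} {e} {μ} {l i *ℕ E} valuations)) (/ℕ-minus μ E (l i))))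
      where
      ∤bE = ∤-nat-split (prime i) (b-power-split E i)
      h≉0 : ¬ h ≋ ⌜ 0ℤ ⌝
      h≉0 h≋0 = ∤-⊗ (prime i) (∤ ∘ ∣ₚ⇒∣) ∤bE (≋0⇒∣ₚ (≋-trans scaled (≋-trans (⊗-cong h≋0 ≋-refl) (Ring.zeroˡ (nat (p i ^ℕ e))))) _)
      valuation = exact-valuation h≉0
      μ : ℕ
      μ = proj₁ valuation
      μ∣h = proj₁ (proj₂ valuation)
      ∤μ = proj₂ (proj₂ valuation)
      valuations : m +ℕ l i *ℕ E ≡ μ +ℕ e
      valuations = exact-unique {x = x ⊗ bE} (∣ₚ-⊗ (∣⇒∣ₚ d) (b^-∣ₚ E i)) (∤-⊗ (prime i) (∤ ∘ ∣ₚ⇒∣) ∤bE)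
        (∣ₚ-cong (≋-sym scaled) (∣ₚ-⊗ μ∣h (nat-p^ e)))
        (λ u → ∤-⊗ (prime i) ∤μ (nat-p^-∤ (prime i) e) (∣ₚ-cong scaled u))

    power-inverse : ∀ n κ {r P : ℤₚ (p i)} → κ ≡ n +ℕ E → r ⊗ nat (b ^ℕ n) ≋ P → r ⊗ nat (b ^ℕ κ) ≋ bE ⊗ P
    power-inverse n _ {r} {P} refl h = ≋-trans (⊗-cong ≋-refl (≋-trans (≡⇒≋ (cong nat (ℕ.^-distribˡ-+-* b n E))) (nat-* (b ^ℕ n) (b ^ℕ E))))
      (≋-trans (≋-sym (Ring.*-assoc r (nat (b ^ℕ n)) bE)) (≋-trans (⊗-cong h ≋-refl) (Ring.*-comm P bE)))

    b^-spec : ∀ k κ → k ≡ + κ ℤ.- + E →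
              num ((b^- k) i) ⊗ nat (b ^ℕ κ) ≋ bE ⊗ nat (p i ^ℕ expo ((b^- k) i))
    b^-spec (+ n) κ eq = power-inverse n κ κ≡ (recip-spec (prime i) (b ^ℕ n) {{b^≢0 n}})
      where
      κ≡ : κ ≡ n +ℕ E
      κ≡ = ℤ.+-injective (trans (lem (+ κ) (+ E)) (trans (cong (ℤ._+ + E) (sym eq)) (sym (ℤ.pos-+ n E))))
        where
        lem : ∀ κ E → κ ≡ κ ℤ.- E ℤ.+ E
        lem = solve-∀
    b^-spec -[1+ n ] κ eq = ≋-trans (⊗-cong (fromℤ≋⌜⌝ (+ (b ^ℕ suc n))) ≋-refl)
      (≋-trans (≋-sym (nat-* (b ^ℕ suc n) (b ^ℕ κ)))
      (≋-trans (≡⇒≋ (cong nat (trans (sym (ℕ.^-distribˡ-+-* b (suc n) κ)) (cong (b ^ℕ_) E≡)))) (≋-sym (Ring.*-identityʳ bE))))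
      where
      E≡ : suc n +ℕ κ ≡ E
      E≡ = ℤ.+-injective (trans (ℤ.pos-+ (suc n) κ) (trans (cong (λ u → ℤ.- u ℤ.+ + κ) eq) (lem (+ κ) (+ E))))
        where
        lem : ∀ κ E → ℤ.- (κ ℤ.- E) ℤ.+ κ ≡ E
        lem = solve-∀

    -- Here c is b^(E-κ) and r = c q, so b^κ r = b^E q = h. Since b^κ divides h, the number r is
    -- integral, and taking its integer part t loses nothing.
    shifted-integerPart : ∀ (c q r : ℚₚ (p i)) t h κ → (expo r ∣ₚ num r → nat (p i ^ℕ expo r) ⊗ t ≋ num r) →
      num r ≋ num c ⊗ num q → expo r ≡ expo c +ℕ expo q →
      num c ⊗ nat (b ^ℕ κ) ≋ bE ⊗ nat (p i ^ℕ expo c) →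
      num q ⊗ bE ≋ h ⊗ nat (p i ^ℕ expo q) → l i *ℕ κ ∣ₚ h → nat (b ^ℕ κ) ⊗ t ≋ h
    shifted-integerPart c q r t h κ part num-r expo-r hc hq κ∣h = ≋-trans (⊗-cong ≋-refl part≋w) bw≋h
      where
      w : ℤₚ (p i)
      w = proj₁ (b^-divide κ i κ∣h)
      bw≋h : nat (b ^ℕ κ) ⊗ w ≋ h
      bw≋h = proj₂ (b^-divide κ i κ∣h)
      num≋ : num r ≋ nat (p i ^ℕ expo r) ⊗ w
      num≋ = ≋-trans num-r (nat-cancel (prime i) (b ^ℕ κ) {{b^≢0 κ}}
        (≋-trans (solve 3 (λ k c q → k :* (c :* q) := (c :* k) :* q) ≋-refl (nat (b ^ℕ κ)) (num c) (num q))
        (≋-trans (⊗-cong hc ≋-refl)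
        (≋-trans (solve 3 (λ B P q → (B :* P) :* q := P :* (q :* B)) ≋-refl bE (nat (p i ^ℕ expo c)) (num q))
        (≋-trans (⊗-cong ≋-refl (≋-trans hq (⊗-cong (≋-sym bw≋h) ≋-refl)))
        (≋-trans (solve 4 (λ P k w Q → P :* ((k :* w) :* Q) := k :* ((P :* Q) :* w)) ≋-refl
            (nat (p i ^ℕ expo c)) (nat (b ^ℕ κ)) w (nat (p i ^ℕ expo q)))
          (⊗-cong ≋-refl (⊗-cong (≋-trans (≋-sym (p^-+ (expo c) (expo q))) (≡⇒≋ (cong (λ e → nat (p i ^ℕ e)) (sym expo-r)))) ≋-refl))))))))
      part≋w : t ≋ w
      part≋w = ⊗-cancelˡ (prime i) (nat-p^-∤ (prime i) (expo r))
        (≋-trans (part (∣ₚ-cong (≋-sym num≋) (∣ₚ-⊗ʳ w (nat-p^ _)))) num≋)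

  -- The two clauses of `ℒ`, with the valuation as an index so that they can be matched against the
  -- two cases of `Order`.
  data ℒ-View (x : ℚ_b) : ℤ ⁺ → ℤ_b → Set where
    at-⊤   : ∀ {z} → (∀ i n → approx (z i) n ≡ 0ℤ) → ℒ-View x ⊤⁺ z
    at-[_] : ∀ k {z} (r : ℚ_b) → (∀ i → num (r i) ≋ num ((b^- k) i) ⊗ num (x i)) →
             (∀ i → expo (r i) ≡ expo ((b^- k) i) +ℕ expo (x i)) →
             (∀ i n → approx (z i) n ≡ approx (integerPart (prime i) (r i)) n) → ℒ-View x [ k ] z

  ℒ-view : (x : ℚ_b) → ℒ-View x (ν-b em x) (ℒ em x)
  ℒ-view x with ν-b em x
  ... | ⊤⁺    = at-⊤ λ i n → refl
  ... | [ k ] = at-[ k ] (λ i → (b^- k) i * x i) (λ i → num-* ((b^- k) i) (x i)) (λ i → refl) λ i n → refl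

  mod-b^-spec : ∀ (z : ℤ_b) d i → l i *ℕ d ∣ₚ nat {p i} (z mod-b^ d) ⊖ z i
  mod-b^-spec z d i = ∣ₚ-cong (-ᶻ≋⊖ (z mod-b^ d) (z i)) (∣⇒∣ₚ (proj₂ (proj₂ (residue z d)) i))

  mod-b^-< : ∀ (z : ℤ_b) d → z mod-b^ d < b ^ℕ d
  mod-b^-< z d = proj₁ (proj₂ (residue z d))

  -- Since ν_b(b^E x) = ν_b(x) + E, the normalisations of x and of h = b^E x coincide, and so do
  -- their digits.
  ℓ-lastDigits : ∀ E (x : ℚ_b) (h : ℤ_b) → (∀ i → num (x i) ⊗ nat (b ^ℕ E) ≋ h i ⊗ nat (p i ^ℕ expo (x i))) →
                 ∀ d → LastDigits d h (ℓ em d x)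
  ℓ-lastDigits E x h scaled d = digits (ℒ-view x)
    (order-minimum (λ i V → l i *ℕ V ∣ₚ h i) (λ i k≤m → ∣ₚ-≤ (ℕ.*-monoʳ-≤ (l i) k≤m)) (λ i → ⌊ ν em (x i) / l i ⌋)
      λ i → ν-order E i (x i) (h i) (scaled i))
    where
    digits : ∀ {v z} → ℒ-View x v z → Order E (λ V → V ∣b h) v → LastDigits d h (z mod-b^ d)
    digits {z = z} (at-⊤ z≡0) (no-maximum h≋0 _) = zero-case (∣b⇒≋0 h≋0)
      (residues-determine (mod-b^-< z d) (ℕ.>-nonZero⁻¹ (b ^ℕ d) {{b^≢0 d}})
        λ i → mod-congʳ (≋-trans (≋-pointwise (z i) (fromℤ 0ℤ) (z≡0 i)) (fromℤ≋⌜⌝ 0ℤ)) (mod-b^-spec z d i))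
    digits {z = z} (at-[ k ] r num-r expo-r z≡) (maximum κ hκ ∤ refl) = nonzero-case κ hκ ∤ (mod-b^-< z d) λ i →
      ∣ₚ-exponent (sym (ℕ.*-distribˡ-+ (l i) κ d)) (∣ₚ-cong (≋-trans (Ring.distribˡ (nat (b ^ℕ κ)) (z i) (⊝ nat (z mod-b^ d)))
          (⊕-cong (z-spec i) (solve 2 (λ a c → a :* (:- c) := :- (a :* c)) ≋-refl (nat (b ^ℕ κ)) (nat (z mod-b^ d)))))
        (∣ₚ-⊗ (b^-∣ₚ κ i) (mod-sym (mod-b^-spec z d i))))
      where
      z-spec : ∀ i → nat (b ^ℕ κ) ⊗ z i ≋ h i
      z-spec i = shifted-integerPart E i ((b^- k) i) (x i) (r i) (z i) (h i) κ
        (λ e → ≋-trans (⊗-cong ≋-refl (≋-pointwise (z i) (integerPart (prime i) (r i)) (z≡ i))) (integerPart-spec (prime i) (r i) e))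
        (num-r i) (expo-r i) (b^-spec E i k κ refl) (scaled i) (hκ i)

-- Finite kernels

-- A finite colouring whose colour classes consist of related elements: the finiteness used both for
-- kernels and for pigeonhole arguments.
FinitelyCoded : {X : Set} → (X → X → Set) → Set
FinitelyCoded {X} R = ∃[ Q ] Σ (X → Fin Q) λ code → ∀ x y → code x ≡ code y → R x y

module _ {X : Set} where

  coded-× : {R R′ : X → X → Set} → FinitelyCoded R → FinitelyCoded R′ → FinitelyCoded (λ x y → R x y × R′ x y)
  coded-× (Q , φ , hφ) (Q′ , φ′ , hφ′) = Q *ℕ Q′ , (λ x → Fin.combine (φ x) (φ′ x)) , λ x y eq →
    hφ x y (proj₁ (Fin.combine-injective (φ x) (φ′ x) (φ y) (φ′ y) eq)) ,
    hφ′ x y (proj₂ (Fin.combine-injective (φ x) (φ′ x) (φ y) (φ′ y) eq))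

  coded-Π : ∀ {n} {R : Fin n → X → X → Set} → (∀ i → FinitelyCoded (R i)) → FinitelyCoded (λ x y → ∀ i → R i x y)
  coded-Π {zero}  h = 1 , (λ _ → zero) , λ x y _ ()
  coded-Π {suc n} h with coded-× (h zero) (coded-Π (h ∘ suc))
  ... | Q , φ , hφ = Q , φ , λ x y eq → λ { zero → proj₁ (hφ x y eq) ; (suc i) → proj₂ (hφ x y eq) i }

  coded-map : ∀ {Y : Set} {R : Y → Y → Set} (f : X → Y) → FinitelyCoded R → FinitelyCoded (λ x y → R (f x) (f y))
  coded-map f (Q , φ , hφ) = Q , φ ∘ f , λ x y → hφ (f x) (f y)

  coded-weaken : {R R′ : X → X → Set} → (∀ x y → R x y → R′ x y) → FinitelyCoded R → FinitelyCoded R′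
  coded-weaken h (Q , φ , hφ) = Q , φ , λ x y eq → h x y (hφ x y eq)

coded-⊎ : ∀ {X Y : Set} {R : X ⊎ Y → X ⊎ Y → Set} → FinitelyCoded (λ x y → R (inj₁ x) (inj₁ y)) →
          FinitelyCoded (λ x y → R (inj₂ x) (inj₂ y)) → FinitelyCoded R
coded-⊎ {X} {Y} {R} (Q , φ , hφ) (Q′ , φ′ , hφ′) = Q +ℕ Q′ , code , λ z z′ eq → decode z z′
    (trans (sym (Fin.splitAt-join Q Q′ (Sum.map φ φ′ z))) (trans (cong (Fin.splitAt Q) eq) (Fin.splitAt-join Q Q′ (Sum.map φ φ′ z′))))
  where
  code : X ⊎ Y → Fin (Q +ℕ Q′)
  code z = Fin.join Q Q′ (Sum.map φ φ′ z)
  inj₁-inj : ∀ {a c : Fin Q} → inj₁ {B = Fin Q′} a ≡ inj₁ c → a ≡ c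
  inj₁-inj refl = refl
  inj₂-inj : ∀ {a c : Fin Q′} → inj₂ {A = Fin Q} a ≡ inj₂ c → a ≡ c
  inj₂-inj refl = refl
  decode : ∀ z z′ → Sum.map φ φ′ z ≡ Sum.map φ φ′ z′ → R z z′
  decode (inj₁ x) (inj₁ x′) eq = hφ x x′ (inj₁-inj eq)
  decode (inj₂ y) (inj₂ y′) eq = hφ′ y y′ (inj₂-inj eq)
  decode (inj₁ x) (inj₂ y′) ()
  decode (inj₂ y) (inj₁ x′) ()

coded-Fin : ∀ {n} → FinitelyCoded {Fin n} _≡_
coded-Fin = _ , id , λ _ _ eq → eq

coded-bounded : ∀ {X : Set} {N} (f : X → ℕ) → (∀ x → f x < N) → FinitelyCoded (λ x y → f x ≡ f y)
coded-bounded {N = N} f f< = N , (λ x → Fin.fromℕ< (f< x)) , λ x y eq →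
  trans (sym (Fin.toℕ-fromℕ< (f< x))) (trans (cong toℕ eq) (Fin.toℕ-fromℕ< (f< y)))

coded-boundedℤ : ∀ {X : Set} {C} (f : X → ℤ) → (∀ x → ℤ.∣ f x ∣ ≤ C) → FinitelyCoded (λ x y → f x ≡ f y)
coded-boundedℤ {C = C} f f≤ = coded-weaken
  (λ x y (sign≡ , abs≡) → trans (sym (ℤ.◃-inverse (f x))) (trans (cong₂ ℤ._◃_ sign≡ abs≡) (ℤ.◃-inverse (f y))))
  (coded-× (coded-weaken (λ x y → sign-code-injective (ℤ.sign (f x)) (ℤ.sign (f y)))
      (coded-map (sign-code ∘ ℤ.sign ∘ f) coded-Fin))
    (coded-bounded (ℤ.∣_∣ ∘ f) (s≤s ∘ f≤)))
  where
  sign-code : Sign.Sign → Fin 2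
  sign-code Sign.+ = zero
  sign-code Sign.- = suc zero
  sign-code-injective : ∀ σ τ → sign-code σ ≡ sign-code τ → σ ≡ τ
  sign-code-injective Sign.+ Sign.+ _ = refl
  sign-code-injective Sign.- Sign.- _ = refl
  sign-code-injective Sign.+ Sign.- ()
  sign-code-injective Sign.- Sign.+ ()

coded-residue : ∀ {p} .{{_ : NonZero p}} {X : Set} t (f : X → ℤₚ p) → FinitelyCoded (λ x y → t ∣ₚ f x ⊖ f y)
coded-residue t f = _ , (λ x → proj₁ (residue-mod (f x) t)) , λ x y eq →
  mod-trans (proj₂ (residue-mod (f x) t)) (subst (λ c → t ∣ₚ nat (toℕ c) ⊖ f y) (sym eq) (mod-sym (proj₂ (residue-mod (f y) t))))

base-expansion : ∀ k c i n j .{{_ : NonZero (k ^ℕ i)}} →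
                 k ^ℕ (c +ℕ i) *ℕ n +ℕ j ≡ k ^ℕ i *ℕ (k ^ℕ c *ℕ n +ℕ j ℕ./ k ^ℕ i) +ℕ j ℕ.% k ^ℕ i
base-expansion k c i n j = trans (cong₂ (λ u v → u *ℕ n +ℕ v) (ℕ.^-distribˡ-+-* k c i) (ℕ.m≡m%n+[m/n]*n j (k ^ℕ i)))
  (lem (k ^ℕ c) (k ^ℕ i) n (j ℕ.% k ^ℕ i) (j ℕ./ k ^ℕ i))
  where
  lem : ∀ c i n r q → c *ℕ i *ℕ n +ℕ (r +ℕ q *ℕ i) ≡ i *ℕ (c *ℕ n +ℕ q) +ℕ r
  lem = ℕ-Solver.solve-∀

module Kernel (em : ExcludedMiddle 0ℓ) {A : Set} where

  finite-kernel : ∀ {k} {a : ℕ → A} {X : Set} (S : X → ℕ → A) → FinitelyCoded (λ x y → S x ≗ S y) →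
                  (∀ i j → j < k ^ℕ i → ∃[ x ] kernelElement k a i j ≗ S x) → FiniteKernel k a
  finite-kernel {k} {a} {X} S (Q , code , injective) covers =
    List.tabulate representative , λ i j j< → let x , eq = covers i j j< in
      tabulate⁺ (code x) λ n → trans (eq n) (represents-code x n)
    where
    representative : Fin Q → ℕ → A
    representative c with em {∃[ x ] code x ≡ c}
    ... | yes (x , _) = S x
    -- A colour without elements gets an arbitrary sequence, as the list may contain more than the
    -- kernel.
    ... | no _ = a
    represents-code : ∀ x → S x ≗ representative (code x)
    represents-code x with em {∃[ y ] code y ≡ code x}
    ... | yes (y , eq) = injective x y (sym eq)
    ... | no none = contradiction (x , refl) none

  module _ {k : ℕ} (k≥1 : 1 ≤ k) where

    private
      instance
        k≢0 : NonZero k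
        k≢0 = ℕ.>-nonZero k≥1

    -- The kernel is generated from the sequence by the decimations n ↦ k n + j with j < k, so a
    -- family that contains the sequence and is closed under these contains the whole kernel.
    closed-family-finite-kernel : ∀ {a : ℕ → A} {X : Set} (S : X → ℕ → A) → FinitelyCoded (λ x y → S x ≗ S y) →
      ∃[ x ] a ≗ S x → (∀ x j → j < k → ∃[ y ] (∀ n → S x (k *ℕ n +ℕ j) ≡ S y n)) → FiniteKernel k a
    closed-family-finite-kernel {a} S coded start step = finite-kernel {a = a} S coded covers
      where
      covers : ∀ i j → j < k ^ℕ i → ∃[ x ] kernelElement k a i j ≗ S x
      covers zero    zero    _ = proj₁ start , λ n → trans (cong a (lem n)) (proj₂ start n)
        where
        lem : ∀ n → n +ℕ 0 +ℕ 0 ≡ n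
        lem = ℕ-Solver.solve-∀
      covers zero    (suc j) (s≤s ())
      covers (suc i) j j< = proj₁ next , λ n → trans (cong a (trans (base-expansion k 1 i n j)
            (cong (λ u → k ^ℕ i *ℕ (u *ℕ n +ℕ j₁) +ℕ j₀) (ℕ.*-identityʳ k))))
          (trans (proj₂ previous (k *ℕ n +ℕ j₁)) (proj₂ next n))
        where
        instance
          k^i≢0 : NonZero (k ^ℕ i)
          k^i≢0 = ℕ.m^n≢0 k i
        j₀ j₁ : ℕ
        j₀ = j ℕ.% k ^ℕ i
        j₁ = j ℕ./ k ^ℕ i
        previous = covers i j₀ (ℕ.m%n<n j (k ^ℕ i))
        next = step (proj₁ previous) j₁ (ℕ.m<n*o⇒m/o<n j<)

  -- An element of the kernel depends only on the residues of k^i and j modulo the period.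
  periodic⇒finite-kernel : ∀ {a : ℕ → A} {T} → IsPeriod T a → ∀ k → FiniteKernel k a
  periodic⇒finite-kernel {a} {T} (T≢0 , period) k = finite-kernel {a = a} {X = ℕ × ℕ} (λ (i , j) → kernelElement k a i j)
    (coded-weaken (λ (i , j) (i′ , j′) (i≡ , j≡) n → same (k ^ℕ i *ℕ n +ℕ j) (k ^ℕ i′ *ℕ n +ℕ j′)
        (trans (ℕ.%-distribˡ-+ (k ^ℕ i *ℕ n) j T) (trans (cong₂ (λ u v → (u +ℕ v) ℕ.% T)
          (trans (ℕ.%-distribˡ-* (k ^ℕ i) n T) (trans (cong (λ u → (u *ℕ (n ℕ.% T)) ℕ.% T) i≡) (sym (ℕ.%-distribˡ-* (k ^ℕ i′) n T)))) j≡)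
          (sym (ℕ.%-distribˡ-+ (k ^ℕ i′ *ℕ n) j′ T)))))
      (coded-× (coded-bounded (λ (i , j) → k ^ℕ i ℕ.% T) (λ (i , j) → ℕ.m%n<n (k ^ℕ i) T))
               (coded-bounded (λ (i , j) → j ℕ.% T) (λ (i , j) → ℕ.m%n<n j T))))
    λ i j _ → (i , j) , λ n → refl
    where
    instance
      T≢0′ : NonZero T
      T≢0′ = T≢0
    shift : ∀ r q → a (r +ℕ q *ℕ T) ≡ a r
    shift r zero    = cong a (ℕ.+-identityʳ r)
    shift r (suc q) = trans (cong a (lem r q T)) (trans (period (r +ℕ q *ℕ T)) (shift r q))
      where
      lem : ∀ r q T → r +ℕ (T +ℕ q *ℕ T) ≡ r +ℕ q *ℕ T +ℕ T
      lem = ℕ-Solver.solve-∀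
    same : ∀ n n′ → n ℕ.% T ≡ n′ ℕ.% T → a n ≡ a n′
    same n n′ eq = trans (cong a (ℕ.m≡m%n+[m/n]*n n T)) (trans (shift (n ℕ.% T) (n ℕ./ T))
      (trans (cong a eq) (trans (sym (shift (n′ ℕ.% T) (n′ ℕ./ T))) (cong a (sym (ℕ.m≡m%n+[m/n]*n n′ T))))))

  finite-kernel-power : ∀ {k} {a : ℕ → A} c → FiniteKernel k a → FiniteKernel (k ^ℕ c) a
  finite-kernel-power {k} {a} c (cs , h) = cs , λ i j j< → subst (λ u → Any′ u j)
      (sym (ℕ.^-*-assoc k c i)) (h (c *ℕ i) j (subst (j <_) (ℕ.^-*-assoc k c i) j<))
    where
    Any′ : ℕ → ℕ → Set
    Any′ u j = Any ((λ n → a (u *ℕ n +ℕ j)) ≗_) cs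

  -- With i = c q + r and r < c, an element of the k-kernel is a decimation by k^r of one of the
  -- k^c-kernel. Both r and the offset, which is below k^r, take finitely many values.
  finite-kernel-root : ∀ {k} {a : ℕ → A} c → 1 ≤ k → 1 ≤ c → FiniteKernel (k ^ℕ c) a → FiniteKernel k a
  finite-kernel-root {k} {a} c k≥1 c≥1 (cs , h) = finite-kernel {a = a} {X = Index} sequence coded covers
    where
    instance
      k≢0 : NonZero k
      k≢0 = ℕ.>-nonZero k≥1
      c≢0 : NonZero c
      c≢0 = ℕ.>-nonZero c≥1
    Index : Set
    Index = Fin (List.length cs) × Fin c × Fin (k ^ℕ c)
    sequence : Index → ℕ → A
    sequence (e , r , j) n = List.lookup cs e (k ^ℕ toℕ r *ℕ n +ℕ toℕ j)
    coded : FinitelyCoded (λ x y → sequence x ≗ sequence y)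
    coded = coded-weaken (λ { (e , r , j) (e , r , j) (refl , refl , refl) n → refl })
      (coded-× (coded-map proj₁ coded-Fin) (coded-× (coded-map (proj₁ ∘ proj₂) coded-Fin) (coded-map (proj₂ ∘ proj₂) coded-Fin)))
    covers : ∀ i j → j < k ^ℕ i → ∃[ x ] kernelElement k a i j ≗ sequence x
    covers i j j< = (Any.index found , Fin.fromℕ< r< , Fin.fromℕ< j₁<) , λ n → trans
        (cong a (trans (cong (λ u → k ^ℕ u *ℕ n +ℕ j) i≡) (base-expansion k r (c *ℕ q) n j)))
        (trans (cong a (cong (λ u → u *ℕ (k ^ℕ r *ℕ n +ℕ j₁) +ℕ j₀) (sym (ℕ.^-*-assoc k c q))))
        (trans (lookup-index found (k ^ℕ r *ℕ n +ℕ j₁))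
          (cong₂ (λ u v → List.lookup cs (Any.index found) (k ^ℕ u *ℕ n +ℕ v)) (sym (Fin.toℕ-fromℕ< r<)) (sym (Fin.toℕ-fromℕ< j₁<)))))
      where
      q r : ℕ
      q = i ℕ./ c
      r = i ℕ.% c
      instance
        k^cq≢0 : NonZero (k ^ℕ (c *ℕ q))
        k^cq≢0 = ℕ.m^n≢0 k (c *ℕ q)
      i≡ : i ≡ r +ℕ c *ℕ q
      i≡ = trans (ℕ.m≡m%n+[m/n]*n i c) (cong (r +ℕ_) (ℕ.*-comm q c))
      r< : r < c
      r< = ℕ.m%n<n i c
      j₀ j₁ : ℕ
      j₀ = j ℕ.% k ^ℕ (c *ℕ q)
      j₁ = j ℕ./ k ^ℕ (c *ℕ q)
      j₁< : j₁ < k ^ℕ c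
      j₁< = ℕ.<-≤-trans (ℕ.m<n*o⇒m/o<n (subst (j <_) (trans (cong (k ^ℕ_) i≡) (ℕ.^-distribˡ-+-* k r (c *ℕ q))) j<))
        (ℕ.^-monoʳ-≤ k (ℕ.<⇒≤ r<))
      found = h q j₀ (subst (j₀ <_) (sym (ℕ.^-*-assoc k c q)) (ℕ.m%n<n j (k ^ℕ (c *ℕ q))))

-- Integral models of digit sequences

module Sequences (em : ExcludedMiddle 0ℓ) {s : ℕ} (B : Factorisation s) (d : ℕ) (d≥1 : 1 ≤ d) where
  open Factorisation B
  open LastDigits B
  open Classical em
  open Compactness em
  open Kernel em

  private
    instance
      p≢0 : ∀ {i} → NonZero (p i)
      p≢0 {i} = prime⇒nonZero (prime i)

  -- What the dynamics of the sequence needs to know about b^E f; information about roots is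
  -- supplied separately, by `FiniteRoots` or `RationalRoot`.
  record Model (a : ℕ → ℕ) : Set where
    field
      H         : ∀ i → ℤₚ (p i) → ℤₚ (p i)
      lipschitz : ∀ i → Lipschitz (H i)
      digits    : ∀ n → LastDigits d (λ i → H i (nat n)) (a n)

  lastDigits-cong : ∀ {h h′ : ℤ_b} {y} → (∀ i → h i ≋ h′ i) → LastDigits d h y → LastDigits d h′ y
  lastDigits-cong eq (zero-case h≋0 y≡0) = zero-case (λ i → ≋-trans (≋-sym (eq i)) (h≋0 i)) y≡0
  lastDigits-cong eq (nonzero-case V V∣ ∤ y< h) = nonzero-case V (λ i → ∣ₚ-cong (eq i) (V∣ i))
    (λ e → ∤ λ i → ∣ₚ-cong (≋-sym (eq i)) (e i)) y<
    (λ i → ∣ₚ-cong (⊕-cong (eq i) ≋-refl) (h i))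

  n≤l*n : ∀ i n → n ≤ l i *ℕ n
  n≤l*n i n = ℕ.m≤n*m n (l i) {{positive i}}

  -- A single component of valuation below t forces ν_b(h) < t, whence agreement modulo b^(t+d)
  -- implies `Close`.
  bounded-unique : ∀ {t N} {h h′ : ℤ_b} {y y′} i → t +ℕ d ≤ N → ¬ t ∣ₚ h i → N ∣b (λ j → h j ⊖ h′ j) →
                   LastDigits d h y → LastDigits d h′ y′ → y ≡ y′
  bounded-unique {t} {N} {h} {h′} i t+d≤N t∤h close = lastDigits-unique d≥1 λ V V∣h →
    ∣b-≤ {h = λ j → h j ⊖ h′ j} (ℕ.≤-trans (ℕ.+-monoˡ-≤ d (ℕ.≮⇒≥ λ t<V →
      t∤h (∣ₚ-≤ (ℕ.≤-trans (ℕ.<⇒≤ t<V) (n≤l*n i V)) (V∣h i)))) t+d≤N) close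

  shift-mod : ∀ N i n q → l i *ℕ N ∣ₚ nat {p i} (n +ℕ b ^ℕ N *ℕ q) ⊖ nat n
  shift-mod N i n q = ∣ₚ-cong (≋-sym (≋-trans (⊕-cong (≋-trans (nat-+ n (b ^ℕ N *ℕ q)) (⊕-cong ≋-refl (nat-* (b ^ℕ N) q))) ≋-refl)
      (solve 3 (λ n B q → (n :+ B :* q) :- n := B :* q) ≋-refl (nat n) (nat (b ^ℕ N)) (nat q))))
    (∣ₚ-⊗ʳ (nat q) (b^-∣ₚ N i))

  rootless⇒periodic : ∀ {a} (𝓜 : Model a) → (∃[ i ] (∀ x → ¬ Model.H 𝓜 i x ≋ ⌜ 0ℤ ⌝)) → ∃[ t ] IsPeriod (b ^ℕ t) a
  rootless⇒periodic {a} 𝓜 (i , rootless) = N , b^≢0 N , λ n → subst (λ u → a (n +ℕ u) ≡ a n) (ℕ.*-identityʳ (b ^ℕ N))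
      (bounded-unique i ℕ.≤-refl (proj₂ bound (nat (n +ℕ b ^ℕ N *ℕ 1)))
        (λ j → lipschitz j (shift-mod N j n 1)) (digits (n +ℕ b ^ℕ N *ℕ 1)) (digits n))
    where
    open Model 𝓜
    bound : ∃[ t ] (∀ x → ¬ t ∣ₚ H i x)
    bound = rootless⇒bounded (lipschitz i) rootless
    N : ℕ
    N = proj₁ bound +ℕ d

  -- θ = u / v
  record RationalRoot {a : ℕ → ℕ} (𝓜 : Model a) (m : Fin s → ℕ) : Set where
    open Model 𝓜
    field
      u           : ℤ
      v           : ℕ
      v-unit      : ∀ i → ¬ p i ℕ∣.∣ v
      θ           : ℤ_b
      v*θ         : ∀ i → nat v ⊗ θ i ≋ ⌜ u ⌝
      G           : ∀ i → ℤₚ (p i) → ℤₚ (p i)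
      G-lipschitz : ∀ i → Lipschitz (G i)
      G-rootless  : ∀ i x → ¬ G i x ≋ ⌜ 0ℤ ⌝
      factors     : ∀ i x → H i x ≋ (x ⊖ θ i) ^ᶻ m i ⊗ G i x

    G-bound : ∃[ t ] (∀ i x → ¬ suc t ∣ₚ G i x)
    G-bound = proj₁ uniform , λ i x e → proj₂ (bound i) x (∣ₚ-≤ (ℕ.≤-trans (proj₂ uniform i) (ℕ.n≤1+n _)) e)
      where
      bound : ∀ i → ∃[ t ] (∀ x → ¬ t ∣ₚ G i x)
      bound i = rootless⇒bounded (G-lipschitz i) (G-rootless i)
      uniform = upper-bound (proj₁ ∘ bound)

  truncated-cancel : ∀ {i t V} {x y : ℤₚ (p i)} → ¬ suc t ∣ₚ y → V ∣ₚ x ⊗ y → V ℕ.∸ t ∣ₚ x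
  truncated-cancel {i} {t} {V} {x} {y} ∤y e with ℕ.≤-total t V
  ... | inj₁ t≤V = ∣ₚ-cancel (prime i) ∤y (∣ₚ-exponent (sym (ℕ.m+[n∸m]≡n t≤V)) (∣ₚ-cong (Ring.*-comm x y) e))
  ... | inj₂ V≤t = ∣ₚ-exponent (sym (ℕ.m≤n⇒m∸n≡0 V≤t)) (∣ₚ-0 x)

  -- Stated for a relation R to serve both congruences between the factors μ and equalities between
  -- sequences.
  periodic-% : ∀ {A : Set} (R : A → A → Set) → (∀ {x y z} → R x y → R y z → R x z) → (∀ {x y} → R x y → R y x) →
               ∀ N {c e : ℕ → A} → (∀ n q → R (c (n +ℕ b ^ℕ N *ℕ q)) (c n)) → (∀ n q → R (e (n +ℕ b ^ℕ N *ℕ q)) (e n)) →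
               (∀ (n : Fin (b ^ℕ N)) → R (c (toℕ n)) (e (toℕ n))) → ∀ n → R (c n) (e n)
  periodic-% R R-trans R-sym N {c} {e} c-per e-per h n = R-trans (reduce c c-per)
      (R-trans (subst (λ u → R (c u) (e u)) (Fin.toℕ-fromℕ< r<) (h (Fin.fromℕ< r<))) (R-sym (reduce e e-per)))
    where
    instance
      T≢0 : NonZero (b ^ℕ N)
      T≢0 = b^≢0 N
    r : ℕ
    r = n ℕ.% b ^ℕ N
    r< : r < b ^ℕ N
    r< = ℕ.m%n<n n (b ^ℕ N)
    n≡ : r +ℕ b ^ℕ N *ℕ (n ℕ./ b ^ℕ N) ≡ n
    n≡ = trans (cong (r +ℕ_) (ℕ.*-comm (b ^ℕ N) (n ℕ./ b ^ℕ N))) (sym (ℕ.m≡m%n+[m/n]*n n (b ^ℕ N)))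
    reduce : ∀ c → (∀ n q → R (c (n +ℕ b ^ℕ N *ℕ q)) (c n)) → R (c n) (c r)
    reduce c per = subst (λ u → R (c u) (c r)) n≡ (per r (n ℕ./ b ^ℕ N))

  -- The components of a centred sequence are (v n + r)^mᵢ μᵢ(n), where v is the fixed denominator
  -- of the root. Up to finitely many possibilities the data are finite: |r| ≤ C, and μᵢ matters
  -- only modulo bᵢ^N, where it is periodic.
  module States (m : Fin s → ℕ) (v C t₀ T : ℕ) (t₀≤T : t₀ ≤ T) where

    N : ℕ
    N = T +ℕ d

    line : ∀ {q} → ℤ → ℕ → ℤₚ q
    line r n = nat v ⊗ nat n ⊕ ⌜ r ⌝

    -- Repeated decimation leads to sequences that are still centred at a root,
    -- with a bounded numerator r, or else purely periodic.
    record Centred : Set where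
      field
        r        : ℤ
        r≤       : ℤ.∣ r ∣ ≤ C
        μ        : ∀ i → ℕ → ℤₚ (p i)
        μ-bound  : ∀ i n → ¬ suc t₀ ∣ₚ μ i n
        μ-period : ∀ i n q → l i *ℕ N ∣ₚ μ i (n +ℕ b ^ℕ N *ℕ q) ⊖ μ i n
        seq      : ℕ → ℕ
        seq-digits : ∀ n → LastDigits d (λ i → line r n ^ᶻ m i ⊗ μ i n) (seq n)

    record Periodic : Set where
      field
        seq    : ℕ → ℕ
        seq<   : ∀ n → seq n < b ^ℕ d
        period : ∀ n q → seq (n +ℕ b ^ℕ N *ℕ q) ≡ seq n

    State : Set
    State = Centred ⊎ Periodic

    sequence : State → ℕ → ℕ
    sequence (inj₁ x) = Centred.seq x
    sequence (inj₂ x) = Periodic.seq x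

    -- As ν(μᵢ) ≤ t₀, the power of the linear factor accounts for all but t₀ of the valuation of a
    -- component. Changing μᵢ by a multiple of bᵢ^N, where N ≥ t₀ + d, thus affects no digit that is
    -- read.
    centred-same : ∀ x y → Centred.r x ≡ Centred.r y →
                   (∀ i (n : Fin (b ^ℕ N)) → l i *ℕ N ∣ₚ Centred.μ x i (toℕ n) ⊖ Centred.μ y i (toℕ n)) →
                   Centred.seq x ≗ Centred.seq y
    centred-same x y refl μ≡ n = lastDigits-unique d≥1
        (λ V V∣ i → ∣ₚ-≤ (exponents i V) (∣ₚ-cong (lem (A i) (X.μ i n) (Y.μ i n))
          (∣ₚ-⊗ (truncated-cancel {i} (X.μ-bound i n) (V∣ i)) (close i))))
        (X.seq-digits n) (Y.seq-digits n)
      where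
      module X = Centred x
      module Y = Centred y
      A : ∀ i → ℤₚ (p i)
      A i = line X.r n ^ᶻ m i
      close : ∀ i → l i *ℕ N ∣ₚ X.μ i n ⊖ Y.μ i n
      close i = periodic-% (λ c e → l i *ℕ N ∣ₚ c ⊖ e) mod-trans mod-sym N (X.μ-period i) (Y.μ-period i) (μ≡ i) n
      lem : ∀ {q} (a x y : ℤₚ q) → a ⊗ (x ⊖ y) ≋ a ⊗ x ⊖ a ⊗ y
      lem = solve 3 (λ a x y → a :* (x :- y) := a :* x :- a :* y) ≋-refl
      exponents : ∀ i V → l i *ℕ (V +ℕ d) ≤ (l i *ℕ V ℕ.∸ t₀) +ℕ l i *ℕ N
      exponents i V = ℕ.≤-trans (ℕ.≤-reflexive (ℕ.*-distribˡ-+ (l i) V d))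
        (ℕ.≤-trans (ℕ.+-monoˡ-≤ (l i *ℕ d) (ℕ.m≤n+m∸n (l i *ℕ V) t₀))
        (ℕ.≤-trans (ℕ.≤-reflexive (rearrange t₀ (l i *ℕ V ℕ.∸ t₀) (l i *ℕ d)))
          (ℕ.+-monoʳ-≤ (l i *ℕ V ℕ.∸ t₀) (ℕ.≤-trans (ℕ.+-monoˡ-≤ (l i *ℕ d) (ℕ.≤-trans t₀≤T (n≤l*n i T)))
            (ℕ.≤-reflexive (sym (ℕ.*-distribˡ-+ (l i) T d)))))))
        where
        rearrange : ∀ a c e → a +ℕ c +ℕ e ≡ c +ℕ (a +ℕ e)
        rearrange = ℕ-Solver.solve-∀

    states-coded : FinitelyCoded (λ x y → sequence x ≗ sequence y)
    states-coded = coded-⊎ {R = λ x y → sequence x ≗ sequence y}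
      (coded-weaken (λ x y (r≡ , μ≡) → centred-same x y r≡ μ≡)
        (coded-× (coded-boundedℤ Centred.r Centred.r≤)
          (coded-Π λ i → coded-Π λ (n : Fin (b ^ℕ N)) → coded-residue (l i *ℕ N) (λ x → Centred.μ x i (toℕ n)))))
      (coded-weaken (λ x y → periodic-% _≡_ trans sym N (Periodic.period x) (Periodic.period y))
        (coded-Π λ (n : Fin (b ^ℕ N)) → coded-bounded (λ x → Periodic.seq x (toℕ n)) (λ x → Periodic.seq< x (toℕ n))))

-- Automaticity at a rational root

module AutomaticAtRoot (em : ExcludedMiddle 0ℓ) {s : ℕ} (B : Factorisation s) (d : ℕ) (d≥1 : 1 ≤ d) where
  open Factorisation B
  open LastDigits B
  open Classical em
  open Kernel em
  open Sequences em B d d≥1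

  module Decimation (m w : Fin s → ℕ) (M : ℕ) (w*m≡M : ∀ i → w i *ℕ m i ≡ M)
                    (v C t₀ T : ℕ) (t₀≤T : t₀ ≤ T) (v≤C : v ≤ C)
                    (T-large : ∀ i → suc (m i *ℕ (l i *ℕ w i) +ℕ t₀) ≤ T) where
    open States m v C t₀ T t₀≤T

    k : ℕ
    k = Π (λ i → p i ^ℕ (l i *ℕ w i))

    k-split : ∀ i → Split (p i) k
    k-split = prime-power-product-split (λ i → l i *ℕ w i)

    instance
      k≢0 : NonZero k
      k≢0 = Π-nonZero (λ i → p i ^ℕ (l i *ℕ w i)) λ i → ℕ.m^n≢0 (p i) (l i *ℕ w i) {{prime⇒nonZero (prime i)}}

    private
      valuation-k^m : ∀ i → m i *ℕ (l i *ℕ w i) ≡ l i *ℕ M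
      valuation-k^m i = trans (lem (m i) (l i) (w i)) (cong (l i *ℕ_) (w*m≡M i))
        where
        lem : ∀ m l w → m *ℕ (l *ℕ w) ≡ l *ℕ (w *ℕ m)
        lem = ℕ-Solver.solve-∀

    opaque

      -- k^mᵢ and b^M have the same pᵢ-adic valuation.
      κ-exists : ∀ i → ∃[ κ ] (nat {p i} (b ^ℕ M) ⊗ κ ≋ nat k ^ᶻ m i × ¬ 1 ∣ₚ κ)
      κ-exists i = proj₁ division , proj₂ division , λ e →
          ∤-^ (prime i) (∤-nat-split (prime i) (k-split i)) (m i)
            (∣ₚ-exponent (trans (ℕ.+-comm (l i *ℕ M) 1) (cong suc (sym (valuation-k^m i))))
              (∣ₚ-cong (proj₂ division) (∣ₚ-⊗ (b^-∣ₚ M i) e)))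
        where
        division : ∃[ κ ] nat {p i} (b ^ℕ M) ⊗ κ ≋ nat k ^ᶻ m i
        division = b^-divide M i (∣ₚ-exponent (valuation-k^m i) (∣ₚ-^ (∣-nat-split (prime i) (k-split i)) (m i)))

    κ : ∀ i → ℤₚ (p i)
    κ i = proj₁ (κ-exists i)

    line-decimate : ∀ {q} r j n → line {q} r (k *ℕ n +ℕ j) ≋ nat v ⊗ nat k ⊗ nat n ⊕ ⌜ + v ℤ.* + j ℤ.+ r ⌝
    line-decimate r j n = ≋-trans (⊕-cong (⊗-cong ≋-refl (≋-trans (nat-+ (k *ℕ n) j) (⊕-cong (nat-* k n) ≋-refl))) ≋-refl)
      (≋-trans (solve 5 (λ v k n j r → v :* (k :* n :+ j) :+ r := (v :* k) :* n :+ (v :* j :+ r)) ≋-refl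
          (nat v) (nat k) (nat n) (nat j) ⌜ r ⌝)
        (⊕-cong ≋-refl (≋-sym (≋-trans (⌜⌝-+ (+ v ℤ.* + j) r) (⊕-cong (⌜⌝-* (+ v) (+ j)) ≋-refl)))))

    line-period : ∀ i r n q → l i *ℕ N ∣ₚ line {p i} r (n +ℕ b ^ℕ N *ℕ q) ⊖ line r n
    line-period i r n q = mod-⊕ (mod-⊗ mod-refl (shift-mod N i n q)) mod-refl

    decimated-period : ∀ {i} (μ : ℕ → ℤₚ (p i)) j → (∀ n q → l i *ℕ N ∣ₚ μ (n +ℕ b ^ℕ N *ℕ q) ⊖ μ n) →
                       ∀ n q → l i *ℕ N ∣ₚ μ (k *ℕ (n +ℕ b ^ℕ N *ℕ q) +ℕ j) ⊖ μ (k *ℕ n +ℕ j)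
    decimated-period {i} μ j period n q = subst (λ u → l i *ℕ N ∣ₚ μ u ⊖ μ (k *ℕ n +ℕ j)) (lem k n (b ^ℕ N) q j)
        (period (k *ℕ n +ℕ j) (k *ℕ q))
      where
      lem : ∀ k n B q j → k *ℕ n +ℕ j +ℕ B *ℕ (k *ℕ q) ≡ k *ℕ (n +ℕ B *ℕ q) +ℕ j
      lem = ℕ-Solver.solve-∀

    -- The chain |r′| k ≤ v j + |r| ≤ C (j + 1) ≤ C k is the reason for letting C bound both v and
    -- |r|.
    decimate-bound : ∀ {r r′ j} → ℤ.∣ r ∣ ≤ C → j < k → + v ℤ.* + j ℤ.+ r ≡ r′ ℤ.* + k → ℤ.∣ r′ ∣ ≤ C
    decimate-bound {r} {r′} {j} r≤C j<k eq = ℕ.*-cancelʳ-≤ ℤ.∣ r′ ∣ C k (ℕ.≤-trans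
      (ℕ.≤-reflexive (sym (trans (cong ℤ.∣_∣ eq) (ℤ.abs-* r′ (+ k)))))
      (ℕ.≤-trans (ℤ.∣i+j∣≤∣i∣+∣j∣ (+ v ℤ.* + j) r)
      (ℕ.≤-trans (ℕ.+-mono-≤ (ℕ.≤-trans (ℕ.≤-reflexive (ℤ.abs-* (+ v) (+ j))) (ℕ.*-monoˡ-≤ j v≤C)) r≤C)
      (ℕ.≤-trans (ℕ.≤-reflexive (trans (ℕ.+-comm (C *ℕ j) C) (sym (ℕ.*-suc C j)))) (ℕ.*-monoʳ-≤ C j<k)))))

    -- If v j + r = r′ k, then v (k n + j) + r = k (v n + r′). The factor k^mᵢ is b^M times a unit
    -- κᵢ; the power b^M, common to all components, cancels from the digits, and κᵢ is absorbed into
    -- μᵢ.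
    centred-step : ∀ (x : Centred) j → j < k → + k ∣ + v ℤ.* + j ℤ.+ Centred.r x →
                   ∃[ y ] (∀ n → Centred.seq x (k *ℕ n +ℕ j) ≡ sequence y n)
    centred-step x j j<k (divides r′ eq) = inj₁ y , λ n → refl
      where
      open Centred x
      line≋ : ∀ {q} n → line {q} r (k *ℕ n +ℕ j) ≋ nat k ⊗ line r′ n
      line≋ n = ≋-trans (line-decimate r j n) (≋-trans (⊕-cong ≋-refl (≋-trans (≡⇒≋ (cong ⌜_⌝ eq)) (⌜⌝-* r′ (+ k))))
        (solve 4 (λ v k n r → (v :* k) :* n :+ r :* k := k :* (v :* n :+ r)) ≋-refl (nat v) (nat k) (nat n) ⌜ r′ ⌝))
      y : Centred
      y = record
        { r = r′
        ; r≤ = decimate-bound {r} {r′} {j} r≤ j<k eq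
        ; μ = λ i n → κ i ⊗ μ i (k *ℕ n +ℕ j)
        ; μ-bound = λ i n e → μ-bound i (k *ℕ n +ℕ j) (unit-cancel (prime i) (proj₂ (proj₂ (κ-exists i))) e)
        ; μ-period = λ i n q → mod-⊗ mod-refl (decimated-period (μ i) j (μ-period i) n q)
        ; seq = λ n → seq (k *ℕ n +ℕ j)
        ; seq-digits = λ n → lastDigits-b^-cancel M (lastDigits-cong (λ i →
            ≋-trans (⊗-cong (≋-trans (^ᶻ-cong (m i) (line≋ n)) (≋-trans (^ᶻ-⊗ (nat k) (line r′ n) (m i))
                (⊗-cong (≋-sym (proj₁ (proj₂ (κ-exists i)))) ≋-refl))) ≋-refl)
              (solve 4 (λ β κ L μ → ((β :* κ) :* L) :* μ := β :* (L :* (κ :* μ))) ≋-refl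
                (nat (b ^ℕ M)) (κ i) (line r′ n ^ᶻ m i) (μ i (k *ℕ n +ℕ j))))
            (seq-digits (k *ℕ n +ℕ j)))
        }

    k∤⇒∤ : ∀ z → ¬ + k ∣ z → ∃[ i ] ¬ l i *ℕ w i ∣ₚ ⌜_⌝ {p i} z
    k∤⇒∤ z k∤z = ¬∀⇒∃¬ λ h → k∤z (∣ᵤ⇒∣ (Π-∣ (λ i → p i ^ℕ (l i *ℕ w i)) (prime-power-coprime (λ i → l i *ℕ w i))
      λ i → ∣⇒∣ᵤ (∣ₚ-⌜⌝⁻¹ (h i))))

    -- Since v (k n + j) + r ≡ v j + r modulo k, some prime pᵢ bounds the valuation of the linear
    -- factor for all n. The i-th component then has valuation at most mᵢ lᵢ wᵢ + t₀ < T, so the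
    -- decimated sequence stays away from the root and is periodic.
    centred-exit : ∀ (x : Centred) j → ¬ + k ∣ + v ℤ.* + j ℤ.+ Centred.r x →
                   ∃[ y ] (∀ n → Centred.seq x (k *ℕ n +ℕ j) ≡ sequence y n)
    centred-exit x j k∤ = inj₂ y , λ n → refl
      where
      open Centred x
      i : Fin s
      i = proj₁ (k∤⇒∤ _ k∤)
      line∤ : ∀ n → ¬ suc (l i *ℕ w i) ∣ₚ line {p i} r (k *ℕ n +ℕ j)
      line∤ n e = proj₂ (k∤⇒∤ _ k∤) (∣ₚ-cong
        (solve 2 (λ a c → (a :+ c) :- a := c) ≋-refl (nat v ⊗ nat k ⊗ nat n) ⌜ + v ℤ.* + j ℤ.+ r ⌝)
        (∣ₚ-⊖ (∣ₚ-cong (line-decimate r j n) (∣ₚ-≤ (ℕ.n≤1+n _) e))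
          (∣ₚ-⊗ʳ (nat n) (∣ₚ-⊗ˡ (nat v) (∣-nat-split (prime i) (k-split i))))))
      y : Periodic
      y = record
        { seq = λ n → seq (k *ℕ n +ℕ j)
        ; seq< = λ n → lastDigits-bound (seq-digits (k *ℕ n +ℕ j))
        ; period = λ n q → bounded-unique i (ℕ.+-monoˡ-≤ d (T-large i))
            (∤-⊗ (prime i) (∤-^ (prime i) (line∤ (n +ℕ b ^ℕ N *ℕ q)) (m i)) (μ-bound i _))
            (λ i → mod-⊗ (mod-^ (decimated-period (line r) j (line-period i r) n q) (m i)) (decimated-period (μ i) j (μ-period i) n q))
            (seq-digits _) (seq-digits _)
        }

    periodic-step : ∀ (x : Periodic) j → ∃[ y ] (∀ n → Periodic.seq x (k *ℕ n +ℕ j) ≡ sequence y n)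
    periodic-step x j = inj₂ y , λ n → refl
      where
      open Periodic x
      y : Periodic
      y = record
        { seq = λ n → seq (k *ℕ n +ℕ j) ; seq< = λ n → seq< (k *ℕ n +ℕ j)
        ; period = λ n q → trans (cong seq (lem k n (b ^ℕ N) q j)) (period (k *ℕ n +ℕ j) (k *ℕ q)) }
        where
        lem : ∀ k n B q j → k *ℕ (n +ℕ B *ℕ q) +ℕ j ≡ k *ℕ n +ℕ j +ℕ B *ℕ (k *ℕ q)
        lem = ℕ-Solver.solve-∀

    step : ∀ x j → j < k → ∃[ y ] (∀ n → sequence x (k *ℕ n +ℕ j) ≡ sequence y n)
    step (inj₁ x) j j<k with + k ∣? + v ℤ.* + j ℤ.+ Centred.r x
    ... | yes k∣ = centred-step x j j<k k∣
    ... | no  k∤ = centred-exit x j k∤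
    step (inj₂ x) j j<k = periodic-step x j

    centred⇒finite-kernel : (x : Centred) → FiniteKernel k (Centred.seq x)
    centred⇒finite-kernel x = closed-family-finite-kernel (ℕ.>-nonZero⁻¹ k) sequence states-coded (inj₁ x , λ n → refl) step

  automatic-at-root : ∀ {a} (𝓜 : Model a) {m} → RationalRoot 𝓜 m → (w : Fin s → ℕ) (M : ℕ) → (∀ i → w i *ℕ m i ≡ M) →
                      FiniteKernel (Π (λ i → p i ^ℕ (l i *ℕ w i))) a
  automatic-at-root {a} 𝓜 {m} root w M w*m≡M = Decimation.centred⇒finite-kernel m w M w*m≡M v (v +ℕ ℤ.∣ u ∣) t₀ T
      (ℕ.m≤m⊔n t₀ (proj₁ bound)) (ℕ.m≤m+n v ℤ.∣ u ∣) (λ i → ℕ.≤-trans (proj₂ bound i) (ℕ.m≤n⊔m t₀ (proj₁ bound)))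
      (record
        -- As n - θᵢ = (v n - u) / v, the sequence itself is centred, with r = -u; the unit v^-mᵢ
        -- goes into μᵢ.
        { r = ℤ.- u
        ; r≤ = ℕ.≤-trans (ℕ.≤-reflexive (ℤ.∣-i∣≡∣i∣ u)) (ℕ.m≤n+m ℤ.∣ u ∣ v)
        ; μ = λ i n → proj₁ (inv i) ^ᶻ m i ⊗ G i (nat n)
        ; μ-bound = λ i n e → proj₂ G-bound i (nat n) (unit-cancel (prime i) (inv^-unit i) e)
        ; μ-period = λ i n q → mod-⊗ mod-refl (G-lipschitz i (shift-mod (T +ℕ d) i n q))
        ; seq = a
        ; seq-digits = λ n → lastDigits-cong (λ i → ≋-trans (factors i (nat n)) (≋-trans (⊗-cong (≋-trans (^ᶻ-cong (m i) (shift i n))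
              (^ᶻ-⊗ (nat v ⊗ nat n ⊕ ⌜ ℤ.- u ⌝) (proj₁ (inv i)) (m i))) ≋-refl)
            (Ring.*-assoc ((nat v ⊗ nat n ⊕ ⌜ ℤ.- u ⌝) ^ᶻ m i) (proj₁ (inv i) ^ᶻ m i) (G i (nat n)))))
            (digits n)
        })
    where
    open Model 𝓜
    open RationalRoot root
    t₀ T : ℕ
    t₀ = proj₁ G-bound
    bound : ∃[ t ] (∀ i → suc (m i *ℕ (l i *ℕ w i) +ℕ t₀) ≤ t)
    bound = upper-bound (λ i → suc (m i *ℕ (l i *ℕ w i) +ℕ t₀))
    T = t₀ ℕ.⊔ proj₁ bound
    inv : ∀ i → ∃[ c ] nat {p i} v ⊗ c ≋ ⌜ 1ℤ ⌝
    inv i = inverse-of-coprime (∤⇒coprime (prime i) (v-unit i))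
    inv^-unit : ∀ i → ¬ 1 ∣ₚ proj₁ (inv i) ^ᶻ m i
    inv^-unit i = subst (λ u → ¬ suc u ∣ₚ proj₁ (inv i) ^ᶻ m i) (ℕ.*-zeroʳ (m i)) (∤-^ (prime i)
      (λ e → ¬-∣1 (prime i) (∣ₚ-cong (proj₂ (inv i)) (∣ₚ-⊗ˡ (nat v) e))) (m i))
    shift : ∀ i n → nat n ⊖ θ i ≋ (nat v ⊗ nat n ⊕ ⌜ ℤ.- u ⌝) ⊗ proj₁ (inv i)
    shift i n = ≋-sym (≋-trans (⊗-cong (⊕-cong ≋-refl (≋-trans (⌜⌝-neg u) (⊝-cong (≋-sym (v*θ i))))) ≋-refl)
      (≋-trans (solve 4 (λ v n θ c → (v :* n :+ :- (v :* θ)) :* c := (v :* c) :* (n :- θ)) ≋-refl (nat v) (nat n) (θ i) (proj₁ (inv i)))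
        (≋-trans (⊗-cong (proj₂ (inv i)) ≋-refl) (Ring.*-identityˡ (nat n ⊖ θ i)))))

-- Integers and affine maps in ℤₚ

n<p^n : ∀ {p} → Prime p → ∀ n → n < p ^ℕ n
n<p^n pr zero    = s≤s z≤n
n<p^n {p} pr (suc n) = ℕ.≤-<-trans (n<p^n pr n) (ℕ.^-monoʳ-< p (ℕ.nonTrivial⇒n>1 p {{prime⇒nonTrivial pr}}) (ℕ.n<1+n n))

-- The congruence modulo p^|x - y| suffices, this power being larger than |x - y|.
⌜⌝-injective : ∀ {p} → Prime p → ∀ {x y} → ⌜_⌝ {p} x ≋ ⌜ y ⌝ → x ≡ y
⌜⌝-injective {p} pr {x} {y} eq = ℤ.i-j≡0⇒i≡j x y (ℤ.∣i∣≡0⇒i≡0 (small-multiple (n<p^n pr ℤ.∣ x ℤ.- y ∣)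
  (∣⇒∣ᵤ (∣ₚ-⌜⌝⁻¹ (∣ₚ-cong (≋-sym (≋-trans (⌜⌝-+ x (ℤ.- y)) (⊕-cong ≋-refl (⌜⌝-neg y)))) (≋⇒∣ₚ eq ℤ.∣ x ℤ.- y ∣))))))

nat-injective : ∀ {p} → Prime p → ∀ {m n} → nat {p} m ≋ nat n → m ≡ n
nat-injective pr eq = ℤ.+-injective (⌜⌝-injective pr eq)

split-v≤ : ∀ {p A} → Prime p → .{{_ : NonZero A}} → (sp : Split p A) → Split.v sp ≤ A
split-v≤ {p} {A} pr sp = ℕ.≤-trans (ℕ.<⇒≤ (n<p^n pr v))
  (ℕ∣.∣⇒≤ (subst (p ^ℕ v ℕ∣.∣_) (sym factorises) (ℕ∣.m∣m*n cofactor)))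
  where open Split sp

affine : ∀ {p} → ℕ → ℕ → ℤₚ p → ℤₚ p
affine A j x = nat A ⊗ x ⊕ nat j

affine-nat : ∀ {p} A j n → nat {p} (A *ℕ n +ℕ j) ≋ affine A j (nat n)
affine-nat A j n = ≋-trans (nat-+ (A *ℕ n) j) (⊕-cong (nat-* A n) ≋-refl)

affine-mod : ∀ {p t} A j {x y : ℤₚ p} → t ∣ₚ x ⊖ y → t ∣ₚ affine A j x ⊖ affine A j y
affine-mod A j d = mod-⊕ (mod-⊗ mod-refl d) mod-refl

affine-cancel : ∀ {p} → Prime p → ∀ A .{{_ : NonZero A}} j {x y : ℤₚ p} → affine A j x ≋ affine A j y → x ≋ y
affine-cancel pr A j {x} {y} eq = nat-cancel pr A (≋-trans (lem (nat A ⊗ x) (nat j))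
  (≋-trans (⊕-cong eq ≋-refl) (≋-sym (lem (nat A ⊗ y) (nat j)))))
  where
  lem : ∀ a c → a ≋ (a ⊕ c) ⊖ c
  lem = solve 2 (λ a c → a := (a :+ c) :- c) ≋-refl

-- Discontinuities of the digits

module Discontinuity (em : ExcludedMiddle 0ℓ) {s : ℕ} (B : Factorisation s) (d : ℕ) (d≥1 : 1 ≤ d) where
  open Factorisation B
  open LastDigits B
  open Classical em
  open Sequences em B d d≥1

  opaque

    approximate : ∀ (z : ℤ_b) D → ∃[ n ] (∀ i → l i *ℕ D ∣ₚ nat n ⊖ z i)
    approximate z D = z mod-b^ D , Bridge.mod-b^-spec em B z D

    update : (o : Fin s) → ℤₚ (p o) → ℤ_b → ℤ_b
    update o x z i with i Fin.≟ o
    ... | yes refl = x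
    ... | no  _    = z i

    update-same : ∀ o x z → update o x z o ≡ x
    update-same o x z with o Fin.≟ o
    ... | yes refl = refl
    ... | no  o≢o  = contradiction refl o≢o

    update-other : ∀ {o x z i} → i ≢ o → update o x z i ≡ z i
    update-other {o} {i = i} i≢o with i Fin.≟ o
    ... | yes i≡o = contradiction i≡o i≢o
    ... | no  _   = refl

  -- The o-th component keeps ν_b(h) below W. After division by b^ν_b(h) the i-th component is
  -- therefore still divisible by bᵢ^d.
  component-zero : ∀ {W h y} o i → ¬ l o *ℕ W ∣ₚ h o → l i *ℕ (W +ℕ d) ∣ₚ h i → LastDigits d h y → l i *ℕ d ∣ₚ nat {p i} y
  component-zero o i ∤ e (zero-case _ refl) = nat-∣ₚ (ℕ∣._∣0 _)
  component-zero {W} {h} {y} o i ∤ e (nonzero-case V V∣ _ _ hy) = b^-cancel V i (∣ₚ-exponent (ℕ.*-distribˡ-+ (l i) V d)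
      (∣ₚ-cong (solve 2 (λ h c → h :- (h :- c) := c) ≋-refl (h i) (nat (b ^ℕ V) ⊗ nat y))
        (∣ₚ-⊖ (∣ₚ-≤ (ℕ.*-monoʳ-≤ (l i) (ℕ.+-monoˡ-≤ d V≤W)) e) (hy i))))
    where
    V≤W : V ≤ W
    V≤W = ℕ.≮⇒≥ λ W<V → ∤ (∣ₚ-≤ (ℕ.*-monoʳ-≤ (l o) (ℕ.<⇒≤ W<V)) (V∣ o))

  -- With V = ν_b(h) < W, all components other than o are divisible by b^(V+1). If the o-th residue
  -- vanished, the o-th component would be so as well, contrary to the maximality of V.
  component-nonzero : ∀ {W h y} o → ¬ l o *ℕ W ∣ₚ h o → (∀ i → i ≢ o → l i *ℕ W ∣ₚ h i) → LastDigits d h y →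
                      ¬ l o *ℕ d ∣ₚ nat {p o} y
  component-nonzero o ∤ e (zero-case h≋0 _) _ = ∤ (≋0⇒∣ₚ (h≋0 o) _)
  component-nonzero {W} {h} {y} o ∤ e (nonzero-case V V∣ maximal _ hy) d∣y = maximal all
    where
    V<W : V < W
    V<W = ℕ.≰⇒> λ W≤V → ∤ (∣ₚ-≤ (ℕ.*-monoʳ-≤ (l o) W≤V) (V∣ o))
    all : suc V ∣b h
    all i with i Fin.≟ o
    ... | no  i≢o  = ∣ₚ-≤ (ℕ.*-monoʳ-≤ (l i) V<W) (e i i≢o)
    ... | yes refl = ∣ₚ-≤ (ℕ.*-monoʳ-≤ (l o) (ℕ.≤-trans (ℕ.≤-reflexive (ℕ.+-comm 1 V)) (ℕ.+-monoʳ-≤ V d≥1)))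
      (∣ₚ-cong (solve 2 (λ h c → (h :- c) :+ c := h) ≋-refl (h o) (nat (b ^ℕ V) ⊗ nat y))
        (∣ₚ-⊕ (hy o) (∣ₚ-exponent (sym (ℕ.*-distribˡ-+ (l o) V d)) (∣ₚ-⊗ (b^-∣ₚ V o) d∣y))))

  -- Among the r + 1 points ω + q^N t with 0 ≤ t ≤ r, at least one is not sent to a root: the affine
  -- map is injective, and there are at most r roots.
  isolated : ∀ {q} → Prime q → {F : ℤₚ q → ℤₚ q} → FiniteRoots F → ∀ A .{{_ : NonZero A}} j N ω →
             ∃[ x ] (N ∣ₚ x ⊖ ω × ¬ F (affine A j x) ≋ ⌜ 0ℤ ⌝)
  isolated {q} pr {F} (r , root , find) A j N ω = ¬¬-elim λ none →
    let t , t′ , t<t′ , same = Fin.pigeonhole (ℕ.n<1+n r) (λ t → proj₁ (find _ (all-roots none t)))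
    in ℕ.<⇒≢ t<t′ (nat-injective pr (⊗-cancelˡ pr (nat-p^-∤ pr N) (cancel (toℕ t) (toℕ t′)
      (affine-cancel pr A j (≋-trans (proj₂ (find _ (all-roots none t)))
        (≋-trans (≡⇒≋ (cong root same)) (≋-sym (proj₂ (find _ (all-roots none t′))))))))))
    where
    point : ℕ → ℤₚ q
    point t = ω ⊕ nat (q ^ℕ N) ⊗ nat t
    near : ∀ t → N ∣ₚ point t ⊖ ω
    near t = ∣ₚ-cong (solve 2 (λ ω c → c := (ω :+ c) :- ω) ≋-refl ω (nat (q ^ℕ N) ⊗ nat t)) (∣ₚ-⊗ʳ (nat t) (nat-p^ N))
    all-roots : ¬ (∃[ x ] (N ∣ₚ x ⊖ ω × ¬ F (affine A j x) ≋ ⌜ 0ℤ ⌝)) → ∀ (t : Fin (suc r)) → F (affine A j (point (toℕ t))) ≋ ⌜ 0ℤ ⌝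
    all-roots none t = ¬¬-elim λ ¬root → none (point (toℕ t) , near (toℕ t) , ¬root)
    cancel : ∀ t t′ → point t ≋ point t′ → nat (q ^ℕ N) ⊗ nat t ≋ nat (q ^ℕ N) ⊗ nat t′
    cancel t t′ eq = ≋-trans (lem ω (nat (q ^ℕ N) ⊗ nat t)) (≋-trans (⊕-cong eq ≋-refl) (≋-sym (lem ω (nat (q ^ℕ N) ⊗ nat t′))))
      where
      lem : ∀ ω c → c ≋ (ω ⊕ c) ⊖ ω
      lem = solve 2 (λ ω c → c := (ω :+ c) :- ω) ≋-refl

  preimage : ∀ A .{{_ : NonZero A}} j (θ : ℤ_b) → (∀ i → Split.v (split (prime i) A) ∣ₚ θ i ⊖ nat j) →
             ∃[ ω ] (∀ i → affine A j (ω i) ≋ θ i)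
  preimage A j θ e = (λ i → proj₁ (quot i)) , λ i → ≋-trans (⊕-cong (proj₂ (quot i)) ≋-refl)
      (solve 2 (λ θ j → (θ :- j) :+ j := θ) ≋-refl (θ i) (nat j))
    where
    quot : ∀ i → ∃[ y ] nat A ⊗ y ≋ θ i ⊖ nat j
    quot i = divide-by-nat (prime i) (split (prime i) A) (e i)

  module _ {a : ℕ → ℕ} (𝓜 : Model a) where
    open Model 𝓜

    digits-affine : ∀ A j n → LastDigits d (λ i → H i (affine A j (nat n))) (a (A *ℕ n +ℕ j))
    digits-affine A j n = lastDigits-cong (λ i → Lipschitz⇒≋ (lipschitz i) (affine-nat A j n)) (digits (A *ℕ n +ℕ j))

    H-mod : ∀ A j i {t x y} → t ∣ₚ x ⊖ y → t ∣ₚ H i (affine A j x) ⊖ H i (affine A j y)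
    H-mod A j i e = lipschitz i (affine-mod A j e)

    -- Such n approximates the point with o-th coordinate x and the others taken from ω. There the
    -- o-th component is not divisible by p_o^W, whereas the others vanish. The summand N of the
    -- precision keeps n near ω; W + d lets the o-th component dominate by d digits.
    single-component-at : ∀ A j (ω : ℤ_b) → (∀ i → H i (affine A j (ω i)) ≋ ⌜ 0ℤ ⌝) → ∀ o N {x W n} →
      l o *ℕ N ∣ₚ x ⊖ ω o → ¬ W ∣ₚ H o (affine A j x) → (∀ i → l i *ℕ (N +ℕ (W +ℕ d)) ∣ₚ nat n ⊖ update o x ω i) →
      (∀ i → l i *ℕ N ∣ₚ nat n ⊖ ω i) × ¬ l o *ℕ d ∣ₚ nat {p o} (a (A *ℕ n +ℕ j)) ×
      (∀ i → i ≢ o → l i *ℕ d ∣ₚ nat {p i} (a (A *ℕ n +ℕ j)))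
    single-component-at A j ω root o N {x} {W} {n} x≈ω ∤W n≈z = near ,
        component-nonzero o ∤o (λ i i≢o → ∣ₚ-≤ (ℕ.*-monoʳ-≤ (l i) (ℕ.m≤m+n W d)) (others i i≢o)) (digits-affine A j n) ,
        λ i i≢o → component-zero o i ∤o (others i i≢o) (digits-affine A j n)
      where
      at-o : l o *ℕ (N +ℕ (W +ℕ d)) ∣ₚ nat n ⊖ x
      at-o = mod-congʳ (≡⇒≋ (update-same o x ω)) (n≈z o)
      elsewhere : ∀ i → i ≢ o → l i *ℕ (N +ℕ (W +ℕ d)) ∣ₚ nat n ⊖ ω i
      elsewhere i i≢o = mod-congʳ (≡⇒≋ (update-other i≢o)) (n≈z i)
      near : ∀ i → l i *ℕ N ∣ₚ nat n ⊖ ω i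
      near i with i Fin.≟ o
      ... | yes refl = mod-trans (∣ₚ-≤ (ℕ.*-monoʳ-≤ (l o) (ℕ.m≤m+n N (W +ℕ d))) at-o) x≈ω
      ... | no  i≢o  = ∣ₚ-≤ (ℕ.*-monoʳ-≤ (l i) (ℕ.m≤m+n N (W +ℕ d))) (elsewhere i i≢o)
      ∤o : ¬ l o *ℕ W ∣ₚ H o (affine A j (nat n))
      ∤o e = ∤W (∣ₚ-≤ (n≤l*n o W) (mod-∣ (H-mod A j o
        (mod-sym (∣ₚ-≤ (ℕ.*-monoʳ-≤ (l o) (ℕ.≤-trans (ℕ.m≤m+n W d) (ℕ.m≤n+m (W +ℕ d) N))) at-o))) e))
      others : ∀ i → i ≢ o → l i *ℕ (W +ℕ d) ∣ₚ H i (affine A j (nat n))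
      others i i≢o = mod-∣ (H-mod A j i (∣ₚ-≤ (ℕ.*-monoʳ-≤ (l i) (ℕ.m≤n+m (W +ℕ d) N)) (elsewhere i i≢o)))
        (≋0⇒∣ₚ (root i) _)

    locally-constant : ∀ A j i {W n n′} {ω : ℤ_b} → ¬ W ∣ₚ H i (affine A j (ω i)) →
      (∀ i → l i *ℕ (W +ℕ d) ∣ₚ nat n ⊖ ω i) → (∀ i → l i *ℕ (W +ℕ d) ∣ₚ nat n′ ⊖ ω i) →
      a (A *ℕ n +ℕ j) ≡ a (A *ℕ n′ +ℕ j)
    locally-constant A j i {W} {n} {n′} ∤W near near′ = bounded-unique i ℕ.≤-refl
      (λ e → ∤W (mod-∣ (H-mod A j i (mod-sym (∣ₚ-≤ (ℕ.≤-trans (ℕ.m≤m+n W d) (n≤l*n i (W +ℕ d))) (near i)))) e))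
      (λ i → H-mod A j i (mod-trans (near i) (mod-sym (near′ i))))
      (digits-affine A j n) (digits-affine A j n′)

    module _ (finite : ∀ i → FiniteRoots (H i)) where

      -- Arbitrarily close to a root, every component of the last digits
      -- except the o-th one can be made to vanish.
      single-component : ∀ A .{{_ : NonZero A}} j (ω : ℤ_b) → (∀ i → H i (affine A j (ω i)) ≋ ⌜ 0ℤ ⌝) → ∀ o N →
        ∃[ n ] ((∀ i → l i *ℕ N ∣ₚ nat n ⊖ ω i) × ¬ l o *ℕ d ∣ₚ nat {p o} (a (A *ℕ n +ℕ j)) ×
                (∀ i → i ≢ o → l i *ℕ d ∣ₚ nat {p i} (a (A *ℕ n +ℕ j))))
      single-component A j ω root o N =
          let x , x≈ω , ¬root = isolated (prime o) (finite o) A j (l o *ℕ N) (ω o)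
              W , ∤W = ≉0⇒∤ ¬root
              n , n≈z = approximate (update o x ω) (N +ℕ (W +ℕ d))
          in n , single-component-at A j ω root o N x≈ω ∤W n≈z

      -- Both sides have the same discontinuities, namely the preimages of the roots.
      root-transfer : ∀ {o o′ : Fin s} → o ≢ o′ → ∀ A .{{_ : NonZero A}} j A′ j′ →
        (∀ n → a (A *ℕ n +ℕ j) ≡ a (A′ *ℕ n +ℕ j′)) → (ω : ℤ_b) →
        (∀ i → H i (affine A j (ω i)) ≋ ⌜ 0ℤ ⌝) → ∀ i → H i (affine A′ j′ (ω i)) ≋ ⌜ 0ℤ ⌝
      root-transfer {o} {o′} o≢o′ A j A′ j′ same ω root i = ¬¬-elim λ ¬root → refute (≉0⇒∤ ¬root)
        where
        refute : ¬ (∃[ W ] ¬ W ∣ₚ H i (affine A′ j′ (ω i)))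
        refute (W , ∤W) =
          let n₁ , near₁ , ∤y , _ = single-component A j ω root o (W +ℕ d)
              n₂ , near₂ , _ , ∣y = single-component A j ω root o′ (W +ℕ d)
          in ∤y (subst (λ y → l o *ℕ d ∣ₚ nat {p o} y)
              (trans (same n₂) (trans (sym (locally-constant A′ j′ i ∤W near₁ near₂)) (sym (same n₁)))) (∣y o o≢o′))

-- Rationality of the roots from automaticity

module Zooming (em : ExcludedMiddle 0ℓ) {s : ℕ} (B : Factorisation s) (d : ℕ) (d≥1 : 1 ≤ d) where
  open Factorisation B
  open LastDigits B
  open Classical em
  open Sequences em B d d≥1
  open Discontinuity em B d d≥1

  representatives : ∀ {K} {X : Set} (x₀ : X) (class : X → Fin K) → ∃[ rep ] (∀ x → class (rep (class x)) ≡ class x)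
  representatives {K} {X} x₀ class = rep , correct
    where
    rep : Fin K → X
    rep c with em {∃[ x ] class x ≡ c}
    ... | yes (x , _) = x
    ... | no _ = x₀
    correct : ∀ x → class (rep (class x)) ≡ class x
    correct x with em {∃[ y ] class y ≡ class x}
    ... | yes (y , eq) = eq
    ... | no none = contradiction (x , refl) none

  coded-pigeonhole : {R : ℕ → ℕ → Set} → FinitelyCoded R → ∃[ e ] ∃[ e′ ] (e < e′ × R e e′)
  coded-pigeonhole (Q , code , h) with Fin.pigeonhole (ℕ.n<1+n Q) (code ∘ toℕ)
  ... | t , t′ , t<t′ , eq = toℕ t , toℕ t′ , t<t′ , h _ _ eq

  preimage-% : ∀ A .{{_ : NonZero A}} z (θ : ℤ_b) → (∀ i → Split.v (split (prime i) A) ∣ₚ θ i ⊖ nat z) →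
               ∃[ ω ] (∀ i → affine A (z ℕ.% A) (ω i) ≋ θ i)
  preimage-% A z θ e = preimage A (z ℕ.% A) θ λ i → mod-trans (e i) (∣ₚ-cong
      (≋-sym (≋-trans (⊕-cong (≋-trans (≡⇒≋ (cong nat (ℕ.m≡m%n+[m/n]*n z A))) (≋-trans (nat-+ (z ℕ.% A) ((z ℕ./ A) *ℕ A))
          (⊕-cong ≋-refl (nat-* (z ℕ./ A) A)))) ≋-refl)
        (solve 3 (λ r q A → (r :+ q :* A) :- r := q :* A) ≋-refl (nat (z ℕ.% A)) (nat (z ℕ./ A)) (nat A))))
      (∣ₚ-⊗ˡ (nat (z ℕ./ A)) (∣-nat-split (prime i) (split (prime i) A))))

  -- Eliminating ω from θ = A ω + j = A′ ω + j′ gives (A′ - A) θ = A′ j - A j′.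
  rational-fixed-point : ∀ A A′ j j′ (ω θ : ℤ_b) → A < A′ → (∀ i → affine A j (ω i) ≋ θ i) → (∀ i → affine A′ j′ (ω i) ≋ θ i) →
    ∃[ v ] ∃[ u ] (NonZero v × (∀ i → nat v ⊗ θ i ≋ ⌜ u ⌝))
  rational-fixed-point A A′ j j′ ω θ A<A′ h h′ = v , u , ℕ.>-nonZero (ℕ.m<n⇒0<n∸m A<A′) , λ i →
      ≋-trans (⊗-cong (v≋ i) ≋-refl) (≋-trans (solve 3 (λ A A′ θ → (A′ :- A) :* θ := A′ :* θ :- A :* θ) ≋-refl (nat A) (nat A′) (θ i))
      (≋-trans (⊕-cong (⊗-cong ≋-refl (≋-sym (h i))) (⊝-cong (⊗-cong ≋-refl (≋-sym (h′ i)))))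
      (≋-trans (solve 5 (λ A A′ ω j j′ → A′ :* (A :* ω :+ j) :- A :* (A′ :* ω :+ j′) := A′ :* j :- A :* j′) ≋-refl
          (nat A) (nat A′) (ω i) (nat j) (nat j′))
        (≋-sym (≋-trans (⌜⌝-+ (+ A′ ℤ.* + j) (ℤ.- (+ A ℤ.* + j′))) (⊕-cong (⌜⌝-* (+ A′) (+ j))
          (≋-trans (⌜⌝-neg (+ A ℤ.* + j′)) (⊝-cong (⌜⌝-* (+ A) (+ j′))))))))))
    where
    v : ℕ
    v = A′ ℕ.∸ A
    u : ℤ
    u = + A′ ℤ.* + j ℤ.- + A ℤ.* + j′
    v≋ : ∀ i → nat {p i} v ≋ nat A′ ⊖ nat A
    v≋ i = ≋-trans (solve 2 (λ v A → v := (v :+ A) :- A) ≋-refl (nat v) (nat A))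
      (⊕-cong (≋-trans (≋-sym (nat-+ v A)) (≡⇒≋ (cong nat (ℕ.m∸n+n≡m (ℕ.<⇒≤ A<A′))))) ≋-refl)

  module _ {a : ℕ → ℕ} (𝓜 : Model a) (finite : ∀ i → FiniteRoots (Model.H 𝓜 i)) {o o′ : Fin s} (o≢o′ : o ≢ o′) where
    open Model 𝓜

    module _ (A j : ℕ → ℕ) (A≢0 : ∀ e → NonZero (A e)) (ω : ℕ → ℤ_b) (θ : ℤ_b) (θ-root : ∀ i → H i (θ i) ≋ ⌜ 0ℤ ⌝)
             (centre : ∀ e i → affine (A e) (j e) (ω e i) ≋ θ i) {K : ℕ} (class : ℕ → Fin K)
             (same : ∀ e e′ → class e ≡ class e′ → ∀ n → a (A e *ℕ n +ℕ j e) ≡ a (A e′ *ℕ n +ℕ j e′)) where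

      same-class-root : ∀ e e′ → class e ≡ class e′ → ∀ i → H i (affine (A e′) (j e′) (ω e i)) ≋ ⌜ 0ℤ ⌝
      same-class-root e e′ eq = root-transfer 𝓜 finite o≢o′ (A e) {{A≢0 e}} (j e) (A e′) (j e′) (same e e′ eq) (ω e)
        λ i → ≋-trans (Lipschitz⇒≋ (lipschitz i) (centre e i)) (θ-root i)

      -- Let r be the representative of the class of e. Then A_r ω_e + j_r is a common root too, so
      -- ω_e is determined by the class and by the choice, for each i, of one of the finitely many
      -- roots of Hᵢ.
      preimages-coded : FinitelyCoded (λ e e′ → ∀ i → ω e i ≋ ω e′ i)
      preimages-coded = decode (representatives 0 class)
        where
        decode : ∃[ rep ] (∀ e → class (rep (class e)) ≡ class e) → FinitelyCoded (λ e e′ → ∀ i → ω e i ≋ ω e′ i)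
        decode (rep , rep≡) = coded-weaken
            (λ e e′ (class≡ , index≡) i → equal i e e′ _ _ _ _ (cong rep class≡) (index≡ i) (proj₂ (root-index e i)) (proj₂ (root-index e′ i)))
            (coded-× (coded-map class coded-Fin) (coded-Π λ i → coded-map (λ e → proj₁ (root-index e i)) coded-Fin))
          where
          root-index : ∀ e i → ∃[ t ] affine (A (rep (class e))) (j (rep (class e))) (ω e i) ≋ proj₁ (proj₂ (finite i)) t
          root-index e i = proj₂ (proj₂ (finite i)) _ (same-class-root e (rep (class e)) (sym (rep≡ e)) i)
          equal : ∀ i e e′ r r′ t t′ → r ≡ r′ → t ≡ t′ → affine (A r) (j r) (ω e i) ≋ proj₁ (proj₂ (finite i)) t →
                  affine (A r′) (j r′) (ω e′ i) ≋ proj₁ (proj₂ (finite i)) t′ → ω e i ≋ ω e′ i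
          equal i e e′ r _ t _ refl refl h h′ = affine-cancel (prime i) (A r) {{A≢0 r}} (j r) (≋-trans h (≋-sym h′))

      rational-centre : (∀ {e e′} → e < e′ → A e < A e′) → ∃[ v ] ∃[ u ] (NonZero v × (∀ i → nat v ⊗ θ i ≋ ⌜ u ⌝))
      rational-centre A-increasing = let e , e′ , e<e′ , eq = coded-pigeonhole preimages-coded in
        rational-fixed-point (A e) (A e′) (j e) (j e′) (ω e′) θ (A-increasing e<e′)
          (λ i → ≋-trans (⊕-cong (⊗-cong ≋-refl (≋-sym (eq i))) ≋-refl) (centre e i)) (centre e′)

  module _ {m : ℕ} (m≥2 : 2 ≤ m) (a : ℕ → ℕ) (kernel : FiniteKernel m a) where

    private
      m≢0 : NonZero m
      m≢0 = ℕ.>-nonZero (ℕ.≤-trans (s≤s z≤n) m≥2)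

    m^≢0 : ∀ e → NonZero (m ^ℕ e)
    m^≢0 e = ℕ.m^n≢0 m e {{m≢0}}

    opaque

      kernel-class : ∀ e j → j < m ^ℕ e → Fin (List.length (proj₁ kernel))
      kernel-class e j j< = Any.index (proj₂ kernel e j j<)

      kernel-class-≡ : ∀ e j j< e′ j′ j′< → kernel-class e j j< ≡ kernel-class e′ j′ j′< →
                       ∀ n → a (m ^ℕ e *ℕ n +ℕ j) ≡ a (m ^ℕ e′ *ℕ n +ℕ j′)
      kernel-class-≡ e j j< e′ j′ j′< eq n = trans (lookup-index (proj₂ kernel e j j<) n)
        (trans (cong (λ c → List.lookup (proj₁ kernel) c n) eq) (sym (lookup-index (proj₂ kernel e′ j′ j′<) n)))

    -- j is the truncation of θ to e digits in base m.
    record Zoom (θ : ℤ_b) (e : ℕ) : Set where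
      field
        j      : ℕ
        j<     : j < m ^ℕ e
        ω      : ℤ_b
        centre : ∀ i → affine (m ^ℕ e) j (ω i) ≋ θ i

    opaque

      zoom : ∀ θ e → Zoom θ e
      zoom θ e = record
          { j = z ℕ.% A ; j< = ℕ.m%n<n z A ; ω = proj₁ pre ; centre = proj₂ pre }
        where
        A z : ℕ
        A = m ^ℕ e
        instance
          A≢0 : NonZero A
          A≢0 = m^≢0 e
        z-approx : ∃[ n ] (∀ i → l i *ℕ A ∣ₚ nat n ⊖ θ i)
        -- Precision A is ample: the valuation of A at pᵢ is at most A, hence at most lᵢ A.
        z-approx = approximate θ A
        z = proj₁ z-approx
        pre : Σ ℤ_b λ ω → (∀ i → affine A (z ℕ.% A) (ω i) ≋ θ i)
        pre = preimage-% A z θ λ i → ∣ₚ-≤ (ℕ.≤-trans (split-v≤ (prime i) (split (prime i) A)) (n≤l*n i A)) (mod-sym (proj₂ z-approx i))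

    automatic⇒rational : (𝓜 : Model a) → (∀ i → FiniteRoots (Model.H 𝓜 i)) → ∀ {o o′ : Fin s} → o ≢ o′ → (θ : ℤ_b) →
      (∀ i → Model.H 𝓜 i (θ i) ≋ ⌜ 0ℤ ⌝) → ∃[ v ] ∃[ u ] (NonZero v × (∀ i → nat v ⊗ θ i ≋ ⌜ u ⌝))
    automatic⇒rational 𝓜 finite o≢o′ θ θ-root = rational-centre 𝓜 finite o≢o′ (m ^ℕ_) (Zoom.j ∘ zoom θ) m^≢0 (Zoom.ω ∘ zoom θ) θ θ-root
      (Zoom.centre ∘ zoom θ) (λ e → kernel-class e (Zoom.j (zoom θ e)) (Zoom.j< (zoom θ e)))
      (λ e e′ → kernel-class-≡ e _ (Zoom.j< (zoom θ e)) e′ _ (Zoom.j< (zoom θ e′))) (ℕ.^-monoʳ-< m m≥2)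

-- Strictness: comparison of the base m with k

split-unique : ∀ {q A} → Prime q → (sp sp′ : Split q A) → Split.v sp ≡ Split.v sp′
split-unique {q} {A} pr sp sp′ = exact-unique {x = nat {q} A} (∣-nat-split pr sp) (∤-nat-split pr sp) (∣-nat-split pr sp′) (∤-nat-split pr sp′)

%-≡⇒∣ : ∀ x t A .{{_ : NonZero A}} → x ℕ.% A ≡ (x +ℕ t) ℕ.% A → A ℕ∣.∣ t
%-≡⇒∣ x t A eq = ℕ∣.∣m+n∣m⇒∣n (subst (A ℕ∣.∣_) (sym (ℕ.+-cancelˡ-≡ (x ℕ.% A) _ _
    (trans (sym (ℕ.+-assoc (x ℕ.% A) (x ℕ./ A *ℕ A) t)) (trans (cong (_+ℕ t) (sym (ℕ.m≡m%n+[m/n]*n x A)))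
      (trans (ℕ.m≡m%n+[m/n]*n (x +ℕ t) A) (cong (_+ℕ (x +ℕ t) ℕ./ A *ℕ A) (sym eq)))))))
    (ℕ∣.n∣m*n ((x +ℕ t) ℕ./ A))) (ℕ∣.n∣m*n (x ℕ./ A))

-- The slopes ε/l of the two valuations differ, so eventually one of them
-- overtakes the other by any given amount.
overtake : ∀ l l′ ε ε′ c e .{{_ : NonZero l′}} → ε *ℕ l′ < ε′ *ℕ l → l *ℕ l′ +ℕ l′ *ℕ c ≤ e →
           ∃[ W ] (ε *ℕ e +ℕ c ≤ l *ℕ W × l′ *ℕ W ≤ ε′ *ℕ e)
overtake l l′ ε ε′ c e slope e-large = W , ℕ.*-cancelˡ-≤ l′ scaled ,
    ℕ.≤-trans (ℕ.≤-reflexive (ℕ.*-comm l′ W)) (ℕ.m/n*n≤m (ε′ *ℕ e) l′)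
  where
  W : ℕ
  -- The largest W that the second inequality allows. The gap ε l′ + 1 ≤ ε′ l, multiplied by e, pays
  -- for the rounding loss l l′ and for l′ c.
  W = (ε′ *ℕ e) ℕ./ l′
  expand : ∀ l l′ ε e c → l′ *ℕ (ε *ℕ e +ℕ c) +ℕ l *ℕ l′ ≡ ε *ℕ l′ *ℕ e +ℕ (l *ℕ l′ +ℕ l′ *ℕ c)
  expand = ℕ-Solver.solve-∀
  collect : ∀ x e → x *ℕ e +ℕ e ≡ suc x *ℕ e
  collect = ℕ-Solver.solve-∀
  swap : ∀ l ε′ e → ε′ *ℕ l *ℕ e ≡ l *ℕ (ε′ *ℕ e)
  swap = ℕ-Solver.solve-∀
  unfold : ∀ l l′ W → l *ℕ (suc W *ℕ l′) ≡ l′ *ℕ (l *ℕ W) +ℕ l *ℕ l′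
  unfold = ℕ-Solver.solve-∀
  scaled : l′ *ℕ (ε *ℕ e +ℕ c) ≤ l′ *ℕ (l *ℕ W)
  scaled = ℕ.+-cancelʳ-≤ (l *ℕ l′) _ _ (ℕ.≤-trans (ℕ.≤-reflexive (expand l l′ ε e c))
    (ℕ.≤-trans (ℕ.+-monoʳ-≤ (ε *ℕ l′ *ℕ e) e-large) (ℕ.≤-trans (ℕ.≤-reflexive (collect (ε *ℕ l′) e))
    (ℕ.≤-trans (ℕ.*-monoˡ-≤ e slope) (ℕ.≤-trans (ℕ.≤-reflexive (swap l ε′ e))
    (ℕ.≤-trans (ℕ.*-monoʳ-≤ l (ℕ.<⇒≤ (<-suc-/* (ε′ *ℕ e) l′))) (ℕ.≤-reflexive (unfold l l′ W))))))))

module Strictness (em : ExcludedMiddle 0ℓ) {s : ℕ} (B : Factorisation s) (d : ℕ) (d≥1 : 1 ≤ d) where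
  open Factorisation B
  open LastDigits B
  open Classical em
  open Compactness em
  open Sequences em B d d≥1
  open Discontinuity em B d d≥1
  open Zooming em B d d≥1

  module _ {a : ℕ → ℕ} (𝓜 : Model a) {mult : Fin s → ℕ} (root : RationalRoot 𝓜 mult) (mult≥1 : ∀ i → 1 ≤ mult i) where
    open Model 𝓜
    open RationalRoot root

    power≋0 : ∀ {i} {x : ℤₚ (p i)} n → x ^ᶻ n ≋ ⌜ 0ℤ ⌝ → x ≋ ⌜ 0ℤ ⌝
    power≋0 {i} n h = ¬¬-elim λ x≉0 → let c , _ , ∤x = exact-valuation x≉0 in ∤-^ (prime i) ∤x n (≋0⇒∣ₚ h _)

    θ-root : ∀ i → H i (θ i) ≋ ⌜ 0ℤ ⌝
    θ-root i = ≋-trans (factors i (θ i)) (≋-trans (⊗-cong (zero-power (mult≥1 i)) ≋-refl) (Ring.zeroˡ (G i (θ i))))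
      where
      zero-power : ∀ {n} → 1 ≤ n → (θ i ⊖ θ i) ^ᶻ n ≋ ⌜ 0ℤ ⌝
      zero-power {suc n} _ = ≋-trans (⊗-cong (⊖-self (θ i)) ≋-refl) (Ring.zeroˡ _)

    unique-root : ∀ i x → H i x ≋ ⌜ 0ℤ ⌝ → x ≋ θ i
    unique-root i x h = ⊖≋0⇒≋ (power≋0 (mult i) (⊗≋0 (prime i) (proj₂ (≉0⇒∤ (G-rootless i x)))
      (≋-trans (Ring.*-comm (G i x) _) (≋-trans (≋-sym (factors i x)) h))))

    only-root : ∀ i → FiniteRoots (H i)
    only-root i = 1 , (λ _ → θ i) , λ x h → zero , unique-root i x h

    module _ {o o′ : Fin s} (o≢o′ : o ≢ o′) {m : ℕ} (m≥2 : 2 ≤ m) (kernel : FiniteKernel m a) where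

      private
        instance
          m≢0 : NonZero m
          m≢0 = ℕ.>-nonZero (ℕ.≤-trans (s≤s z≤n) m≥2)
        K : ℕ
        K = List.length (proj₁ kernel)

      opaque

        m-split : ∀ i → Split (p i) m
        m-split i = split (prime i) m

        cofactor-bound : ∃[ t ] (∀ i x → ¬ suc t ∣ₚ G i x)
        cofactor-bound = G-bound

      ε : Fin s → ℕ
      ε i = Split.v (m-split i)

      P : ℕ
      P = Π λ i → p i ^ℕ ε i

      -- Here θ is the only root, so `root-transfer` identifies the preimages of θ under both affine
      -- maps.
      common-centre : ∀ A .{{_ : NonZero A}} j A′ j′ (ω : ℤ_b) → (∀ n → a (A *ℕ n +ℕ j) ≡ a (A′ *ℕ n +ℕ j′)) →
                      (∀ i → affine A j (ω i) ≋ θ i) → ∀ i → affine A′ j′ (ω i) ≋ θ i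
      common-centre A j A′ j′ ω same centre i = unique-root i _ (root-transfer 𝓜 only-root o≢o′ A j A′ j′ same ω
        (λ i → ≋-trans (Lipschitz⇒≋ (lipschitz i) (centre i)) (θ-root i)) i)

      P∣m : P ℕ∣.∣ m
      P∣m = Π-∣ (λ i → p i ^ℕ ε i) (prime-power-coprime ε)
        λ i → subst (p i ^ℕ ε i ℕ∣.∣_) (sym (Split.factorises (m-split i))) (ℕ∣.m∣m*n _)

      -- Otherwise θ would have too many truncations to K digits in base m,
      -- because the part of m prime to b does not constrain them.
      cofactor-trivial : ∀ c → m ≡ c *ℕ P → ¬ 2 ≤ c
      cofactor-trivial c m≡cP c≥2 = refute (Fin.pigeonhole (ℕ.n<1+n K) λ q → kernel-class m≥2 a kernel K (j (toℕ q)) (j< (toℕ q)))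
        where
        A Q z : ℕ
        A = m ^ℕ K
        instance
          A≢0 : NonZero A
          A≢0 = m^≢0 m≥2 a kernel K
        -- Adding multiples of P^K to z keeps θ = m^K ω + j solvable and yields c^K residues j
        -- modulo m^K, which is more than the number K of classes because c ≥ 2.
        Q = P ^ℕ K
        z = proj₁ (approximate θ A)
        z≈θ : ∀ i → l i *ℕ A ∣ₚ nat z ⊖ θ i
        z≈θ = proj₂ (approximate θ A)
        j : ℕ → ℕ
        j q = (z +ℕ q *ℕ Q) ℕ.% A
        j< : ∀ q → j q < A
        j< q = ℕ.m%n<n (z +ℕ q *ℕ Q) A
        valuation-Q : ∀ i → Split.v (split (prime i) A) ∣ₚ nat {p i} Q
        valuation-Q i = ∣ₚ-exponent (split-unique (prime i) (power-split (prime i) (m-split i) K) (split (prime i) A))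
          (∣-nat-split (prime i) (power-split (prime i) (prime-power-product-split ε i) K))
        pre : ∀ q → Σ ℤ_b λ ω → ∀ i → affine A (j q) (ω i) ≋ θ i
        pre q = preimage-% A (z +ℕ q *ℕ Q) θ λ i → ∣ₚ-cong
          (≋-trans (solve 3 (λ θ z c → (θ :- z) :- c := θ :- (z :+ c)) ≋-refl (θ i) (nat z) (nat (q *ℕ Q)))
            (⊕-cong ≋-refl (⊝-cong (≋-sym (nat-+ z (q *ℕ Q))))))
          (∣ₚ-⊖ (∣ₚ-≤ (ℕ.≤-trans (split-v≤ (prime i) (split (prime i) A)) (n≤l*n i A)) (mod-sym (z≈θ i)))
            (∣ₚ-cong (≋-sym (nat-* q Q)) (∣ₚ-⊗ˡ (nat q) (valuation-Q i))))
        A≡ : A ≡ c ^ℕ K *ℕ Q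
        A≡ = trans (cong (_^ℕ K) m≡cP) (^-distribʳ-* c P K)
        j-injective : ∀ q t → j q ≡ j (q +ℕ t) → c ^ℕ K ℕ∣.∣ t
        j-injective q t eq = ℕ∣.*-cancelʳ-∣ Q {{ℕ.m^n≢0 P K {{Π-nonZero _ λ i → ℕ.m^n≢0 (p i) (ε i) {{prime⇒nonZero (prime i)}}}}}}
          (subst (ℕ∣._∣ t *ℕ Q) A≡ (%-≡⇒∣ (z +ℕ q *ℕ Q) (t *ℕ Q) A (trans eq (cong (ℕ._% A) (lem z q t Q)))))
          where
          lem : ∀ z q t Q → z +ℕ (q +ℕ t) *ℕ Q ≡ z +ℕ q *ℕ Q +ℕ t *ℕ Q
          lem = ℕ-Solver.solve-∀
        K<c^K : K < c ^ℕ K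
        K<c^K = ℕ.<-≤-trans (n<2^n K) (ℕ.^-monoˡ-≤ K c≥2)
          where
          n<2^n : ∀ n → n < 2 ^ℕ n
          n<2^n zero    = s≤s z≤n
          n<2^n (suc n) = ℕ.≤-<-trans (n<2^n n) (ℕ.^-monoʳ-< 2 (s≤s (s≤s z≤n)) (ℕ.n<1+n n))
        j-same : ∀ q q′ → kernel-class m≥2 a kernel K (j q) (j< q) ≡ kernel-class m≥2 a kernel K (j q′) (j< q′) → j q ≡ j q′
        j-same q q′ class≡ = nat-injective (prime o) (≋-trans (lem (nat A ⊗ proj₁ (pre q) o) (nat (j q)))
          (≋-trans (⊕-cong (≋-trans (proj₂ (pre q) o) (≋-sym (common-centre A (j q) A (j q′) (proj₁ (pre q))
              (kernel-class-≡ m≥2 a kernel K (j q) (j< q) K (j q′) (j< q′) class≡) (proj₂ (pre q)) o))) ≋-refl)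
            (≋-sym (lem (nat A ⊗ proj₁ (pre q) o) (nat (j q′))))))
          where
          lem : ∀ x y → y ≋ (x ⊕ y) ⊖ x
          lem = solve 2 (λ x y → y := (x :+ y) :- x) ≋-refl
        refute : ¬ (∃[ q ] ∃[ q′ ] (toℕ q < toℕ q′ × kernel-class m≥2 a kernel K (j (toℕ q)) (j< (toℕ q)) ≡
                                                     kernel-class m≥2 a kernel K (j (toℕ q′)) (j< (toℕ q′))))
        refute (q , q′ , q<q′ , class≡) = ℕ.<⇒≢ (ℕ.m<n⇒0<n∸m q<q′) (sym (small-multiple
          (ℕ.≤-<-trans (ℕ.m∸n≤m (toℕ q′) (toℕ q)) (ℕ.<-≤-trans (Fin.toℕ<n q′) K<c^K))
          (j-injective (toℕ q) (toℕ q′ ℕ.∸ toℕ q)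
            (trans (j-same (toℕ q) (toℕ q′) class≡) (cong j (sym (ℕ.m+[n∸m]≡n (ℕ.<⇒≤ q<q′))))))))

      private
        t₀ : ℕ
        t₀ = proj₁ cofactor-bound

      -- Since A x + j - θ = A (x - ω), the valuation for A = mᵉ is multᵢ (εᵢ e + ν(x - ω)) up to an
      -- error of at most t₀; the next two lemmas are the two bounds.
      H-at : ∀ i A j {ω x : ℤₚ (p i)} → affine A j ω ≋ θ i →
             H i (affine A j x) ≋ (nat A ⊗ (x ⊖ ω)) ^ᶻ mult i ⊗ G i (affine A j x)
      H-at i A j {ω} {x} centre = ≋-trans (factors i (affine A j x)) (⊗-cong (^ᶻ-cong (mult i)
        (≋-trans (⊕-cong ≋-refl (⊝-cong (≋-sym centre)))
          (solve 4 (λ A x ω j → (A :* x :+ j) :- (A :* ω :+ j) := A :* (x :- ω)) ≋-refl (nat A) x ω (nat j)))) ≋-refl)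

      H-∣ : ∀ i e j {α} {ω x : ℤₚ (p i)} → affine (m ^ℕ e) j ω ≋ θ i → α ∣ₚ x ⊖ ω →
            mult i *ℕ (ε i *ℕ e +ℕ α) ∣ₚ H i (affine (m ^ℕ e) j x)
      H-∣ i e j {x = x} centre α∣ = ∣ₚ-cong (≋-sym (H-at i (m ^ℕ e) j centre)) (∣ₚ-⊗ʳ (G i (affine (m ^ℕ e) j x))
        (∣ₚ-^ (∣ₚ-⊗ (∣-nat-split (prime i) (power-split (prime i) (m-split i) e)) α∣) (mult i)))

      H-∤ : ∀ i e j {α} {ω x : ℤₚ (p i)} → affine (m ^ℕ e) j ω ≋ θ i → ¬ suc α ∣ₚ x ⊖ ω →
            ¬ suc (mult i *ℕ (ε i *ℕ e +ℕ α) +ℕ t₀) ∣ₚ H i (affine (m ^ℕ e) j x)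
      H-∤ i e j {x = x} centre ∤α d∣ = ∤-⊗ (prime i) (∤-^ (prime i)
          (∤-⊗ (prime i) (∤-nat-split (prime i) (power-split (prime i) (m-split i) e)) ∤α) (mult i))
        (proj₂ cofactor-bound i (affine (m ^ℕ e) j x)) (∣ₚ-cong (H-at i (m ^ℕ e) j centre) d∣)

      -- At n, the o-th component of the digits vanishes after the e-fold zoom,
      -- but not after the e′-fold zoom.
      incompatible : ∀ {o o′} → o ≢ o′ → ∀ e j e′ j′ (ω : ℤ_b) →
        (∀ i → affine (m ^ℕ e) j (ω i) ≋ θ i) → (∀ i → affine (m ^ℕ e′) j′ (ω i) ≋ θ i) →
        ∀ {W α W′ n} → suc (mult o′ *ℕ (ε o′ *ℕ e +ℕ 0) +ℕ t₀) ≤ W → l o *ℕ (W +ℕ d) ≤ α →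
        suc (mult o *ℕ (ε o *ℕ e′ +ℕ α) +ℕ t₀) ≤ l o *ℕ W′ → l o′ *ℕ W′ ≤ mult o′ *ℕ (ε o′ *ℕ e′ +ℕ 0) →
        (∀ i → l i *ℕ ((W +ℕ d) +ℕ W′) ∣ₚ nat n ⊖ update o (ω o ⊕ nat (p o ^ℕ α)) (update o′ (ω o′ ⊕ ⌜ 1ℤ ⌝) ω) i) →
        a (m ^ℕ e *ℕ n +ℕ j) ≢ a (m ^ℕ e′ *ℕ n +ℕ j′)
      incompatible {o} {o′} o≢o′ e j e′ j′ ω centre centre′ {W} {α} {W′} {n} W≥ α≥ W′≥ W′≤ n≈ same =
        component-nonzero {W′} o
          (λ d∣ → H-∤ o e′ j′ (centre′ o) at-o-∤ (∣ₚ-≤ W′≥ (pull-back e′ j′ o at-o ≤W′ d∣)))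
          dominated (digits-affine 𝓜 (m ^ℕ e′) j′ n)
          (subst (λ y → l o *ℕ d ∣ₚ nat {p o} y) same (component-zero {W} o′ o
            (λ d∣ → H-∤ o′ e j (centre o′) at-o′-∤ (∣ₚ-≤ W≥ (∣ₚ-≤ (n≤l*n o′ W) (pull-back e j o′ at-o′ (≤W+d (ℕ.m≤m+n W d)) d∣))))
            (mod-∣ (H-mod 𝓜 (m ^ℕ e) j o (∣ₚ-≤ (ℕ.*-monoʳ-≤ (l o) (ℕ.m≤m+n (W +ℕ d) W′)) at-o))
              (∣ₚ-≤ (ℕ.≤-trans α≥ (ℕ.≤-trans (ℕ.m≤n+m α (ε o *ℕ e)) (ℕ.m≤n*m _ (mult o) {{ℕ.>-nonZero (mult≥1 o)}})))
                (H-∣ o e j (centre o) at-o-∣)))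
            (digits-affine 𝓜 (m ^ℕ e) j n)))
        where
        D : ℕ
        D = (W +ℕ d) +ℕ W′
        z₁ : ℤₚ (p o)
        -- The target point has distance p^-α from ω in coordinate o and distance 1 in coordinate
        -- o′. In every other coordinate it equals ω, where the function vanishes, so only o and o′
        -- compete for the minimum in ν_b.
        z₁ = ω o ⊕ nat (p o ^ℕ α)
        z₂ : ℤₚ (p o′)
        z₂ = ω o′ ⊕ ⌜ 1ℤ ⌝
        shift : ∀ {q} (x y : ℤₚ q) → (x ⊕ y) ⊖ x ≋ y
        shift = solve 2 (λ x y → (x :+ y) :- x := y) ≋-refl
        at-o : l o *ℕ D ∣ₚ nat n ⊖ z₁
        at-o = mod-congʳ (≡⇒≋ (update-same o z₁ _)) (n≈ o)
        at-o′ : l o′ *ℕ D ∣ₚ nat n ⊖ z₂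
        at-o′ = mod-congʳ (≡⇒≋ (trans (update-other (o≢o′ ∘ sym)) (update-same o′ z₂ ω))) (n≈ o′)
        elsewhere : ∀ i → i ≢ o → i ≢ o′ → l i *ℕ D ∣ₚ nat n ⊖ ω i
        elsewhere i i≢o i≢o′ = mod-congʳ (≡⇒≋ (trans (update-other i≢o) (update-other i≢o′))) (n≈ i)
        at-o-∣ : α ∣ₚ z₁ ⊖ ω o
        at-o-∣ = ∣ₚ-cong (≋-sym (shift (ω o) (nat (p o ^ℕ α)))) (nat-p^ α)
        at-o-∤ : ¬ suc α ∣ₚ z₁ ⊖ ω o
        at-o-∤ d∣ = nat-p^-∤ (prime o) α (∣ₚ-cong (shift (ω o) (nat (p o ^ℕ α))) d∣)
        at-o′-∤ : ¬ 1 ∣ₚ z₂ ⊖ ω o′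
        at-o′-∤ d∣ = ¬-∣1 (prime o′) (∣ₚ-cong (shift (ω o′) ⌜ 1ℤ ⌝) d∣)
        ≤W′ : W′ ≤ D
        ≤W′ = ℕ.m≤n+m W′ (W +ℕ d)
        ≤W+d : ∀ {V} → V ≤ W +ℕ d → V ≤ D
        ≤W+d le = ℕ.≤-trans le (ℕ.m≤m+n (W +ℕ d) W′)
        pull-back : ∀ e j i {V} {x : ℤₚ (p i)} → l i *ℕ D ∣ₚ nat n ⊖ x → V ≤ D →
                    l i *ℕ V ∣ₚ H i (affine (m ^ℕ e) j (nat n)) → l i *ℕ V ∣ₚ H i (affine (m ^ℕ e) j x)
        pull-back e j i near V≤D d∣ = mod-∣ (H-mod 𝓜 (m ^ℕ e) j i (mod-sym (∣ₚ-≤ (ℕ.*-monoʳ-≤ (l i) V≤D) near))) d∣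
        dominated : ∀ i → i ≢ o → l i *ℕ W′ ∣ₚ H i (affine (m ^ℕ e′) j′ (nat n))
        dominated i i≢o with i Fin.≟ o′
        ... | yes refl = mod-∣ (H-mod 𝓜 (m ^ℕ e′) j′ i (∣ₚ-≤ (ℕ.*-monoʳ-≤ (l i) ≤W′) at-o′))
          (∣ₚ-≤ W′≤ (H-∣ i e′ j′ (centre′ i) (∣ₚ-0 _)))
        ... | no i≢o′ = mod-∣ (H-mod 𝓜 (m ^ℕ e′) j′ i (∣ₚ-≤ (ℕ.*-monoʳ-≤ (l i) ≤W′) (elsewhere i i≢o i≢o′)))
          (≋0⇒∣ₚ (≋-trans (Lipschitz⇒≋ (lipschitz i) (centre′ i)) (θ-root i)) _)

      private
        module Z (e : ℕ) = Zoom (zoom m≥2 a kernel θ e)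

        class : ℕ → Fin K
        class e = kernel-class m≥2 a kernel e (Z.j e) (Z.j< e)

        class-same : ∀ e e′ → class e ≡ class e′ → ∀ n → a (m ^ℕ e *ℕ n +ℕ Z.j e) ≡ a (m ^ℕ e′ *ℕ n +ℕ Z.j e′)
        class-same e e′ = kernel-class-≡ m≥2 a kernel e (Z.j e) (Z.j< e) e′ (Z.j e′) (Z.j< e′)

      -- After an e-fold zoom the i-th valuation divided by lᵢ grows in e with slope multᵢ εᵢ / lᵢ.
      -- Fix e in an infinite class and a point at which o′ determines ν_b. If the slope of o is the
      -- smaller one, then for large e′ in the same class it is o that determines ν_b at this point,
      -- although the two kernel elements are equal.
      slopes-≮ : ∀ {o o′ : Fin s} → o ≢ o′ → ¬ mult o *ℕ ε o *ℕ l o′ < mult o′ *ℕ ε o′ *ℕ l o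
      slopes-≮ {o} {o′} o≢o′ slope = from-class (infinite-pigeonhole class)
        where
        from-class : ¬ (∃[ c ] (∀ N → ∃[ e ] (N ≤ e × class e ≡ c)))
        from-class (c , often) = at (proj₁ (often 0)) (proj₂ (proj₂ (often 0)))
          where
          at : ∀ e → class e ≡ c → ⊥
          at e e∈c = with-e′ (proj₁ (often bound)) (proj₁ (proj₂ (often bound))) (proj₂ (proj₂ (often bound)))
            where
            W α c₀ bound : ℕ
            -- After the e-fold zoom the o′-th component, taken at distance 1 from ω, has valuation
            -- below W, and α makes the o-th one divisible by b^(W+d) at p_o. The constant c₀
            -- collects the part of the o-th valuation that does not grow with e′, and `bound` is
            -- the threshold of `overtake`.
            W = suc (mult o′ *ℕ (ε o′ *ℕ e +ℕ 0) +ℕ t₀)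
            α = l o *ℕ (W +ℕ d)
            c₀ = suc (mult o *ℕ α +ℕ t₀)
            bound = l o *ℕ l o′ +ℕ l o′ *ℕ c₀
            with-e′ : ∀ e′ → bound ≤ e′ → class e′ ≡ c → ⊥
            with-e′ e′ e′-large e′∈c =
              let W′ , W′≥ , W′≤ = overtake (l o) (l o′) (mult o *ℕ ε o) (mult o′ *ℕ ε o′) c₀ e′ {{positive o′}} slope e′-large
                  n , n≈ = approximate (update o (Z.ω e o ⊕ nat (p o ^ℕ α)) (update o′ (Z.ω e o′ ⊕ ⌜ 1ℤ ⌝) (Z.ω e))) ((W +ℕ d) +ℕ W′)
                  same = class-same e e′ (trans e∈c (sym e′∈c))
              in incompatible o≢o′ e (Z.j e) e′ (Z.j e′) (Z.ω e) (Z.centre e)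
                   (common-centre (m ^ℕ e) {{m^≢0 m≥2 a kernel e}} (Z.j e) (m ^ℕ e′) (Z.j e′) (Z.ω e) same (Z.centre e))
                   ℕ.≤-refl ℕ.≤-refl (ℕ.≤-trans (ℕ.≤-reflexive (lem (mult o) (ε o) e′ α t₀)) W′≥)
                   (ℕ.≤-trans W′≤ (ℕ.≤-reflexive (lem′ (mult o′) (ε o′) e′))) n≈ (same n)
              where
              lem : ∀ μ ε e α t → suc (μ *ℕ (ε *ℕ e +ℕ α) +ℕ t) ≡ μ *ℕ ε *ℕ e +ℕ suc (μ *ℕ α +ℕ t)
              lem = ℕ-Solver.solve-∀
              lem′ : ∀ μ ε e → μ *ℕ ε *ℕ e ≡ μ *ℕ (ε *ℕ e +ℕ 0)
              lem′ = ℕ-Solver.solve-∀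

      slopes-≡ : ∀ i i′ → mult i *ℕ ε i *ℕ l i′ ≡ mult i′ *ℕ ε i′ *ℕ l i
      slopes-≡ i i′ with i Fin.≟ i′
      ... | yes refl = refl
      ... | no i≢i′ = ℕ.≤-antisym (ℕ.≮⇒≥ (slopes-≮ (i≢i′ ∘ sym))) (ℕ.≮⇒≥ (slopes-≮ i≢i′))

      m≡P : m ≡ P
      m≡P = exact P∣m
        where
        exact : P ℕ∣.∣ m → m ≡ P
        exact (ℕ∣.divides 0 m≡)             = contradiction m≡ (ℕ.≢-nonZero⁻¹ m)
        exact (ℕ∣.divides 1 m≡)             = trans m≡ (ℕ.*-identityˡ P)
        exact (ℕ∣.divides (suc (suc c)) m≡) = contradiction (s≤s (s≤s z≤n)) (cofactor-trivial (suc (suc c)) m≡)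

      -- Equal slopes and wᵢ multᵢ = M give lᵢ wᵢ (mult_r ε_r) = εᵢ (M l_r): the exponent vectors of
      -- k and m are proportional. An r with ε_r ≠ 0 exists because m = P ≥ 2.
      multiplicatively-dependent : (w : Fin s → ℕ) (M : ℕ) → (∀ i → 1 ≤ w i) → (∀ i → w i *ℕ mult i ≡ M) →
        ∃[ e ] ∃[ c ] (1 ≤ e × 1 ≤ c × Π (λ i → p i ^ℕ (l i *ℕ w i)) ^ℕ e ≡ m ^ℕ c)
      multiplicatively-dependent w M w≥1 w*mult≡M = at (¬∀⇒∃¬ λ ε≡0 →
          ℕ.<⇒≢ m≥2 (sym (trans m≡P (trans (Π-cong {s} λ i → cong (p i ^ℕ_) (ε≡0 i)) (Π-1 {s})))))
        where
        Π-1 : ∀ {n} → Π {n} (λ _ → 1) ≡ 1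
        Π-1 {zero}  = refl
        Π-1 {suc n} = trans (ℕ.*-identityˡ _) (Π-1 {n})
        at : ∃[ r ] (ε r ≢ 0) → ∃[ e ] ∃[ c ] (1 ≤ e × 1 ≤ c × Π (λ i → p i ^ℕ (l i *ℕ w i)) ^ℕ e ≡ m ^ℕ c)
        at (r , εr≢0) = mult r *ℕ ε r , M *ℕ l r , ℕ.*-mono-≤ (mult≥1 r) (ℕ.n≢0⇒n>0 εr≢0) ,
          ℕ.*-mono-≤ (subst (1 ≤_) (w*mult≡M r) (ℕ.*-mono-≤ (w≥1 r) (mult≥1 r))) (l≥1 r) ,
          trans (Π-^ (λ i → p i ^ℕ (l i *ℕ w i)) (mult r *ℕ ε r)) (trans (Π-cong exponents)
            (trans (sym (Π-^ (λ i → p i ^ℕ ε i) (M *ℕ l r))) (cong (_^ℕ (M *ℕ l r)) (sym m≡P))))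
          where
          exponents : ∀ i → (p i ^ℕ (l i *ℕ w i)) ^ℕ (mult r *ℕ ε r) ≡ (p i ^ℕ ε i) ^ℕ (M *ℕ l r)
          exponents i = trans (ℕ.^-*-assoc (p i) (l i *ℕ w i) (mult r *ℕ ε r)) (trans (cong (p i ^ℕ_)
              (trans (lem₁ (l i) (w i) (mult r *ℕ ε r)) (trans (cong (w i *ℕ_) (slopes-≡ r i))
                (trans (lem₂ (w i) (mult i) (ε i) (l r)) (cong (λ M → ε i *ℕ (M *ℕ l r)) (w*mult≡M i))))))
            (sym (ℕ.^-*-assoc (p i) (ε i) (M *ℕ l r))))
            where
            lem₁ : ∀ l w x → l *ℕ w *ℕ x ≡ w *ℕ (x *ℕ l)
            lem₁ = ℕ-Solver.solve-∀
            lem₂ : ∀ w μ ε l → w *ℕ (μ *ℕ ε *ℕ l) ≡ ε *ℕ (w *ℕ μ *ℕ l)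
            lem₂ = ℕ-Solver.solve-∀

-- Rational p-adic integers

module _ {p : ℕ} (pr : Prime p) where

  private
    cleared : ∀ {R P θ u v : ℤₚ p} → R ⊗ v ≋ P → θ ⊗ P ≋ u ⊗ R → (v ⊗ θ) ⊗ P ≋ u ⊗ P
    cleared {R} {P} {θ} {u} {v} h eq = ≋-trans (solve 3 (λ v θ P → (v :* θ) :* P := v :* (θ :* P)) ≋-refl v θ P)
      (≋-trans (⊗-cong ≋-refl eq) (≋-trans (solve 3 (λ v u R → v :* (u :* R) := u :* (R :* v)) ≋-refl v u R) (⊗-cong ≋-refl h)))

    uncleared : ∀ {R P θ u v : ℤₚ p} → R ⊗ v ≋ P → v ⊗ θ ≋ u → v ⊗ (θ ⊗ P) ≋ v ⊗ (u ⊗ R)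
    uncleared {R} {P} {θ} {u} {v} h eq = ≋-trans (≋-sym (Ring.*-assoc v θ P)) (≋-trans (⊗-cong eq (≋-sym h))
      (solve 3 (λ v u R → u :* (R :* v) := v :* (u :* R)) ≋-refl v u R))

    num-fromℚ : ∀ q → num (fromℚ pr q) ≋ ⌜ ↥ q ⌝ ⊗ num (recip pr (↧ₙ q))
    num-fromℚ q = ≋-trans (num-* (ι (fromℤ (↥ q))) (recip pr (↧ₙ q))) (⊗-cong (fromℤ≋⌜⌝ (↥ q)) ≋-refl)

  fromℚ⇒denominator : ∀ q θ → ι θ ≈ fromℚ pr q → nat (↧ₙ q) ⊗ θ ≋ ⌜ ↥ q ⌝
  fromℚ⇒denominator q θ eq = ⊗-cancelˡ pr (nat-p^-∤ pr (expo (recip pr (↧ₙ q))))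
    (≋-trans (Ring.*-comm _ _) (≋-trans (cleared (recip-spec pr (↧ₙ q))
      (≋-trans (≈⇒≋ (ι θ) (fromℚ pr q) eq) (≋-trans (Ring.*-identityʳ _) (num-fromℚ q)))) (Ring.*-comm _ _)))

  denominator⇒fromℚ : ∀ q θ → nat (↧ₙ q) ⊗ θ ≋ ⌜ ↥ q ⌝ → ι θ ≈ fromℚ pr q
  denominator⇒fromℚ q θ eq = ≋⇒≈ (ι θ) (fromℚ pr q)
    (≋-trans (nat-cancel pr (↧ₙ q) (uncleared (recip-spec pr (↧ₙ q)) eq))
      (≋-trans (≋-sym (num-fromℚ q)) (≋-sym (Ring.*-identityʳ _))))

  -- As θ is integral, a prime p dividing the denominator would divide the numerator as well, but q
  -- is in lowest terms.
  denominator-unit : ∀ q (θ : ℤₚ p) → nat (↧ₙ q) ⊗ θ ≋ ⌜ ↥ q ⌝ → ¬ p ℕ∣.∣ ↧ₙ q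
  denominator-unit (mkℚ n d-1 cop) θ eq p∣v = ℕ.<⇒≢ (ℕ.nonTrivial⇒n>1 p {{prime⇒nonTrivial pr}})
    (sym (Coprimality.recompute cop (subst (ℕ∣._∣ ℤ.∣ n ∣) (ℕ.*-identityʳ p) (∣⇒∣ᵤ (∣ₚ-⌜⌝⁻¹ {p} {1} 1∣n)) , p∣v)))
    where
    1∣n : 1 ∣ₚ ⌜_⌝ {p} n
    1∣n = ∣ₚ-cong eq (∣ₚ-⊗ʳ θ (nat-∣ₚ {p} {1} {suc d-1} (subst (ℕ∣._∣ suc d-1) (sym (ℕ.*-identityʳ p)) p∣v)))

  reduce-fraction : ∀ u v .{{_ : NonZero v}} (θ : ℤₚ p) → nat v ⊗ θ ≋ ⌜ u ⌝ → nat (↧ₙ (u ℚ./ v)) ⊗ θ ≋ ⌜ ↥ (u ℚ./ v) ⌝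
  reduce-fraction u v θ eq = nat-cancel pr g {{g≢0}} (≋-trans
      (solve 3 (λ g v θ → g :* (v :* θ) := (v :* g) :* θ) ≋-refl (nat g) (nat (↧ₙ (u ℚ./ v))) θ)
      (≋-trans (⊗-cong (≋-trans (≋-sym (⌜⌝-* (ℚ.↧ (u ℚ./ v)) (+ g))) (≡⇒≋ (cong ⌜_⌝ (ℚ.↧-/ u v)))) ≋-refl)
      (≋-trans eq (≋-trans (≡⇒≋ (cong ⌜_⌝ (sym (ℚ.↥-/ u v)))) (≋-trans (⌜⌝-* (↥ (u ℚ./ v)) (+ g)) (Ring.*-comm _ _))))))
    where
    g : ℕ
    g = ℤ.∣ ℤ.gcd u (+ v) ∣
    g≢0 : NonZero g
    g≢0 = ℕ.≢-nonZero λ g≡0 → ℕ.≢-nonZero⁻¹ v (ℤ.+-injective (trans (sym (ℚ.↧-/ u v))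
      (trans (cong (λ t → ℚ.↧ (u ℚ./ v) ℤ.* t) (ℤ.∣i∣≡0⇒i≡0 g≡0)) (ℤ.*-zeroʳ (ℚ.↧ (u ℚ./ v))))))

-- Families of analytic functions

module AnalyticFamily (em : ExcludedMiddle 0ℓ) {s : ℕ} (s≥2 : 2 ≤ s) (B : Factorisation s)
  (f : ∀ i → ℤₚ (Factorisation.p B i) → ℚₚ (Factorisation.p B i)) (analytic : ∀ i → Analytic (f i))
  (f≢0 : ∀ i → ¬ (∀ x → f i x ≈ 0#)) where

  open Factorisation B
  open LastDigits B
  open Classical em
  open Compactness em
  open Kernel em

  opaque

    sequence : ℕ → ℕ → ℕ
    sequence d n = ℓ em d (λ i → f i (fromℕ n))

    sequence≡ℓ : sequence ≡ (λ d n → ℓ em d (λ i → f i (fromℕ n)))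
    sequence≡ℓ = refl

    sequence-digits : ∀ {d h} n → LastDigits d h (ℓ em d (λ i → f i (fromℕ n))) → LastDigits d h (sequence d n)
    sequence-digits n digits = digits

  other-index : ∀ (k : Fin s) → ∃[ o ] o ≢ k
  other-index k = distinct-from s≥2 k
    where
    distinct-from : ∀ {n} → 2 ≤ n → (k : Fin n) → ∃[ o ] o ≢ k
    distinct-from (s≤s (s≤s _)) zero    = suc zero , λ ()
    distinct-from (s≤s (s≤s _)) (suc k) = zero , λ ()

  o₁ : Fin s
  o₁ = Fin.fromℕ< {0} (ℕ.≤-trans (s≤s z≤n) s≥2)

  opaque

    integral : ∀ i → IntegralSeries (f i)
    integral i = integral-series (prime i) (analytic i)

  series : ∀ i → Series (p i)
  series i = IntegralSeries.series (integral i)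

  denominator : Fin s → ℕ
  denominator i = IntegralSeries.denominator (integral i)

  represented : ∀ i x → Represents (f i x) (eval (series i) x) (denominator i)
  represented i = IntegralSeries.represented (integral i)

  root⇒eval≋0 : ∀ i x → Root (f i) x → eval (series i) x ≋ ⌜ 0ℤ ⌝
  root⇒eval≋0 i x = root⇒≋0 (prime i) (represented i x)

  eval≋0⇒root : ∀ i x → eval (series i) x ≋ ⌜ 0ℤ ⌝ → Root (f i) x
  eval≋0⇒root i x = ≋0⇒root (prime i) (represented i x)

  opaque

    factorisation : ∀ i → RootFactorisation (eval (series i))
    factorisation i = root-factorisation em (series i) λ h → f≢0 i λ x → eval≋0⇒root i x (h x)

  opaque

    complement : ∀ {E e} i → e ≤ E → ∃[ c ] c *ℕ p i ^ℕ e ≡ b ^ℕ E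
    complement {E} {e} i e≤E = ℕ∣._∣_.quotient divides-b , sym (ℕ∣._∣_.equality divides-b)
      where
      divides-b : p i ^ℕ e ℕ∣.∣ b ^ℕ E
      divides-b = ℕ∣.∣-trans (^-∣-^ (p i) (ℕ.≤-trans e≤E (ℕ.m≤n*m E (l i) {{positive i}})))
        (subst (p i ^ℕ (l i *ℕ E) ℕ∣.∣_) (sym (Split.factorises (b-power-split E i))) (ℕ∣.m∣m*n _))

  complement-≋ : ∀ {c e E} i → c *ℕ p i ^ℕ e ≡ b ^ℕ E → nat {p i} c ⊗ nat (p i ^ℕ e) ≋ nat (b ^ℕ E)
  complement-≋ {c} {e} i eq = ≋-trans (≋-sym (nat-* c (p i ^ℕ e))) (≡⇒≋ (cong nat eq))

  complement-nonZero : ∀ {c e E} i → c *ℕ p i ^ℕ e ≡ b ^ℕ E → NonZero c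
  complement-nonZero {E = E} i eq = ℕ.≢-nonZero λ { refl → ℕ.≢-nonZero⁻¹ (b ^ℕ E) {{b^≢0 E}} (sym eq) }

  scale : ∀ i (c : ℕ) → Series (p i) → ℤₚ (p i) → ℤₚ (p i)
  scale i c A x = nat c ⊗ eval A x

  scale-lipschitz : ∀ i c A → Lipschitz (scale i c A)
  scale-lipschitz i c A h = mod-⊗ mod-refl (eval-lipschitz A h)

  -- H below is b^E f.
  module Integral (d : ℕ) (d≥1 : 1 ≤ d) (E : ℕ) (E-large : ∀ i → denominator i ≤ E) where
    open Sequences em B d d≥1

    c : Fin s → ℕ
    c i = proj₁ (complement i (E-large i))

    c-spec : ∀ i → c i *ℕ p i ^ℕ denominator i ≡ b ^ℕ E
    c-spec i = proj₂ (complement i (E-large i))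

    instance
      c≢0 : ∀ {i} → NonZero (c i)
      c≢0 {i} = complement-nonZero {c i} {denominator i} {E} i (c-spec i)

    H : ∀ i → ℤₚ (p i) → ℤₚ (p i)
    H i = scale i (c i) (series i)

    scaled : ∀ i x → num (f i x) ⊗ nat (b ^ℕ E) ≋ H i x ⊗ nat (p i ^ℕ expo (f i x))
    scaled i x = ≋-trans (⊗-cong ≋-refl (≋-sym (complement-≋ {c i} {denominator i} {E} i (c-spec i))))
      (≋-trans (solve 3 (λ n c P → n :* (c :* P) := c :* (n :* P)) ≋-refl (num (f i x)) (nat (c i)) (nat (p i ^ℕ denominator i)))
      (≋-trans (⊗-cong ≋-refl (Represents.cross (represented i x))) (≋-sym (Ring.*-assoc _ _ _))))

    model : Model (sequence d)
    model = record
      { H = H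
      ; lipschitz = λ i → scale-lipschitz i (c i) (series i)
      ; digits = λ n → lastDigits-cong (λ i → Lipschitz⇒≋ (scale-lipschitz i (c i) (series i)) (fromℤ≋⌜⌝ (+ n)))
          (sequence-digits n (Bridge.ℓ-lastDigits em B E (λ i → f i (fromℕ n)) (λ i → H i (fromℕ n)) (λ i → scaled i (fromℕ n)) d))
      }

    root⇒H≋0 : ∀ i x → Root (f i) x → H i x ≋ ⌜ 0ℤ ⌝
    root⇒H≋0 i x r = ≋-trans (⊗-cong ≋-refl (root⇒eval≋0 i x r)) (⊗0 (nat (c i)))

    H≋0⇒root : ∀ i x → H i x ≋ ⌜ 0ℤ ⌝ → Root (f i) x
    H≋0⇒root i x h = eval≋0⇒root i x (⊗≋0 (prime i) (proj₂ (nat-≢0 (prime i) (c i))) h)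

    finiteRoots : ∀ i → FiniteRoots (H i)
    finiteRoots i = let r , root , find = finite-roots (prime i) (factorisation i)
      in r , root , λ x h → find x (⊗≋0 (prime i) (proj₂ (nat-≢0 (prime i) (c i))) h)

  module _ (d : ℕ) (d≥1 : 1 ≤ d) where

    private
      E : ℕ
      E = proj₁ (upper-bound denominator)
      module I = Integral d d≥1 E (proj₂ (upper-bound denominator))
    open Discontinuity em B d d≥1 using (update; update-same; update-other)

    Roots-≋ : ∀ {x y : ℤ_b} → (∀ i → x i ≋ y i) → Roots f x → Roots f y
    Roots-≋ {x} {y} eq h i = eval≋0⇒root i (y i) (≋-trans (eval-≋ (series i) (≋-sym (eq i))) (root⇒eval≋0 i (x i) (h i)))

    Roots-update : ∀ {θ : ℤ_b} → Roots f θ → ∀ i x → Root (f i) x → Roots f (update i x θ)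
    Roots-update {θ} h i x r k with k Fin.≟ i
    ... | yes refl = subst (Root (f k)) (sym (update-same k x θ)) r
    ... | no  k≢i  = subst (Root (f k)) (sym (update-other k≢i)) (h k)

    -- The set of common roots is a product: putting x in place of θᵢ gives another common root,
    -- which must be θ.
    component-unique : ∀ (θ : ℤ_b) → Roots f ≐ (θ ≈b_) → ∀ i x → Root (f i) x → x ≋ θ i
    component-unique θ (⊆ , ⊇) i x r = ≋-sym (subst (θ i ≋_) (update-same i x θ)
      (≈ᶻ⇒≋ (⊆ (Roots-update (⊇ λ i → ≋⇒≈ᶻ (≋-refl {x = θ i})) i x r) i)))

    no-roots⇒periodic : Empty (Roots f) → ∃[ t ] IsPeriod (b ^ℕ t) (sequence d)
    no-roots⇒periodic empty = Sequences.rootless⇒periodic em B d d≥1 I.model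
        -- A product can be empty only if one of its factors is; excluded middle provides the index.
        (let i , none = ¬∀⇒∃¬ {P = λ i → ∃[ x ] Root (f i) x} (λ h → empty (proj₁ ∘ h) (proj₂ ∘ h))
         in i , λ x h → none (x , I.H≋0⇒root i x h))

    private
      K : (Fin s → ℕ) → ℕ
      K w = Π (λ i → bᵢ i ^ℕ w i)

      K≡ : ∀ w → Π (λ i → p i ^ℕ (l i *ℕ w i)) ≡ K w
      K≡ w = Π-cong λ i → sym (ℕ.^-*-assoc (p i) (l i) (w i))

    K≥2 : ∀ w → (∀ i → 1 ≤ w i) → 2 ≤ K w
    K≥2 w w≥1 = ℕ.≤-trans (ℕ.nonTrivial⇒n>1 (p o₁) {{prime⇒nonTrivial (prime o₁)}})
      (ℕ∣.∣⇒≤ {{Π-nonZero _ λ i → ℕ.m^n≢0 (bᵢ i) (w i) {{ℕ.m^n≢0 (p i) (l i) {{prime⇒nonZero (prime i)}}}}}}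
        (ℕ∣.∣-trans (∣-power (positive-power (l≥1 o₁))) (ℕ∣.∣-trans (∣-power (positive-power (w≥1 o₁))) (∣Π (λ i → bᵢ i ^ℕ w i) o₁))))
      where
      positive-power : ∀ {n} → 1 ≤ n → NonZero n
      positive-power = ℕ.>-nonZero
      ∣-power : ∀ {x n} → NonZero n → x ℕ∣.∣ x ^ℕ n
      ∣-power {n = suc n} _ = ℕ∣.m∣m*n _

    opaque

      multiplicity-series : ∀ i (θ : ℤₚ (p i)) m → IsMultiplicity (f i) θ m → Σ (Series (p i)) λ C → ∃[ e ]
        ((¬ eval C θ ≋ ⌜ 0ℤ ⌝) × (∀ x → nat (p i ^ℕ e) ⊗ eval (series i) x ≋ nat (p i ^ℕ denominator i) ⊗ ((x ⊖ θ) ^ᶻ m ⊗ eval C x)))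
      multiplicity-series i θ m (g , g-analytic , gθ≉0 , f≈) = IntegralSeries.series G , IntegralSeries.denominator G ,
          (λ h → gθ≉0 (≋0⇒root (prime i) (IntegralSeries.represented G θ) h)) ,
          λ x → power-factor⇒ (prime i) θ x (f i x) (g x) m (f≈ x) (represented i x) (IntegralSeries.represented G x)
        where
        G : IntegralSeries g
        G = integral-series (prime i) g-analytic

    opaque

      rational-root : ∀ (θ : ℤ_b) (m : Fin s → ℕ) → Rational θ → Roots f ≐ (θ ≈b_) → (∀ i → IsMultiplicity (f i) (θ i) (m i)) →
                      Σ (Sequences.Model em B d d≥1 (sequence d)) λ 𝓜 → Σ (Sequences.RationalRoot em B d d≥1 𝓜 m) λ R →
                        ∀ i → 1 ≤ m i
      rational-root θ m (q , θ≈q) roots multiplicity = J.model , R , m≥1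
        where
        cofactor : ∀ i → Σ (Series (p i)) λ C → ∃[ e ] ((¬ eval C (θ i) ≋ ⌜ 0ℤ ⌝) ×
          (∀ x → nat (p i ^ℕ e) ⊗ eval (series i) x ≋ nat (p i ^ℕ denominator i) ⊗ ((x ⊖ θ i) ^ᶻ m i ⊗ eval C x)))
        cofactor i = multiplicity-series i (θ i) (m i) (multiplicity i)
        C : ∀ i → Series (p i)
        C i = proj₁ (cofactor i)
        e′ : Fin s → ℕ
        e′ i = proj₁ (proj₂ (cofactor i))
        bound : ∃[ F ] (∀ i → denominator i ≤ F)
        bound = upper-bound denominator
        bound′ : ∃[ F ] (∀ i → e′ i ≤ F)
        bound′ = upper-bound e′
        F : ℕ
        -- One exponent clears the denominators of all fᵢ and of their cofactors, so that fᵢ = (x -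
        -- θᵢ)^mᵢ gᵢ becomes an identity over ℤₚ after scaling by b^F.
        F = proj₁ bound ℕ.⊔ proj₁ bound′
        module J = Integral d d≥1 F (λ i → ℕ.≤-trans (proj₂ bound i) (ℕ.m≤m⊔n (proj₁ bound) (proj₁ bound′)))
        c′-exists : ∀ i → ∃[ c ] c *ℕ p i ^ℕ e′ i ≡ b ^ℕ F
        c′-exists i = complement i (ℕ.≤-trans (proj₂ bound′ i) (ℕ.m≤n⊔m (proj₁ bound) (proj₁ bound′)))
        c′ : Fin s → ℕ
        c′ i = proj₁ (c′-exists i)
        θ-denominator : ∀ i → nat (↧ₙ q) ⊗ θ i ≋ ⌜ ↥ q ⌝
        θ-denominator i = fromℚ⇒denominator (prime i) q (θ i) (θ≈q i)
        factors : ∀ i x → J.H i x ≋ (x ⊖ θ i) ^ᶻ m i ⊗ scale i (c′ i) (C i) x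
        factors i x = ⊗-cancelˡ (prime i) (nat-p^-∤ (prime i) (e′ i)) (⊗-cancelˡ (prime i) (nat-p^-∤ (prime i) (denominator i))
          (≋-trans (solve 4 (λ P Q c a → P :* (Q :* (c :* a)) := (c :* P) :* (Q :* a)) ≋-refl Pe Pe′ (nat (J.c i)) (eval (series i) x))
          (≋-trans (⊗-cong (≋-trans (complement-≋ {J.c i} {denominator i} {F} i (J.c-spec i))
            (≋-sym (complement-≋ {c′ i} {e′ i} {F} i (proj₂ (c′-exists i))))) (proj₂ (proj₂ (proj₂ (cofactor i))) x))
            (solve 5 (λ P Q c y a → (c :* Q) :* (P :* (y :* a)) := P :* (Q :* (y :* (c :* a)))) ≋-refl
              Pe Pe′ (nat (c′ i)) ((x ⊖ θ i) ^ᶻ m i) (eval (C i) x)))))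
          where
          Pe Pe′ : ℤₚ (p i)
          Pe = nat (p i ^ℕ denominator i)
          Pe′ = nat (p i ^ℕ e′ i)
        G-rootless : ∀ i x → ¬ scale i (c′ i) (C i) x ≋ ⌜ 0ℤ ⌝
        -- A root of the cofactor is a root of fᵢ, hence equals θᵢ, where the cofactor is nonzero by
        -- the definition of multiplicity.
        G-rootless i x h = proj₁ (proj₂ (proj₂ (cofactor i))) (≋-trans (eval-≋ (C i) (≋-sym x≋θ)) C≋0)
          where
          C≋0 : eval (C i) x ≋ ⌜ 0ℤ ⌝
          C≋0 = ⊗≋0 (prime i) (proj₂ (nat-≢0 (prime i) (c′ i) {{complement-nonZero {c′ i} {e′ i} {F} i (proj₂ (c′-exists i))}})) h
          x≋θ : x ≋ θ i
          x≋θ = component-unique θ roots i x (J.H≋0⇒root i x (≋-trans (factors i x) (≋-trans (⊗-cong ≋-refl h) (⊗0 _))))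
        R : Sequences.RationalRoot em B d d≥1 J.model m
        R = record
          { u = ↥ q ; v = ↧ₙ q ; v-unit = λ i → denominator-unit (prime i) q (θ i) (θ-denominator i) ; θ = θ ; v*θ = θ-denominator
          ; G = λ i → scale i (c′ i) (C i) ; G-lipschitz = λ i → scale-lipschitz i (c′ i) (C i) ; G-rootless = G-rootless ; factors = factors }
        m≥1 : ∀ i → 1 ≤ m i
        m≥1 i = ℕ.n≢0⇒n>0 λ m≡0 → G-rootless i (θ i) (≋-trans (≋-sym (Ring.*-identityˡ _))
          (≋-trans (⊗-cong (≡⇒≋ (sym (cong ((θ i ⊖ θ i) ^ᶻ_) m≡0))) ≋-refl) (≋-trans (≋-sym (factors i (θ i)))
            (J.root⇒H≋0 i (θ i) (proj₂ roots {θ} (λ j → ≋⇒≈ᶻ (≋-refl {x = θ j})) i)))))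

    rational-root⇒strictly-automatic : ∀ (θ : ℤ_b) → Rational θ → Roots f ≐ (θ ≈b_) →
      (m : Fin s → ℕ) → (∀ i → IsMultiplicity (f i) (θ i) (m i)) →
      (w : Fin s → ℕ) → (∀ i → 1 ≤ w i) → (∀ i j → w i *ℕ m i ≡ w j *ℕ m j) → StrictlyAutomatic (Π (λ i → bᵢ i ^ℕ w i)) (sequence d)
    rational-root⇒strictly-automatic θ rational roots m multiplicity w w≥1 w*m =
      let 𝓜 , R , m≥1 = rational-root θ m rational roots multiplicity
          M = w o₁ *ℕ m o₁
          o , o≢o₁ = other-index o₁
      in (K≥2 w w≥1 , subst (λ k → FiniteKernel k (sequence d)) (K≡ w)
            (AutomaticAtRoot.automatic-at-root em B d d≥1 𝓜 R w M λ i → w*m i o₁)) ,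
         λ k k≥2 independent (_ , kernel) →
           let e , c , e≥1 , c≥1 , eq = Strictness.multiplicatively-dependent em B d d≥1 𝓜 R m≥1 o≢o₁ k≥2 kernel w M w≥1 (λ i → w*m i o₁)
           in independent e c e≥1 c≥1 (trans (cong (_^ℕ e) (sym (K≡ w))) eq)

    automatic⇒unique-rational-root : ¬ Empty (Roots f) → Automatic (sequence d) → ∃[ θ ] (Rational θ × Roots f ≐ (θ ≈b_))
    automatic⇒unique-rational-root nonempty (k , k≥2 , kernel) = unique (¬¬-elim λ none → nonempty λ x r → none (x , r))
      where
      ratio : ∀ (θ : ℤ_b) → Roots f θ → ∃[ v ] ∃[ u ] (NonZero v × (∀ i → nat {p i} v ⊗ θ i ≋ ⌜ u ⌝))
      ratio θ r = Zooming.automatic⇒rational em B d d≥1 k≥2 (sequence d) kernel I.model I.finiteRoots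
        (proj₂ (other-index o₁)) θ λ i → I.root⇒H≋0 i (θ i) (r i)
      unique : ∃[ θ ] Roots f θ → ∃[ θ ] (Rational θ × Roots f ≐ (θ ≈b_))
      unique (θ , r) = θ , (u ℚ./ v , λ i → denominator⇒fromℚ (prime i) (u ℚ./ v) (θ i) (reduce-fraction (prime i) u v (θ i) (v*θ i))) ,
          (λ {x} → only {x}) , λ {x} eq → Roots-≋ (λ i → ≈ᶻ⇒≋ (eq i)) r
        where
        v : ℕ
        v = proj₁ (ratio θ r)
        u : ℤ
        u = proj₁ (proj₂ (ratio θ r))
        instance
          v≢0 : NonZero v
          v≢0 = proj₁ (proj₂ (proj₂ (ratio θ r)))
        v*θ : ∀ i → nat v ⊗ θ i ≋ ⌜ u ⌝
        v*θ = proj₂ (proj₂ (proj₂ (ratio θ r)))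
        -- Replacing only the i-th component of θ by a root x of fᵢ gives a
        -- rational element too, equal to θ at any other component.
        only : ∀ {x} → Roots f x → θ ≈b x
        only {x} rx i = ≋⇒≈ᶻ (same (ratio y (Roots-update r i (x i) (rx i))))
          where
          y : ℤ_b
          y = update i (x i) θ
          o = other-index i
          same : ∃[ v′ ] ∃[ u′ ] (NonZero v′ × (∀ j → nat {p j} v′ ⊗ y j ≋ ⌜ u′ ⌝)) → θ i ≋ x i
          same (v′ , u′ , v′≢0 , v′*y) = nat-cancel (prime i) v (nat-cancel (prime i) v′ {{v′≢0}}
            (≋-trans (⊗-cong ≋-refl (v*θ i)) (≋-trans (≋-sym (⌜⌝-* (+ v′) u)) (≋-trans (≡⇒≋ (cong ⌜_⌝ numerators))
              (≋-trans (⌜⌝-* (+ v) u′) (≋-trans (⊗-cong ≋-refl (≋-trans (≋-sym (v′*y i)) (⊗-cong ≋-refl (≡⇒≋ (update-same i (x i) θ)))))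
                (solve 3 (λ v v′ x → v :* (v′ :* x) := v′ :* (v :* x)) ≋-refl (nat v) (nat v′) (x i))))))))
            where
            j : Fin s
            j = proj₁ o
            numerators : + v′ ℤ.* u ≡ + v ℤ.* u′
            numerators = ⌜⌝-injective (prime j) (≋-trans (⌜⌝-* (+ v′) u) (≋-trans (⊗-cong ≋-refl (≋-sym (v*θ j)))
              (≋-trans (solve 3 (λ v v′ x → v′ :* (v :* x) := v :* (v′ :* x)) ≋-refl (nat v) (nat v′) (θ j))
              (≋-trans (⊗-cong ≋-refl (≋-trans (⊗-cong ≋-refl (≡⇒≋ (sym (update-other (proj₂ o))))) (v′*y j))) (≋-sym (⌜⌝-* (+ v) u′))))))

  linearProduct-vanishes : ∀ {q r} (root : Fin r → ℤₚ q) j → linearProduct root (root j) ≋ ⌜ 0ℤ ⌝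
  linearProduct-vanishes root zero    = ≋-trans (⊗-cong (⊖-self (root zero)) ≋-refl) (Ring.zeroˡ _)
  linearProduct-vanishes root (suc j) = ≋-trans (⊗-cong ≋-refl (linearProduct-vanishes (root ∘ suc) j)) (⊗0 _)

  linearProduct-power : ∀ {q r} (root : Fin r → ℤₚ q) θ → (∀ j → root j ≋ θ) → ∀ x → linearProduct root x ≋ (x ⊖ θ) ^ᶻ r
  linearProduct-power {r = zero}  root θ h x = ≋-refl
  linearProduct-power {r = suc r} root θ h x =
    ⊗-cong (⊕-cong ≋-refl (⊝-cong (h zero))) (linearProduct-power (root ∘ suc) θ (h ∘ suc) x)

  opaque

    -- As θ is the only common root, each entry of `root` equals θᵢ, and the number of entries is
    -- the multiplicity.
    multiplicity-exists : ∀ (θ : ℤ_b) → Roots f ≐ (θ ≈b_) → ∀ i → ∃[ m ] IsMultiplicity (f i) (θ i) m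
    multiplicity-exists θ roots i = count , g , analytic-series (prime i) cofactor (denominator i) ,
        (λ h → rootless (θ i) (root⇒≋0 (prime i) (represents-/p^ (eval cofactor (θ i)) (denominator i)) h)) ,
        λ x → ⇒power-factor (prime i) (θ i) x (f i x) (g x) count
          (represents-cong (≋-trans (factors x) (⊗-cong (linearProduct-power root (θ i) root≋θ x) ≋-refl)) (represented i x))
          (represents-/p^ (eval cofactor x) (denominator i))
      where
      open RootFactorisation (factorisation i)
      g : ℤₚ (p i) → ℚₚ (p i)
      g x = eval cofactor x /p^ denominator i
      root≋θ : ∀ j → root j ≋ θ i
      root≋θ j = component-unique 1 ℕ.≤-refl θ roots i (root j) (eval≋0⇒root i (root j)
        (≋-trans (factors (root j)) (≋-trans (⊗-cong (linearProduct-vanishes root j) ≋-refl) (Ring.zeroˡ _))))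

  opaque

    multiplicities : ∀ (θ : ℤ_b) → Roots f ≐ (θ ≈b_) → Σ (Fin s → ℕ) λ m → ∀ i → IsMultiplicity (f i) (θ i) (m i)
    multiplicities θ roots = (λ i → proj₁ (multiplicity-exists θ roots i)) , λ i → proj₂ (multiplicity-exists θ roots i)

  balancing-exponents : ∀ (m : Fin s → ℕ) → (∀ i → 1 ≤ m i) →
                        Σ (Fin s → ℕ) λ w → (∀ i → 1 ≤ w i) × (∀ i j → w i *ℕ m i ≡ w j *ℕ m j)
  balancing-exponents m m≥1 = w , w≥1 , λ i j → trans (w*m i) (sym (w*m j))
    where
    w : Fin s → ℕ
    w i = proj₁ (Π-remove m i)
    w*m : ∀ i → w i *ℕ m i ≡ Π m
    w*m i = trans (ℕ.*-comm (w i) (m i)) (sym (proj₁ (proj₂ (Π-remove m i))))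
    w≥1 : ∀ i → 1 ≤ w i
    w≥1 i = ℕ.n≢0⇒n>0 λ w≡0 → ℕ.≢-nonZero⁻¹ (Π m) {{Π-nonZero m λ j → ℕ.>-nonZero (m≥1 j)}}
      (trans (sym (w*m i)) (cong (_*ℕ m i) w≡0))

  opaque

    -- The base is built from the multiplicities alone, so it is the same for all d; the comparison
    -- of d with d′ rests on this.
    rational-root⇒strict-base : ∃[ θ ] (Rational θ × Roots f ≐ (θ ≈b_)) →
                                ∃[ K ] (∀ d → 1 ≤ d → StrictlyAutomatic K (sequence d))
    rational-root⇒strict-base (θ , rational , roots) =
      let m , multiplicity = multiplicities θ roots
          w , w≥1 , balanced = balancing-exponents m (proj₂ (proj₂ (rational-root 1 ℕ.≤-refl θ m rational roots multiplicity)))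
      in Π (λ i → bᵢ i ^ℕ w i) , λ d d≥1 → rational-root⇒strictly-automatic d d≥1 θ rational roots m multiplicity w w≥1 balanced

-- Strict automaticity and change of base

coprime-suc : ∀ n → Coprime n (suc n)
coprime-suc n {i} (i∣n , i∣1+n) = ℕ∣.∣1⇒≡1 (ℕ∣.∣m+n∣m⇒∣n (subst (i ℕ∣.∣_) (ℕ.+-comm 1 n) i∣1+n) i∣n)

-- From kᵉ = (k + 1)ᶜ it would follow that k ≥ 2 divides a number coprime to it.
suc-independent : ∀ {k} → 2 ≤ k → ∀ e c → 1 ≤ e → 1 ≤ c → k ^ℕ e ≢ suc k ^ℕ c
suc-independent {k} k≥2 (suc e) c _ _ eq = ℕ.<⇒≢ k≥2 (sym (coprime-^ʳ c (coprime-suc k)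
  (ℕ∣.∣-refl , subst (k ℕ∣.∣_) eq (ℕ∣.m∣m*n (k ^ℕ e)))))

module StrictlyAutomaticSequences (em : ExcludedMiddle 0ℓ) {A : Set} where
  open Classical em
  open Kernel em

  -- A periodic sequence is automatic in every base, in particular in base k + 1, which is
  -- multiplicatively independent of k.
  strictly-automatic⇒aperiodic : ∀ k (a : ℕ → A) T → StrictlyAutomatic k a → ¬ IsPeriod T a
  strictly-automatic⇒aperiodic k a T ((k≥2 , _) , strict) period = strict (suc k) (ℕ.≤-trans k≥2 (ℕ.n≤1+n k)) (suc-independent k≥2)
    (ℕ.≤-trans k≥2 (ℕ.n≤1+n k) , periodic⇒finite-kernel {a = a} {T} period (suc k))

  -- k and K are multiplicatively dependent, since a is both k- and K-automatic.
  strictly-automatic-transfer : ∀ k K (a a′ : ℕ → A) → StrictlyAutomatic K a → StrictlyAutomatic K a′ →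
                                StrictlyAutomatic k a → StrictlyAutomatic k a′
  strictly-automatic-transfer k K a a′ (_ , strict) ((_ , kernel) , strict′) (automatic@(k≥2 , _) , _) =
      transfer (¬¬-elim λ independent → strict k k≥2 (λ e c e≥1 c≥1 eq → independent (e , c , e≥1 , c≥1 , eq)) automatic)
    where
    transfer : ∃[ e ] ∃[ c ] (1 ≤ e × 1 ≤ c × K ^ℕ e ≡ k ^ℕ c) → StrictlyAutomatic k a′
    transfer (e , c , e≥1 , c≥1 , K^e≡k^c) =
      (k≥2 , finite-kernel-root {a = a′} c (ℕ.≤-trans (s≤s z≤n) k≥2) c≥1
        (subst (λ n → FiniteKernel n a′) K^e≡k^c (finite-kernel-power {a = a′} e kernel))) ,
      λ m m≥2 independent → strict′ m m≥2 λ e′ c′ e′≥1 c′≥1 K^e′≡m^c′ →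
        independent (c *ℕ e′) (c′ *ℕ e) (ℕ.*-mono-≤ c≥1 e′≥1) (ℕ.*-mono-≤ c′≥1 e≥1) (begin
          k ^ℕ (c *ℕ e′)   ≡⟨ ℕ.^-*-assoc k c e′ ⟨
          (k ^ℕ c) ^ℕ e′   ≡⟨ cong (_^ℕ e′) K^e≡k^c ⟨
          (K ^ℕ e) ^ℕ e′   ≡⟨ ℕ.^-*-assoc K e e′ ⟩
          K ^ℕ (e *ℕ e′)   ≡⟨ cong (K ^ℕ_) (ℕ.*-comm e e′) ⟩
          K ^ℕ (e′ *ℕ e)   ≡⟨ ℕ.^-*-assoc K e′ e ⟨
          (K ^ℕ e′) ^ℕ e   ≡⟨ cong (_^ℕ e) K^e′≡m^c′ ⟩
          (m ^ℕ c′) ^ℕ e   ≡⟨ ℕ.^-*-assoc m c′ e ⟩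
          m ^ℕ (c′ *ℕ e)   ∎)
      where open ≡-Reasoning

-- The trichotomy and its independence of d

module Conclusion (em : ExcludedMiddle 0ℓ) {s : ℕ} (s≥2 : 2 ≤ s) (B : Factorisation s)
  (f : ∀ i → ℤₚ (Factorisation.p B i) → ℚₚ (Factorisation.p B i)) (analytic : ∀ i → Analytic (f i))
  (f≢0 : ∀ i → ¬ (∀ x → f i x ≈ 0#)) where

  open Factorisation B
  open Kernel em
  open StrictlyAutomaticSequences em
  open AnalyticFamily em s≥2 B f analytic f≢0

  Classified : (ℕ → ℕ → ℕ) → Set
  Classified seq =
    (∀ d → 1 ≤ d →
      (Empty (Roots f) → ∃[ t ] IsPeriod (b ^ℕ t) (seq d))
      ×
      (∀ θ → Rational θ → Roots f ≐ (θ ≈b_) →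
        (m : Fin s → ℕ) → (∀ i → IsMultiplicity (f i) (θ i) (m i)) →
        (w : Fin s → ℕ) → (∀ i → 1 ≤ w i) → (∀ i j → w i *ℕ m i ≡ w j *ℕ m j) →
        StrictlyAutomatic (Π (λ i → bᵢ i ^ℕ w i)) (seq d))
      ×
      (¬ Empty (Roots f) →
        ¬ (∃[ θ ] Rational θ × Roots f ≐ (θ ≈b_)) →
        ¬ Automatic (seq d)))
    ×
    (∀ d d′ → 1 ≤ d → 1 ≤ d′ →
      ((∃[ t ] IsPeriod (b ^ℕ t) (seq d)) ⇔ (∃[ t ] IsPeriod (b ^ℕ t) (seq d′)))
      ×
      (∀ k → StrictlyAutomatic k (seq d) ⇔ StrictlyAutomatic k (seq d′))
      ×
      (Automatic (seq d) ⇔ Automatic (seq d′)))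

  -- Each case is a statement about all d at once, so every equivalence between d and d′ is settled
  -- inside a single case. The rational case keeps only the common base K.
  data Case : Set where
    no-roots      : Empty (Roots f) → Case
    rational      : ∃[ K ] (∀ d → 1 ≤ d → StrictlyAutomatic K (sequence d)) → Case
    not-automatic : (∀ d → 1 ≤ d → ¬ Automatic (sequence d)) → Case

  case : Case
  case = roots-empty? em
    where
    unique? : ¬ Empty (Roots f) → Dec (∃[ θ ] (Rational θ × Roots f ≐ (θ ≈b_))) → Case
    unique? nonempty (yes unique) = rational (rational-root⇒strict-base unique)
    unique? nonempty (no ¬unique) = not-automatic λ d d≥1 automatic → ¬unique (automatic⇒unique-rational-root d d≥1 nonempty automatic)
    roots-empty? : Dec (Empty (Roots f)) → Case
    roots-empty? (yes empty)   = no-roots empty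
    roots-empty? (no nonempty) = unique? nonempty em

  periodic⇒automatic : ∀ (a : ℕ → ℕ) → ∃[ t ] IsPeriod (b ^ℕ t) a → Automatic a
  periodic⇒automatic a (t , period) = 2 , ℕ.≤-refl , periodic⇒finite-kernel {a = a} {b ^ℕ t} period 2

  periodic→ : Case → ∀ d d′ → 1 ≤ d → 1 ≤ d′ → ∃[ t ] IsPeriod (b ^ℕ t) (sequence d) → ∃[ t ] IsPeriod (b ^ℕ t) (sequence d′)
  periodic→ (no-roots empty) d d′ d≥1 d′≥1 period = no-roots⇒periodic d′ d′≥1 empty
  periodic→ (rational (K , strict)) d d′ d≥1 d′≥1 (t , period) =
    contradiction period (strictly-automatic⇒aperiodic K (sequence d) (b ^ℕ t) (strict d d≥1))
  periodic→ (not-automatic h) d d′ d≥1 d′≥1 period = contradiction (periodic⇒automatic (sequence d) period) (h d d≥1)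

  strict→ : Case → ∀ d d′ → 1 ≤ d → 1 ≤ d′ → ∀ k → StrictlyAutomatic k (sequence d) → StrictlyAutomatic k (sequence d′)
  strict→ (no-roots empty) d d′ d≥1 d′≥1 k strict = refute (no-roots⇒periodic d d≥1 empty)
    where
    refute : ∃[ t ] IsPeriod (b ^ℕ t) (sequence d) → StrictlyAutomatic k (sequence d′)
    refute (t , period) = contradiction period (strictly-automatic⇒aperiodic k (sequence d) (b ^ℕ t) strict)
  strict→ (rational (K , strict-K)) d d′ d≥1 d′≥1 k strict =
    strictly-automatic-transfer k K (sequence d) (sequence d′) (strict-K d d≥1) (strict-K d′ d′≥1) strict
  strict→ (not-automatic h) d d′ d≥1 d′≥1 k strict = contradiction (k , proj₁ strict) (h d d≥1)

  automatic→ : Case → ∀ d d′ → 1 ≤ d → 1 ≤ d′ → Automatic (sequence d) → Automatic (sequence d′)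
  automatic→ (no-roots empty) d d′ d≥1 d′≥1 automatic = periodic⇒automatic (sequence d′) (no-roots⇒periodic d′ d′≥1 empty)
  automatic→ (rational (K , strict)) d d′ d≥1 d′≥1 automatic = K , proj₁ (strict d′ d′≥1)
  automatic→ (not-automatic h) d d′ d≥1 d′≥1 automatic = contradiction automatic (h d d≥1)

  classified : Classified sequence
  classified =
    (λ d d≥1 → no-roots⇒periodic d d≥1 , rational-root⇒strictly-automatic d d≥1 ,
      λ nonempty not-unique automatic → not-unique (automatic⇒unique-rational-root d d≥1 nonempty automatic)) ,
    λ d d′ d≥1 d′≥1 →
      mk⇔ (periodic→ case d d′ d≥1 d′≥1) (periodic→ case d′ d d′≥1 d≥1) ,
      (λ k → mk⇔ (strict→ case d d′ d≥1 d′≥1 k) (strict→ case d′ d d′≥1 d≥1 k)) ,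
      mk⇔ (automatic→ case d d′ d≥1 d′≥1) (automatic→ case d′ d d′≥1 d≥1)

theorem2p8 :
  (em : ExcludedMiddle 0ℓ)
  {s : ℕ} → 2 ≤ s →
  (B : Factorisation s) →
  let open Factorisation B in
  (f : ∀ i → ℤₚ (p i) → ℚₚ (p i)) →
  (∀ i → Analytic (f i)) →
  (∀ i → ¬ (∀ x → f i x ≈ 0#)) →
  let seq : ℕ → ℕ → ℕ
      seq d n = ℓ em d (λ i → f i (fromℕ n))
  in
  (∀ d → 1 ≤ d →
    (Empty (Roots f) → ∃[ t ] IsPeriod (b ^ℕ t) (seq d))
    ×
    (∀ θ → Rational θ → Roots f ≐ (θ ≈b_) →
      (m : Fin s → ℕ) → (∀ i → IsMultiplicity (f i) (θ i) (m i)) →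
      (w : Fin s → ℕ) → (∀ i → 1 ≤ w i) → (∀ i j → w i *ℕ m i ≡ w j *ℕ m j) →
      StrictlyAutomatic (Π (λ i → bᵢ i ^ℕ w i)) (seq d))
    ×
    (¬ Empty (Roots f) →
      ¬ (∃[ θ ] Rational θ × Roots f ≐ (θ ≈b_)) →
      ¬ Automatic (seq d)))
  ×
  (∀ d d′ → 1 ≤ d → 1 ≤ d′ →
    ((∃[ t ] IsPeriod (b ^ℕ t) (seq d)) ⇔ (∃[ t ] IsPeriod (b ^ℕ t) (seq d′)))
    ×
    (∀ k → StrictlyAutomatic k (seq d) ⇔ StrictlyAutomatic k (seq d′))
    ×
    (Automatic (seq d) ⇔ Automatic (seq d′)))
theorem2p8 em s≥2 B f analytic f≢0 = subst Classified sequence≡ℓ classified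
  where
  open AnalyticFamily em s≥2 B f analytic f≢0
  open Conclusion em s≥2 B f analytic f≢0
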